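{- There is an absolute constant $C>0$ such that for every $n\ge 1$ and every $0<\varepsilon\le 1$, the cardinal complexity (with parameter $\varepsilon$) of the game of googol with $n$ numbers is at most $\left(\frac{Cn}{\varepsilon}\right)^n$.
   Context: Game of googol. There are $n$ slips with distinct integers from $[N]=\{1,\dots,N\}$: the adversary picks an $n$-element set $S\subseteq[N]$, the numbers are assigned to the slips by a uniformly random permutation $\sigma$, and the slips arrive in a uniformly random order $\pi$. At each step the algorithm sees the next number and irrevocably accepts or rejects it; at most one number may be accepted. The reward is $1$ if the accepted number is the largest of $S$, and $0$ otherwise. A general (cardinal) algorithm's decision at step $k$ may depend on the identities and values of the first $k$ numbers; an ordinal algorithm's decision may depend only on the identities and on the relative ranking of the first $k$ numbers. Algorithms may be randomized. Cardinal complexity. For a parameter $\varepsilon>0$, the cardinal complexity of the game is the minimum $N$ such that there is a distribution $\mathcal{F}$ over $n$-element subsets of $[N]$ for which, when $S\sim\mathcal{F}$ (independently of $\sigma,\pi$), the maximum expected reward over all algorithms (even knowing $\mathcal{F}$) is at most $(1+\varepsilon)$ times the maximum expected reward over ordinal algorithms. -}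

module Defs where

open import Data.Bool using (Bool; if_then_else_)
open import Data.Fin using (Fin; punchIn)
import Data.Fin as Fin
import Data.Fin.Properties as Fin
open import Data.Integer using (+_)
open import Data.List using (List; []; _∷_; map; foldr; concatMap; allFin)
open import Data.List.Relation.Unary.All using (All)
open import Data.Maybe using (Maybe; just; nothing; maybe)
open import Data.Nat using (ℕ; zero; suc; _⊔_; _!)
import Data.Nat as ℕ
import Data.Nat.Properties as ℕ
open import Data.Product using (Σ; ∃; ∃₂; _×_; _,_; proj₁; proj₂)
open import Data.Rational using (ℚ; 0ℚ; 1ℚ; ½; _+_; _*_; _-_; _/_; ∣_∣; 1/_; _≤_; _<_; Positive; positive; nonNegative)
open import Data.Rational.Properties
open import Data.Rational.Solver using (module +-*-Solver)
open import Data.Unit using (⊤)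
open import Data.Vec using (Vec; lookup; _∷ʳ_)
import Data.Vec as Vec
open import Data.Vec.Relation.Unary.All using (all?)
open import Data.Vec.Relation.Unary.Linked using (Linked)
open import Function.Bundles using (_⇔_)
open import Relation.Binary.PropositionalEquality using (_≡_; refl; sym; trans; cong; cong₂; subst)
open import Relation.Nullary using (does)

------------------------------------------------------------------------
-- Real numbers: Cauchy sequences of rationals, compared by _≤ᴿ_, with
-- _≃ᴿ_ as equality.

Eventually : (ℕ → Set) → Set
Eventually P = ∃ λ M → ∀ m → M ℕ.≤ m → P m

record ℝ : Set where
  constructor mkℝ
  field
    seq    : ℕ → ℚ
    cauchy : ∀ δ → 0ℚ < δ →
             ∃ λ M → ∀ m n → M ℕ.≤ m → M ℕ.≤ n → ∣ seq m - seq n ∣ ≤ δ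

open ℝ public

infix  4 _≤ᴿ_ _<ᴿ_ _≃ᴿ_
infixl 6 _+ᴿ_
infixl 7 _*ᴿ_
infixr 8 _^ᴿ_

_≤ᴿ_ : ℝ → ℝ → Set
x ≤ᴿ y = ∀ δ → 0ℚ < δ → Eventually λ m → seq x m ≤ seq y m + δ

_<ᴿ_ : ℝ → ℝ → Set
x <ᴿ y = ∃ λ δ → 0ℚ < δ × Eventually λ m → seq x m + δ ≤ seq y m

_≃ᴿ_ : ℝ → ℝ → Set
x ≃ᴿ y = x ≤ᴿ y × y ≤ᴿ x

fromℚ : ℚ → ℝ
fromℚ q = mkℝ (λ _ → q) λ δ 0<δ → 0 , λ _ _ _ _ →
  ≤-trans (≤-reflexive (cong ∣_∣ (+-inverseʳ q))) (<⇒≤ 0<δ)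

fromℕ : ℕ → ℝ
fromℕ n = fromℚ (+ n / 1)

0ᴿ 1ᴿ : ℝ
0ᴿ = fromℚ 0ℚ
1ᴿ = fromℚ 1ℚ

private
  open +-*-Solver using (solve; _:+_; _:*_; _:-_; _:=_)

  ½+½ : ∀ δ → ½ * δ + ½ * δ ≡ δ
  ½+½ δ = trans (sym (*-distribʳ-+ δ ½ ½)) (*-identityˡ δ)

  0<½* : ∀ {δ} → 0ℚ < δ → 0ℚ < ½ * δ
  0<½* {δ} 0<δ = subst (_< ½ * δ) (*-zeroʳ ½) (*-monoʳ-<-pos ½ 0<δ)

  bounded : (x : ℝ) → ∃ λ K → 0ℚ < K × Eventually λ m → ∣ seq x m ∣ ≤ K
  bounded x = 1ℚ + ∣ c ∣ , 0<K , M , λ m M≤m → begin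
      ∣ seq x m ∣               ≡⟨ cong ∣_∣ (solve 2 (λ a b → a := (a :- b) :+ b) refl (seq x m) c) ⟩
      ∣ (seq x m - c) + c ∣     ≤⟨ ∣p+q∣≤∣p∣+∣q∣ (seq x m - c) c ⟩
      ∣ seq x m - c ∣ + ∣ c ∣   ≤⟨ +-monoˡ-≤ ∣ c ∣ (proj₂ (cauchy x 1ℚ 0<1) m M M≤m ℕ.≤-refl) ⟩
      1ℚ + ∣ c ∣                ∎
    where
    open ≤-Reasoning
    0<1 : 0ℚ < 1ℚ
    0<1 = positive⁻¹ 1ℚ
    M : ℕ
    M = proj₁ (cauchy x 1ℚ 0<1)
    c : ℚ
    c = seq x M
    0<K : 0ℚ < 1ℚ + ∣ c ∣
    0<K = +-mono-<-≤ 0<1 (0≤∣p∣ c)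

  *-mono : ∀ {a b c d} → 0ℚ ≤ b → 0ℚ ≤ c → a ≤ c → b ≤ d → a * b ≤ c * d
  *-mono {b = b} {c = c} 0≤b 0≤c a≤c b≤d = ≤-trans
    (*-monoʳ-≤-nonNeg b {{nonNegative 0≤b}} a≤c)
    (*-monoˡ-≤-nonNeg c {{nonNegative 0≤c}} b≤d)

_+ᴿ_ : ℝ → ℝ → ℝ
seq (x +ᴿ y) m = seq x m + seq y m
cauchy (x +ᴿ y) δ 0<δ =
  let (M , hx) = cauchy x (½ * δ) (0<½* 0<δ)
      (K , hy) = cauchy y (½ * δ) (0<½* 0<δ)
  in M ⊔ K , λ m n p q →
    let a = seq x m ; b = seq y m ; c = seq x n ; d = seq y n in
    begin
      ∣ (a + b) - (c + d) ∣       ≡⟨ cong ∣_∣ (solve 4 (λ a b c d → (a :+ b) :- (c :+ d) := (a :- c) :+ (b :- d)) refl a b c d) ⟩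
      ∣ (a - c) + (b - d) ∣       ≤⟨ ∣p+q∣≤∣p∣+∣q∣ (a - c) (b - d) ⟩
      ∣ a - c ∣ + ∣ b - d ∣       ≤⟨ +-mono-≤ (hx m n (ℕ.m⊔n≤o⇒m≤o M K p) (ℕ.m⊔n≤o⇒m≤o M K q))
                                              (hy m n (ℕ.m⊔n≤o⇒n≤o M K p) (ℕ.m⊔n≤o⇒n≤o M K q)) ⟩
      ½ * δ + ½ * δ               ≡⟨ ½+½ δ ⟩
      δ                           ∎
  where open ≤-Reasoning

_*ᴿ_ : ℝ → ℝ → ℝ
seq (x *ᴿ y) m = seq x m * seq y m
cauchy (x *ᴿ y) δ 0<δ =
  let (P , hP) = cauchy x η 0<η
      (Q , hQ) = cauchy y η 0<η
      R = P ⊔ Q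
      T = A ⊔ B
  in R ⊔ T , λ m n p q →
    let a = seq x m ; b = seq y m ; c = seq x n ; d = seq y n
        pR = ℕ.m⊔n≤o⇒m≤o R T p ; qR = ℕ.m⊔n≤o⇒m≤o R T q
        pT = ℕ.m⊔n≤o⇒n≤o R T p ; qT = ℕ.m⊔n≤o⇒n≤o R T q
    in begin
      ∣ a * b - c * d ∣                       ≡⟨ cong ∣_∣ (solve 4 (λ a b c d → a :* b :- c :* d := a :* (b :- d) :+ (a :- c) :* d) refl a b c d) ⟩
      ∣ a * (b - d) + (a - c) * d ∣           ≤⟨ ∣p+q∣≤∣p∣+∣q∣ (a * (b - d)) ((a - c) * d) ⟩
      ∣ a * (b - d) ∣ + ∣ (a - c) * d ∣       ≡⟨ cong₂ _+_ (∣p*q∣≡∣p∣*∣q∣ a (b - d)) (∣p*q∣≡∣p∣*∣q∣ (a - c) d) ⟩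
      ∣ a ∣ * ∣ b - d ∣ + ∣ a - c ∣ * ∣ d ∣   ≤⟨ +-mono-≤
                                                   (*-mono (0≤∣p∣ (b - d)) (<⇒≤ 0<K) (hA m (ℕ.m⊔n≤o⇒m≤o A B pT))
                                                     (hQ m n (ℕ.m⊔n≤o⇒n≤o P Q pR) (ℕ.m⊔n≤o⇒n≤o P Q qR)))
                                                   (*-mono (0≤∣p∣ d) (<⇒≤ 0<η)
                                                     (hP m n (ℕ.m⊔n≤o⇒m≤o P Q pR) (ℕ.m⊔n≤o⇒m≤o P Q qR))
                                                     (hB n (ℕ.m⊔n≤o⇒n≤o A B qT))) ⟩
      K * η + η * L                           ≡⟨ solve 3 (λ K L η → K :* η :+ η :* L := η :* (K :+ L)) refl K L η ⟩
      δ * 1/ (K + L) * (K + L)                ≡⟨ *-assoc δ (1/ (K + L)) (K + L) ⟩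
      δ * (1/ (K + L) * (K + L))              ≡⟨ cong (δ *_) (*-inverseˡ (K + L)) ⟩
      δ * 1ℚ                                  ≡⟨ *-identityʳ δ ⟩
      δ                                       ∎
  where
  open ≤-Reasoning
  K L : ℚ
  K = proj₁ (bounded x)
  L = proj₁ (bounded y)
  0<K = proj₁ (proj₂ (bounded x))
  0<L = proj₁ (proj₂ (bounded y))
  A B : ℕ
  A = proj₁ (proj₂ (proj₂ (bounded x)))
  B = proj₁ (proj₂ (proj₂ (bounded y)))
  hA = proj₂ (proj₂ (proj₂ (bounded x)))
  hB = proj₂ (proj₂ (proj₂ (bounded y)))
  instance
    K+L>0 : Positive (K + L)
    K+L>0 = positive (+-mono-< 0<K 0<L)
    K+L≢0 = pos⇒nonZero (K + L)
    inv>0 : Positive (1/ (K + L))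
    inv>0 = 1/pos⇒pos (K + L)
  η : ℚ
  η = δ * 1/ (K + L)
  0<η : 0ℚ < η
  0<η = subst (_< η) (*-zeroˡ (1/ (K + L))) (*-monoˡ-<-pos (1/ (K + L)) 0<δ)

_^ᴿ_ : ℝ → ℕ → ℝ
x ^ᴿ zero  = 1ᴿ
x ^ᴿ suc n = x *ᴿ x ^ᴿ n

------------------------------------------------------------------------
-- Finitely supported probability distributions. An outcome may be listed
-- several times; its probability is then the sum of its weights.

sumᴿ : List ℝ → ℝ
sumᴿ = foldr _+ᴿ_ 0ᴿ

record Dist (A : Set) : Set where
  field
    outcomes : List (ℝ × A)
    weight≥0 : All (λ o → 0ᴿ ≤ᴿ proj₁ o) outcomes
    total≃1  : sumᴿ (map proj₁ outcomes) ≃ᴿ 1ᴿ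

open Dist public

𝔼 : {A : Set} → Dist A → (A → ℝ) → ℝ
𝔼 D f = sumᴿ (map (λ (w , a) → w *ᴿ f a) (outcomes D))

-- All permutations of Fin n in one-line notation, each listed once: choose
-- the image i of the first index, and send the other indices into the
-- complement of i.
permutations : ∀ n → List (Vec (Fin n) n)
permutations zero    = Vec.[] ∷ []
permutations (suc n) =
  concatMap (λ i → map (λ p → i Vec.∷ Vec.map (punchIn i) p) (permutations n)) (allFin (suc n))

uniformPermutation : ∀ n → (Vec (Fin n) n → ℚ) → ℚ
uniformPermutation n f =
  (+ 1 / (n !)) {{n ℕ.!≢0}} * foldr _+_ 0ℚ (map f (permutations n))

------------------------------------------------------------------------
-- The game. The element x of Fin N stands for the integer x + 1 of [N].

-- An n-element subset of [N], given by its elements in increasing order.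
record NSubset (N n : ℕ) : Set where
  constructor mkNSubset
  field
    elements   : Vec (Fin N) n
    increasing : Linked Fin._<_ elements

open NSubset public

-- What is observed at one step: the identity of the slip and its number.
Observation : ℕ → ℕ → Set
Observation N n = Fin n × Fin N

-- Observations so far, in order of arrival.
History : ℕ → ℕ → ℕ → Set
History N n k = Vec (Observation N n) k

-- A deterministic algorithm: given the first k observations, whether to
-- accept the k-th one.
Algorithm : ℕ → ℕ → Set
Algorithm N n = ∀ k → History N n k → Bool

SameIdentities : ∀ {N n k} → History N n k → History N n k → Set
SameIdentities h h′ = Vec.map proj₁ h ≡ Vec.map proj₁ h′

SameRanking : ∀ {N n k} → History N n k → History N n k → Set
SameRanking h h′ = ∀ i j →
  (proj₂ (lookup h  i) Fin.< proj₂ (lookup h  j)) ⇔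
  (proj₂ (lookup h′ i) Fin.< proj₂ (lookup h′ j))

Ordinal : ∀ {N n} → Algorithm N n → Set
Ordinal {N} {n} A = ∀ k (h h′ : History N n k) →
  SameIdentities h h′ → SameRanking h h′ → A k h ≡ A k h′

Cardinal : ∀ {N n} → Algorithm N n → Set
Cardinal _ = ⊤

-- The first accepted observation, if any, when `seen` has been rejected and
-- the given observations are still to come.
run : ∀ {N n k l} → Algorithm N n → (seen : History N n k) →
      Vec (Observation N n) l → Maybe (Observation N n)
run A seen Vec.[]       = nothing
run A seen (x Vec.∷ xs) =
  if A _ (seen ∷ʳ x) then just x else run A (seen ∷ʳ x) xs

-- Slip i carries the element of S of rank σ i; the slip arriving at step k
-- is π k.
arrivals : ∀ {N n} → NSubset N n → (σ π : Vec (Fin n) n) → Vec (Observation N n) n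
arrivals S σ π = Vec.map (λ i → i , lookup (elements S) (lookup σ i)) π

reward : ∀ {N n} → NSubset N n → Maybe (Observation N n) → ℚ
reward S = maybe
  (λ (_ , v) → if does (all? (Fin._≤? v) (elements S)) then 1ℚ else 0ℚ)
  0ℚ

winProbability : ∀ {N n} → Algorithm N n → NSubset N n → ℚ
winProbability {n = n} A S =
  uniformPermutation n λ σ → uniformPermutation n λ π →
    reward S (run A Vec.[] (arrivals S σ π))

-- A randomized algorithm is a random choice of a deterministic one, made
-- independently of S, σ and π.
Randomized : ∀ {N n} → (Algorithm N n → Set) → Set
Randomized {N} {n} P = Dist (Σ (Algorithm N n) P)

expectedReward : ∀ {N n} {P : Algorithm N n → Set} →
                 Dist (NSubset N n) → Randomized P → ℝ
expectedReward F 𝒜 = 𝔼 𝒜 λ (A , _) → 𝔼 F λ S → fromℚ (winProbability A S)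

IsMaxReward : ∀ {N n} → Dist (NSubset N n) → (Algorithm N n → Set) → ℝ → Set
IsMaxReward F P v =
  (∃ λ (𝒜 : Randomized P) → expectedReward F 𝒜 ≃ᴿ v) ×
  (∀ (𝒜 : Randomized P) → expectedReward F 𝒜 ≤ᴿ v)

Admissible : ℕ → ℝ → ℕ → Set
Admissible n ε N = ∃ λ (F : Dist (NSubset N n)) → ∃₂ λ v w →
  IsMaxReward F Cardinal v × IsMaxReward F Ordinal w × v ≤ᴿ (1ᴿ +ᴿ ε) *ᴿ w

IsCardinalComplexity : ℕ → ℝ → ℕ → Set
IsCardinalComplexity n ε κ =
  Admissible n ε κ × (∀ N → Admissible n ε N → κ ℕ.≤ N)

-- N ≤ (C n / ε) ^ n, with the denominator ε ^ n > 0 cleared.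
WithinBound : ℝ → ℕ → ℝ → ℕ → Set
WithinBound C n ε N = fromℕ N *ᴿ ε ^ᴿ n ≤ᴿ (C *ᴿ fromℕ n) ^ᴿ n

-- The minimum of {N | Admissible n ε N} is at most (C n / ε) ^ n. For real ε
-- the minimum cannot be located constructively, so the first
-- component supplies an admissible N within the bound, which in particular
-- says that the set is nonempty.
CardinalComplexity≤ : ℝ → ℕ → ℝ → Set
CardinalComplexity≤ C n ε =
  (∃ λ N → Admissible n ε N × WithinBound C n ε N) ×
  (∀ κ → IsCardinalComplexity n ε κ → WithinBound C n ε κ)

-- The adversary draws the n numbers from a hierarchy with n − 1 levels of digits
-- in base M. At each level a cluster of n numbers either keeps a common digit or
-- splits into a lower part with digit d and an upper part with digit d + 1, the
-- lower part having size i with weight 1/i. If digits are read cyclically mod M,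
-- then at every time k, whatever the values and the record flags seen so far, the
-- next value is a record with probability exactly 1/(k + 1), so that cardinal
-- algorithms gain nothing over the ordinal threshold rule. Excluding the pair
-- (M − 1, 0) at each of the n − 1 splits, which turns the cyclic order into the
-- order of the numbers, multiplies probabilities by at most (M/(M − 1))ⁿ⁻¹, and
-- this is at most 1 + ε for M of order n/ε.

module Submission where

open import Data.Bool using (Bool; true; false; _∧_; if_then_else_)
open import Data.Bool.ListAction using (all)
open import Data.Bool.Properties as Bool using (∧-assoc; ∧-comm; ∧-zeroʳ; ∧-identityʳ)
open import Data.Empty using (⊥-elim)
open import Data.Fin as Fin using (Fin; zero; suc; inject₁; toℕ; combine; punchIn)
import Data.Fin.Properties as Fin
open import Data.Integer as ℤ using ()
import Data.Integer.Properties as ℤ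
open import Data.List using (List; []; _∷_; _++_; _∷ʳ_; map; length; reverse; foldl; foldr;
  concatMap; allFin; tabulate; cartesianProduct; cartesianProductWith; upTo)
import Data.List.Properties as List
open import Data.List.Membership.Propositional using (_∈_)
open import Data.List.Membership.Propositional.Properties
  using (∈-allFin; ∈-upTo⁺; ∈-cartesianProduct⁺; ∈-cartesianProductWith⁺; ∈-map⁺; ∈-concat⁺′)
open import Data.List.Relation.Binary.Permutation.Propositional
  using (_↭_; prep; swap; ↭-refl; ↭-trans; ↭-sym; ↭⇒↭ₛ)
open import Data.List.Relation.Binary.Permutation.Propositional.Properties
  using (↭-length; ↭-reverse; All-resp-↭)
import Data.List.Relation.Binary.Permutation.Setoid.Properties as PermutationSetoid
open import Data.List.Relation.Unary.All as All using (All; []; _∷_)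
import Data.List.Relation.Unary.All.Properties as All
open import Data.List.Relation.Unary.AllPairs as AllPairs using (AllPairs; []; _∷_)
import Data.List.Relation.Unary.AllPairs.Properties as AllPairs
open import Data.List.Relation.Unary.Any using (here; there)
open import Data.Maybe using (just)
open import Data.Nat as ℕ using (ℕ; zero; suc; _≤_; z≤n; s≤s; _∸_; _^_; _!)
import Data.Nat.Properties as ℕ
open import Data.Product using (Σ; ∃; ∃₂; _×_; _,_; proj₁; proj₂; uncurry)
import Data.Product.Properties as Product
open import Data.Rational as ℚ
  using (ℚ; 0ℚ; 1ℚ; ½; _+_; _*_; _-_; -_; 1/_; _/_; _⊔_; ∣_∣; Positive; positive; mkℚ)
  renaming (_≤_ to _≤ℚ_; _<_ to _<ℚ_)
import Data.Rational.Properties as ℚ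
open import Data.Rational.Solver using (module +-*-Solver)
import Data.Rational.Unnormalised as ℚᵘ
import Data.Rational.Unnormalised.Properties as ℚᵘ
open import Data.Sum as Sum using (_⊎_; inj₁; inj₂)
open import Data.Unit using (⊤; tt)
open import Data.Vec as Vec using (Vec; []; _∷_; lookup; removeAt; head; tail; toList; fromList; zipWith)
  renaming (_∷ʳ_ to _▷_)
import Data.Vec.Properties as Vec
open import Data.Vec.Relation.Unary.All as VecAll using ([]; _∷_) renaming (All to VecAll)
import Data.Vec.Relation.Unary.All.Properties as VecAll
open import Data.Vec.Relation.Unary.Linked using (Linked; []; [-]; _∷_)
open import Function using (_∘_; id; flip)
open import Function.Bundles using (mk⇔; Equivalence)
open import Relation.Binary using (DecidableEquality)
open import Relation.Binary.PropositionalEquality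
  using (_≡_; refl; sym; trans; cong; cong₂; subst; subst₂; setoid; resp₂; module ≡-Reasoning)
open import Relation.Nullary using (¬_; Dec; does; yes; no)
open import Relation.Nullary.Decidable using (dec-true; dec-false; does-⇔; ¬?)
open import Defs

open +-*-Solver using (solve; _:+_; _:*_; _:-_; :-_; _:=_; con)

-- Rationals and finite measures

-- In the acyclic law the lower digit of a split is never M - 1 and the upper one never 0, so digits
-- leak where the maximum is. Values therefore carry bits beside their digits, and the order is read
-- off the bits alone: the cyclic law makes sense although its digits may contradict that order, and
-- the winning probability of an algorithm is a functional of digits and record flags defined under
-- both laws.
--
-- The weights come from asking that the law survive deletion of the latest value, and also its
-- deletion when it is a record. Deleting a record shrinks the upper part of a split, so the weight
-- may depend on the lower size only; deleting an arbitrary value then forces 1/i, and the harmonic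
-- weight of staying together collects the splits that lose a part. It is 0 for a cluster with one
-- value more than levels left, which must split.
--
-- One recursion serves twice: with digits visible for the cyclic pairs, where it bounds all
-- algorithms, and with digits hidden for the adjacent pairs, where the threshold rule attains the
-- same value with no factor lost.

ι : ℕ → ℚ
ι zero    = 0ℚ
ι (suc n) = 1ℚ + ι n

n/1≡ι : ∀ n → ℤ.+ n / 1 ≡ ι n
n/1≡ι zero    = refl
n/1≡ι (suc n) = trans (ℚ.toℚᵘ-injective suc≃) (cong (1ℚ +_) (n/1≡ι n))
  where
  open ℚᵘ.≃-Reasoning
  suc≃ : ℚ.toℚᵘ (ℤ.+ suc n / 1) ℚᵘ.≃ ℚ.toℚᵘ (1ℚ + ℤ.+ n / 1)
  suc≃ = begin
    ℚ.toℚᵘ (ℤ.+ suc n / 1)                    ≈⟨ ℚ.toℚᵘ-fromℚᵘ (ℚᵘ.mkℚᵘ (ℤ.+ suc n) 0) ⟩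
    ℚᵘ.mkℚᵘ (ℤ.+ suc n) 0              ≈⟨ ℚᵘ.*≡* (trans (ℤ.*-identityʳ (ℤ.+ suc n)) (sym
                                             (trans (ℤ.*-identityʳ _) (cong (ℤ._+_ (ℤ.+ 1)) (ℤ.*-identityʳ (ℤ.+ n)))))) ⟩
    ℚ.toℚᵘ 1ℚ ℚᵘ.+ ℚᵘ.mkℚᵘ (ℤ.+ n) 0          ≈⟨ ℚᵘ.+-congʳ (ℚ.toℚᵘ 1ℚ) (ℚ.toℚᵘ-fromℚᵘ (ℚᵘ.mkℚᵘ (ℤ.+ n) 0)) ⟨
    ℚ.toℚᵘ 1ℚ ℚᵘ.+ ℚ.toℚᵘ (ℤ.+ n / 1)         ≈⟨ ℚ.toℚᵘ-homo-+ 1ℚ (ℤ.+ n / 1) ⟨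
    ℚ.toℚᵘ (1ℚ + ℤ.+ n / 1)                   ∎

ι-+ : ∀ m n → ι (m ℕ.+ n) ≡ ι m + ι n
ι-+ zero    n = sym (ℚ.+-identityˡ (ι n))
ι-+ (suc m) n = trans (cong (1ℚ +_) (ι-+ m n)) (sym (ℚ.+-assoc 1ℚ (ι m) (ι n)))

ι-* : ∀ m n → ι (m ℕ.* n) ≡ ι m * ι n
ι-* zero    n = sym (ℚ.*-zeroˡ (ι n))
ι-* (suc m) n = trans (ι-+ n (m ℕ.* n)) (trans (cong (_+_ (ι n)) (ι-* m n))
  (solve 2 (λ a b → b :+ a :* b := (con 1ℚ :+ a) :* b) refl (ι m) (ι n)))

-- Lets the ring solver use a hypothesis `a ≡ b`: the equation is proved modulo `a - b`, with
-- cofactor `c`.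
modulo : ∀ {a b p q} c → a ≡ b → p ≡ q + (a - b) * c → p ≡ q
modulo {a} {b} {p} {q} c refl p≡ = trans p≡
  (solve 3 (λ q a c → q :+ (a :- a) :* c := q) refl q a c)

0≤1 : 0ℚ ≤ℚ 1ℚ
0≤1 = ℚ.nonNegative⁻¹ 1ℚ

0≤+ : ∀ {p q} → 0ℚ ≤ℚ p → 0ℚ ≤ℚ q → 0ℚ ≤ℚ p + q
0≤+ = ℚ.+-mono-≤

0≤* : ∀ {p q} → 0ℚ ≤ℚ p → 0ℚ ≤ℚ q → 0ℚ ≤ℚ p * q
0≤* {p} {q} 0≤p 0≤q = subst (_≤ℚ p * q) (ℚ.*-zeroʳ p)
  (ℚ.*-monoˡ-≤-nonNeg p {{ℚ.nonNegative 0≤p}} 0≤q)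

*-monoˡ : ∀ {p q r} → 0ℚ ≤ℚ r → p ≤ℚ q → r * p ≤ℚ r * q
*-monoˡ {r = r} 0≤r = ℚ.*-monoˡ-≤-nonNeg r {{ℚ.nonNegative 0≤r}}

*-monoʳ : ∀ {p q r} → 0ℚ ≤ℚ r → p ≤ℚ q → p * r ≤ℚ q * r
*-monoʳ {r = r} 0≤r = ℚ.*-monoʳ-≤-nonNeg r {{ℚ.nonNegative 0≤r}}

0≤ι : ∀ n → 0ℚ ≤ℚ ι n
0≤ι zero    = ℚ.≤-refl
0≤ι (suc n) = 0≤+ 0≤1 (0≤ι n)

ι-pos : ∀ n → ℚ.Positive (ι (suc n))
ι-pos n = ℚ.positive (ℚ.+-mono-<-≤ (ℚ.positive⁻¹ 1ℚ) (0≤ι n))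

ι-mono : ∀ {m n} → m ≤ n → ι m ≤ℚ ι n
ι-mono {n = n} z≤n = 0≤ι n
ι-mono (s≤s m≤n)   = ℚ.+-monoʳ-≤ 1ℚ (ι-mono m≤n)

-- 1 / (n + 1)
recip : ℕ → ℚ
recip n = (1/ ι (suc n)) {{ℚ.pos⇒nonZero (ι (suc n)) {{ι-pos n}}}}

recip-inverse : ∀ n → ι (suc n) * recip n ≡ 1ℚ
recip-inverse n = ℚ.*-inverseʳ (ι (suc n)) {{ℚ.pos⇒nonZero (ι (suc n)) {{ι-pos n}}}}

0≤recip : ∀ n → 0ℚ ≤ℚ recip n
0≤recip n = ℚ.<⇒≤ (ℚ.positive⁻¹ (recip n) {{ℚ.1/pos⇒pos (ι (suc n)) {{ι-pos n}}}})

recip-cancel : ∀ n x → recip n * (ι (suc n) * x) ≡ x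
recip-cancel n x = trans (sym (ℚ.*-assoc (recip n) (ι (suc n)) x))
  (trans (cong (_* x) (trans (ℚ.*-comm (recip n) (ι (suc n))) (recip-inverse n))) (ℚ.*-identityˡ x))

cancel-recip : ∀ n x → ι (suc n) * (recip n * x) ≡ x
cancel-recip n x = trans (sym (ℚ.*-assoc (ι (suc n)) (recip n) x))
  (trans (cong (_* x) (recip-inverse n)) (ℚ.*-identityˡ x))

-- All sums are treated as functionals on `A → ℚ`, so that each exchange lemma applies to any outer
-- sum. The field `ext` stands in for function extensionality.
record Linear {A : Set} (L : (A → ℚ) → ℚ) : Set where
  field
    ext : ∀ {f g} → (∀ a → f a ≡ g a) → L f ≡ L g
    add : ∀ f g → L (λ a → f a + g a) ≡ L f + L g
    mul : ∀ c f → L (λ a → c * f a) ≡ c * L f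

  vanish : L (λ _ → 0ℚ) ≡ 0ℚ
  vanish = trans (ext λ _ → sym (ℚ.*-zeroˡ 0ℚ)) (trans (mul 0ℚ (λ _ → 0ℚ)) (ℚ.*-zeroˡ (L (λ _ → 0ℚ))))

  const : ∀ c → L (λ _ → c) ≡ c * L (λ _ → 1ℚ)
  const c = trans (ext λ _ → sym (ℚ.*-identityʳ c)) (mul c (λ _ → 1ℚ))

  mulʳ : ∀ c f → L (λ a → f a * c) ≡ L f * c
  mulʳ c f = trans (ext λ a → ℚ.*-comm (f a) c) (trans (mul c f) (ℚ.*-comm c (L f)))

  sub : ∀ f g → L (λ a → f a - g a) ≡ L f - L g
  sub f g = trans (ext λ a → solve 2 (λ x y → x :- y := x :+ con (- 1ℚ) :* y) refl (f a) (g a))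
    (trans (add f (λ a → - 1ℚ * g a)) (trans (cong (_+_ (L f)) (mul (- 1ℚ) g))
      (solve 2 (λ x y → x :+ con (- 1ℚ) :* y := x :- y) refl (L f) (L g))))

Monotone : {A : Set} → ((A → ℚ) → ℚ) → Set
Monotone L = ∀ {f g} → (∀ a → f a ≤ℚ g a) → L f ≤ℚ L g

Measure : Set → Set
Measure A = List (ℚ × A)

∫ : {A : Set} → Measure A → (A → ℚ) → ℚ
∫ []            f = 0ℚ
∫ ((w , a) ∷ m) f = w * f a + ∫ m f

∫-linear : {A : Set} (m : Measure A) → Linear (∫ m)
∫-linear m = record { ext = ext m ; add = λ f g → add m {f} {g} ; mul = λ c f → mul m {c} {f} }
  where
  ext : ∀ m {f g} → (∀ a → f a ≡ g a) → ∫ m f ≡ ∫ m g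
  ext []            f≡g = refl
  ext ((w , a) ∷ m) f≡g = cong₂ _+_ (cong (w *_) (f≡g a)) (ext m f≡g)
  add : ∀ m {f g} → ∫ m (λ a → f a + g a) ≡ ∫ m f + ∫ m g
  add []                    = refl
  add ((w , a) ∷ m) {f} {g} = trans (cong (_+_ (w * (f a + g a))) (add m {f} {g}))
    (solve 5 (λ w x y s t → w :* (x :+ y) :+ (s :+ t) := (w :* x :+ s) :+ (w :* y :+ t)) refl
      w (f a) (g a) (∫ m f) (∫ m g))
  mul : ∀ m {c f} → ∫ m (λ a → c * f a) ≡ c * ∫ m f
  mul []            {c}     = sym (ℚ.*-zeroʳ c)
  mul ((w , a) ∷ m) {c} {f} = trans (cong (_+_ (w * (c * f a))) (mul m {c} {f}))
    (solve 4 (λ w c x s → w :* (c :* x) :+ c :* s := c :* (w :* x :+ s)) refl w c (f a) (∫ m f))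

module ∫ {A : Set} (m : Measure A) = Linear (∫-linear m)

∫-cong : ∀ {A : Set} {P : A → Set} {m : Measure A} {f g} → All (P ∘ proj₂) m →
         (∀ a → P a → f a ≡ g a) → ∫ m f ≡ ∫ m g
∫-cong []       f≡g = refl
∫-cong {m = (w , a) ∷ m} (p ∷ ps) f≡g = cong₂ _+_ (cong (w *_) (f≡g a p)) (∫-cong ps f≡g)

NonNeg : {A : Set} → Measure A → Set
NonNeg = All (λ o → 0ℚ ≤ℚ proj₁ o)

∫-mono : {A : Set} {m : Measure A} → NonNeg m → Monotone (∫ m)
∫-mono []          f≤g = ℚ.≤-refl
∫-mono (0≤w ∷ 0≤m) f≤g = ℚ.+-mono-≤ (*-monoˡ 0≤w (f≤g _)) (∫-mono 0≤m f≤g)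

∫-0≤ : {A : Set} {m : Measure A} {f : A → ℚ} → NonNeg m → (∀ a → 0ℚ ≤ℚ f a) → 0ℚ ≤ℚ ∫ m f
∫-0≤ []          0≤f = ℚ.≤-refl
∫-0≤ (0≤w ∷ 0≤m) 0≤f = 0≤+ (0≤* 0≤w (0≤f _)) (∫-0≤ 0≤m 0≤f)

∫-++ : {A : Set} (m m′ : Measure A) (f : A → ℚ) → ∫ (m ++ m′) f ≡ ∫ m f + ∫ m′ f
∫-++ []            m′ f = sym (ℚ.+-identityˡ (∫ m′ f))
∫-++ ((w , a) ∷ m) m′ f = trans (cong (_+_ (w * f a)) (∫-++ m m′ f))
  (sym (ℚ.+-assoc (w * f a) (∫ m f) (∫ m′ f)))

fubini : {A B : Set} {L : (A → ℚ) → ℚ} → Linear L → (m : Measure B) (f : A → B → ℚ) →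
         L (λ a → ∫ m (f a)) ≡ ∫ m (λ b → L (λ a → f a b))
fubini lin []            f = Linear.vanish lin
fubini lin ((w , b) ∷ m) f = trans (Linear.add lin (λ a → w * f a b) (λ a → ∫ m (f a)))
  (cong₂ _+_ (Linear.mul lin w (λ a → f a b)) (fubini lin m f))

infixl 1 _>>=_

abstract

  dirac : {A : Set} → A → Measure A
  dirac a = (1ℚ , a) ∷ []

  ∫-dirac : {A : Set} (a : A) (f : A → ℚ) → ∫ (dirac a) f ≡ f a
  ∫-dirac a f = trans (ℚ.+-identityʳ (1ℚ * f a)) (ℚ.*-identityˡ (f a))

  scale : {A : Set} → ℚ → Measure A → Measure A
  scale c = map (λ (w , a) → c * w , a)

  ∫-scale : {A : Set} (c : ℚ) (m : Measure A) (f : A → ℚ) → ∫ (scale c m) f ≡ c * ∫ m f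
  ∫-scale c []            f = sym (ℚ.*-zeroʳ c)
  ∫-scale c ((w , a) ∷ m) f = trans (cong (_+_ (c * w * f a)) (∫-scale c m f))
    (solve 4 (λ c w x s → c :* w :* x :+ c :* s := c :* (w :* x :+ s)) refl c w (f a) (∫ m f))

  _>>=_ : {A B : Set} → Measure A → (A → Measure B) → Measure B
  []            >>= k = []
  ((w , a) ∷ m) >>= k = scale w (k a) ++ (m >>= k)

  ∫->>= : {A B : Set} (m : Measure A) (k : A → Measure B) (f : B → ℚ) →
          ∫ (m >>= k) f ≡ ∫ m (λ a → ∫ (k a) f)
  ∫->>= []            k f = refl
  ∫->>= ((w , a) ∷ m) k f = trans (∫-++ (scale w (k a)) (m >>= k) f)
    (cong₂ _+_ (∫-scale w (k a) f) (∫->>= m k f))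

  All-dirac : {A : Set} {P : A → Set} {a : A} → P a → All (P ∘ proj₂) (dirac a)
  All-dirac p = p ∷ []

  All-scale : {A : Set} {P : A → Set} (c : ℚ) {m : Measure A} →
              All (P ∘ proj₂) m → All (P ∘ proj₂) (scale c m)
  All-scale c []       = []
  All-scale c (p ∷ ps) = p ∷ All-scale c ps

  All->>= : {A B : Set} {P : A → Set} {Q : B → Set} {m : Measure A} {k : A → Measure B} →
            All (P ∘ proj₂) m → (∀ a → P a → All (Q ∘ proj₂) (k a)) → All (Q ∘ proj₂) (m >>= k)
  All->>= []       q = []
  All->>= {m = (w , a) ∷ m} (p ∷ ps) q = All.++⁺ (All-scale w (q a p)) (All->>= ps q)

  NonNeg-dirac : {A : Set} {a : A} → NonNeg (dirac a)
  NonNeg-dirac = 0≤1 ∷ []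

  NonNeg-scale : {A : Set} {c : ℚ} {m : Measure A} → 0ℚ ≤ℚ c → NonNeg m → NonNeg (scale c m)
  NonNeg-scale 0≤c []                  = []
  NonNeg-scale {c = c} 0≤c (0≤w ∷ 0≤m) = 0≤* {c} 0≤c 0≤w ∷ NonNeg-scale 0≤c 0≤m

  NonNeg->>= : {A B : Set} {m : Measure A} {k : A → Measure B} →
               NonNeg m → (∀ a → NonNeg (k a)) → NonNeg (m >>= k)
  NonNeg->>= []          0≤k = []
  NonNeg->>= {m = (w , a) ∷ m} (0≤w ∷ 0≤m) 0≤k = All.++⁺ (NonNeg-scale {c = w} 0≤w (0≤k a)) (NonNeg->>= 0≤m 0≤k)

-- Orderings and interleavings

select : {A : Set} → List A → (A × List A → ℚ) → ℚ
select []       G = 0ℚ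
select (x ∷ xs) G = G (x , xs) + select xs (λ (y , r) → G (y , x ∷ r))

-- Unnormalised: each of the n! orderings counts once, which keeps divisions out of the recursions.
-- The number is meant to be the length of the list and makes the recursion structural.
orderings : {A : Set} → ℕ → List A → (List A → ℚ) → ℚ
orderings zero    xs f = f []
orderings (suc n) xs f = select xs λ (x , r) → orderings n r λ ys → f (x ∷ ys)

shuffles : {A : Set} → List A → List A → (List A → ℚ) → ℚ
shuffles []       ys       f = f ys
shuffles (x ∷ xs) []       f = f (x ∷ xs)
shuffles (x ∷ xs) (y ∷ ys) f =
  shuffles xs (y ∷ ys) (λ zs → f (x ∷ zs)) + shuffles (x ∷ xs) ys (λ zs → f (y ∷ zs))

interchange : ∀ a b c d → (a + b) + (c + d) ≡ (a + c) + (b + d)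
interchange = solve 4 (λ a b c d → (a :+ b) :+ (c :+ d) := (a :+ c) :+ (b :+ d)) refl

select-linear : {A : Set} (xs : List A) → Linear (select xs)
select-linear xs = record { ext = ext xs ; add = add xs ; mul = mul xs }
  where
  ext : ∀ xs {f g} → (∀ a → f a ≡ g a) → select xs f ≡ select xs g
  ext []       f≡g = refl
  ext (x ∷ xs) f≡g = cong₂ _+_ (f≡g _) (ext xs λ _ → f≡g _)
  add : ∀ xs f g → select xs (λ o → f o + g o) ≡ select xs f + select xs g
  add []       f g = refl
  add (x ∷ xs) f g = trans (cong (_+_ (f (x , xs) + g (x , xs))) (add xs _ _))
    (interchange (f (x , xs)) (g (x , xs)) _ _)
  mul : ∀ xs c f → select xs (λ o → c * f o) ≡ c * select xs f
  mul []       c f = sym (ℚ.*-zeroʳ c)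
  mul (x ∷ xs) c f = trans (cong (_+_ (c * f (x , xs))) (mul xs c _)) (sym (ℚ.*-distribˡ-+ c _ _))

module select {A : Set} (xs : List A) = Linear (select-linear xs)

orderings-linear : {A : Set} (n : ℕ) (xs : List A) → Linear (orderings n xs)
orderings-linear n xs = record { ext = ext n xs ; add = add n xs ; mul = mul n xs }
  where
  ext : ∀ n xs {f g} → (∀ a → f a ≡ g a) → orderings n xs f ≡ orderings n xs g
  ext zero    xs f≡g = f≡g []
  ext (suc n) xs f≡g = select.ext xs λ (x , r) → ext n r λ ys → f≡g (x ∷ ys)
  add : ∀ n xs f g → orderings n xs (λ o → f o + g o) ≡ orderings n xs f + orderings n xs g
  add zero    xs f g = refl
  add (suc n) xs f g = trans (select.ext xs λ (x , r) → add n r _ _) (select.add xs _ _)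
  mul : ∀ n xs c f → orderings n xs (λ o → c * f o) ≡ c * orderings n xs f
  mul zero    xs c f = refl
  mul (suc n) xs c f = trans (select.ext xs λ (x , r) → mul n r c _) (select.mul xs c _)

module orderings {A : Set} (n : ℕ) (xs : List A) = Linear (orderings-linear n xs)

shuffles-linear : {A : Set} (xs ys : List A) → Linear (shuffles xs ys)
shuffles-linear xs ys = record { ext = ext xs ys ; add = add xs ys ; mul = mul xs ys }
  where
  ext : ∀ xs ys {f g} → (∀ a → f a ≡ g a) → shuffles xs ys f ≡ shuffles xs ys g
  ext []       ys       f≡g = f≡g ys
  ext (x ∷ xs) []       f≡g = f≡g (x ∷ xs)
  ext (x ∷ xs) (y ∷ ys) f≡g = cong₂ _+_ (ext xs (y ∷ ys) λ _ → f≡g _) (ext (x ∷ xs) ys λ _ → f≡g _)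
  add : ∀ xs ys f g → shuffles xs ys (λ o → f o + g o) ≡ shuffles xs ys f + shuffles xs ys g
  add []       ys       f g = refl
  add (x ∷ xs) []       f g = refl
  add (x ∷ xs) (y ∷ ys) f g =
    trans (cong₂ _+_ (add xs (y ∷ ys) (λ zs → f (x ∷ zs)) (λ zs → g (x ∷ zs)))
                     (add (x ∷ xs) ys (λ zs → f (y ∷ zs)) (λ zs → g (y ∷ zs))))
      (interchange (shuffles xs (y ∷ ys) λ zs → f (x ∷ zs)) (shuffles xs (y ∷ ys) λ zs → g (x ∷ zs))
        (shuffles (x ∷ xs) ys λ zs → f (y ∷ zs)) (shuffles (x ∷ xs) ys λ zs → g (y ∷ zs)))
  mul : ∀ xs ys c f → shuffles xs ys (λ o → c * f o) ≡ c * shuffles xs ys f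
  mul []       ys       c f = refl
  mul (x ∷ xs) []       c f = refl
  mul (x ∷ xs) (y ∷ ys) c f =
    trans (cong₂ _+_ (mul xs (y ∷ ys) c _) (mul (x ∷ xs) ys c _)) (sym (ℚ.*-distribˡ-+ c _ _))

module shuffles {A : Set} (xs ys : List A) = Linear (shuffles-linear xs ys)

select-mono : {A : Set} (xs : List A) → Monotone (select xs)
select-mono []       f≤g = ℚ.≤-refl
select-mono (x ∷ xs) f≤g = ℚ.+-mono-≤ (f≤g _) (select-mono xs λ _ → f≤g _)

orderings-mono : {A : Set} (n : ℕ) (xs : List A) → Monotone (orderings n xs)
orderings-mono zero    xs f≤g = f≤g []
orderings-mono (suc n) xs f≤g = select-mono xs λ (x , r) → orderings-mono n r λ ys → f≤g (x ∷ ys)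

select-comm : {A B : Set} {L : (A → ℚ) → ℚ} → Linear L → (xs : List B) (G : A → B × List B → ℚ) →
              L (λ a → select xs (G a)) ≡ select xs (λ o → L (λ a → G a o))
select-comm lin []       G = Linear.vanish lin
select-comm {L = L} lin (x ∷ xs) G = trans
  (Linear.add lin (λ a → G a (x , xs)) (λ a → select xs (λ (y , r) → G a (y , x ∷ r))))
  (cong (_+_ (L (λ a → G a (x , xs)))) (select-comm lin xs (λ a (y , r) → G a (y , x ∷ r))))

select-map : {A B : Set} (φ : A → B) (xs : List A) (G : B × List B → ℚ) →
             select (map φ xs) G ≡ select xs (λ (x , r) → G (φ x , map φ r))
select-map φ []       G = refl
select-map φ (x ∷ xs) G = cong (_+_ (G (φ x , map φ xs))) (select-map φ xs (λ (y , r) → G (y , φ x ∷ r)))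

orderings-map : {A B : Set} (φ : A → B) (n : ℕ) (xs : List A) (f : List B → ℚ) →
                orderings n (map φ xs) f ≡ orderings n xs (λ ys → f (map φ ys))
orderings-map φ zero    xs f = refl
orderings-map φ (suc n) xs f =
  trans (select-map φ xs _) (select.ext xs λ (x , r) → orderings-map φ n r _)

select-++ : {A : Set} (xs ys : List A) (G : A × List A → ℚ) →
            select (xs ++ ys) G ≡
            select xs (λ (x , r) → G (x , r ++ ys)) + select ys (λ (y , r) → G (y , xs ++ r))
select-++ []       ys G = sym (ℚ.+-identityˡ _)
select-++ (x ∷ xs) ys G = trans
  (cong (_+_ (G (x , xs ++ ys))) (select-++ xs ys (λ (y , r) → G (y , x ∷ r))))
  (sym (ℚ.+-assoc (G (x , xs ++ ys)) (select xs (λ (y , r) → G (y , x ∷ r ++ ys)))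
    (select ys (λ (y , r) → G (y , x ∷ xs ++ r)))))

select-cong : {A : Set} (xs : List A) {f g : A × List A → ℚ} →
              (∀ x r → x ∷ r ↭ xs → f (x , r) ≡ g (x , r)) → select xs f ≡ select xs g
select-cong []       f≡g = refl
select-cong (x ∷ xs) f≡g = cong₂ _+_ (f≡g x xs ↭-refl)
  (select-cong xs λ y r p → f≡g y (x ∷ r) (↭-trans (swap y x ↭-refl) (prep x p)))

select-length : {A : Set} (xs : List A) {n : ℕ} {f g : A × List A → ℚ} → length xs ≡ suc n →
                (∀ x r → length r ≡ n → f (x , r) ≡ g (x , r)) → select xs f ≡ select xs g
select-length xs |xs| f≡g = select-cong xs λ x r p →
  f≡g x r (ℕ.suc-injective (trans (↭-length p) |xs|))

orderings-cong : {A : Set} (n : ℕ) (xs : List A) {f g : List A → ℚ} → length xs ≡ n →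
                 (∀ ys → ys ↭ xs → f ys ≡ g ys) → orderings n xs f ≡ orderings n xs g
orderings-cong zero    []  _    f≡g = f≡g [] ↭-refl
orderings-cong (suc n) xs  |xs| f≡g = select-cong xs λ x r p →
  orderings-cong n r (ℕ.suc-injective (trans (↭-length p) |xs|)) λ ys q →
    f≡g (x ∷ ys) (↭-trans (prep x q) p)

-- An ordering of the whole amounts to an ordering of each part and an interleaving. The induction
-- asks from which part the first element comes. This is how the orderings of a split cluster reduce
-- to those of its parts.
orderings-++ : {A : Set} (i j : ℕ) (xs ys : List A) → length xs ≡ i → length ys ≡ j → (f : List A → ℚ) →
               orderings (i ℕ.+ j) (xs ++ ys) f ≡
               orderings i xs (λ us → orderings j ys (λ vs → shuffles us vs f))
orderings-++ zero    j       []       ys |xs| |ys| f = refl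
orderings-++ (suc i) zero    xs       [] |xs| |ys| f
  rewrite List.++-identityʳ xs | ℕ.+-identityʳ i =
  orderings.ext (suc i) xs {f} {λ us → shuffles us [] f} λ { [] → refl ; (_ ∷ _) → refl }
orderings-++ (suc i) (suc j) xs       ys |xs| |ys| f = begin
  orderings (suc i ℕ.+ suc j) (xs ++ ys) f
    ≡⟨ select-++ xs ys (λ (x , r) → orderings (i ℕ.+ suc j) r (λ zs → f (x ∷ zs))) ⟩
  select xs (λ (x , r) → orderings (i ℕ.+ suc j) (r ++ ys) (λ zs → f (x ∷ zs))) +
  select ys (λ (y , r) → orderings (i ℕ.+ suc j) (xs ++ r) (λ zs → f (y ∷ zs)))
    ≡⟨ cong₂ _+_
         (select-length xs |xs| λ x r |r| → orderings-++ i (suc j) r ys |r| |ys| (λ zs → f (x ∷ zs)))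
         (select-length ys |ys| λ y r |r| →
           trans (cong (λ n → orderings n (xs ++ r) (λ zs → f (y ∷ zs))) (ℕ.+-suc i j))
             (orderings-++ (suc i) j xs r |xs| |r| (λ zs → f (y ∷ zs)))) ⟩
  left + select ys (λ (y , r) → orderings (suc i) xs (λ us → right us (y , r)))
    ≡⟨ cong (_+_ left) (sym (select-comm (orderings-linear (suc i) xs) ys right)) ⟩
  left + orderings (suc i) xs (λ us → select ys (right us))
    ≡⟨ sym (select.add xs (λ (x , r) → orderings i r (λ us → select ys (left′ x us)))
                          (λ (x , r) → orderings i r (λ us → select ys (right (x ∷ us))))) ⟩
  select xs (λ (x , r) → orderings i r (λ us → select ys (left′ x us)) +
                         orderings i r (λ us → select ys (right (x ∷ us))))
    ≡⟨ (select.ext xs λ (x , r) → trans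
         (sym (orderings.add i r (λ us → select ys (left′ x us)) (λ us → select ys (right (x ∷ us)))))
         (orderings.ext i r λ us → trans
           (sym (select.add ys (left′ x us) (right (x ∷ us))))
           (select.ext ys λ (y , r′) → sym (orderings.add j r′
             (λ vs → shuffles us (y ∷ vs) (λ zs → f (x ∷ zs)))
             (λ vs → shuffles (x ∷ us) vs (λ zs → f (y ∷ zs))))))) ⟩
  orderings (suc i) xs (λ us → orderings (suc j) ys (λ vs → shuffles us vs f))
    ∎
  where
  open ≡-Reasoning
  left′ : _ → List _ → _ × List _ → ℚ
  left′ x us (y , r) = orderings j r (λ vs → shuffles us (y ∷ vs) (λ zs → f (x ∷ zs)))
  left : ℚ
  left = select xs (λ (x , r) → orderings i r (λ us → select ys (left′ x us)))
  right : List _ → _ × List _ → ℚ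
  right us (y , r) = orderings j r (λ vs → shuffles us vs (λ zs → f (y ∷ zs)))

select-swap : {A : Set} (xs : List A) (H : A → A → List A → ℚ) →
              select xs (λ (x , r) → select r (λ (y , r′) → H x y r′)) ≡
              select xs (λ (x , r) → select r (λ (y , r′) → H y x r′))
select-swap []       H = refl
select-swap (x ∷ xs) H = begin
  first + select xs (λ (y , r) → H y x r + select r (λ (z , r′) → H y z (x ∷ r′)))
    ≡⟨ cong (_+_ first) (select.add xs (λ (y , r) → H y x r)
         (λ (y , r) → select r (λ (z , r′) → H y z (x ∷ r′)))) ⟩
  first + (second + select xs (λ (y , r) → select r (λ (z , r′) → H y z (x ∷ r′))))
    ≡⟨ cong (λ s → first + (second + s)) (select-swap xs (λ y z r → H y z (x ∷ r))) ⟩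
  first + (second + rest)
    ≡⟨ solve 3 (λ a b c → a :+ (b :+ c) := b :+ (a :+ c)) refl first second rest ⟩
  second + (first + rest)
    ≡⟨ cong (_+_ second) (sym (select.add xs (λ (y , r) → H x y r)
         (λ (y , r) → select r (λ (z , r′) → H z y (x ∷ r′))))) ⟩
  second + select xs (λ (y , r) → H x y r + select r (λ (z , r′) → H z y (x ∷ r′)))
    ∎
  where
  open ≡-Reasoning
  first second rest : ℚ
  first  = select xs (λ (y , r) → H x y r)
  second = select xs (λ (y , r) → H y x r)
  rest   = select xs (λ (y , r) → select r (λ (z , r′) → H z y (x ∷ r′)))

orderings-last : {A : Set} (n : ℕ) (xs : List A) (f : List A → ℚ) →
                 orderings (suc n) xs f ≡ select xs (λ (x , r) → orderings n r (λ ys → f (ys ∷ʳ x)))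
orderings-last zero    xs f = refl
orderings-last (suc n) xs f = trans
  (select.ext xs λ (x , r) → orderings-last n r (λ ys → f (x ∷ ys)))
  (select-swap xs (λ x y r → orderings n r (λ ys → f (x ∷ ys ∷ʳ y))))

-- Needed because the game deals values in order of arrival, while views list the latest arrival
-- first.
orderings-reverse : {A : Set} (n : ℕ) (xs : List A) (f : List A → ℚ) →
                    orderings n xs (λ ys → f (reverse ys)) ≡ orderings n xs f
orderings-reverse zero    xs f = refl
orderings-reverse (suc n) xs f = trans
  (select.ext xs λ (x , r) → trans
    (orderings.ext n r λ ys → cong f (List.unfold-reverse x ys))
    (orderings-reverse n r (λ ys → f (ys ∷ʳ x))))
  (sym (orderings-last n xs f))

select-const : {A : Set} (xs : List A) (c : ℚ) → select xs (λ _ → c) ≡ ι (length xs) * c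
select-const []       c = sym (ℚ.*-zeroˡ c)
select-const (x ∷ xs) c = trans (cong (_+_ c) (select-const xs c))
  (solve 2 (λ c n → c :+ n :* c := (con 1ℚ :+ n) :* c) refl c (ι (length xs)))

orderings-1 : {A : Set} (n : ℕ) (xs : List A) → length xs ≡ n → orderings n xs (λ _ → 1ℚ) ≡ ι (n !)
orderings-1 zero    xs |xs| = refl
orderings-1 (suc n) xs |xs| = trans
  (select-length xs {f = λ (x , r) → orderings n r (λ _ → 1ℚ)} |xs| λ x r |r| → orderings-1 n r |r|)
  (trans (select-const xs (ι (n !))) (trans (cong (λ k → ι k * ι (n !)) |xs|) (sym (ι-* (suc n) (n !)))))

-- The hierarchy

-- A value is a string of base-M digits. The bit beside a digit says on which
-- side of the cluster's split the value lies; the true order of the values is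
-- the lexicographic order of the bits, and players only see the digits.
Value : ℕ → ℕ → Set
Value M h = Vec (Fin M × Bool) h

_≺_ : ∀ {M h} → Value M h → Value M h → Bool
[]               ≺ []               = false
((_ , false) ∷ x) ≺ ((_ , false) ∷ y) = x ≺ y
((_ , false) ∷ x) ≺ ((_ , true)  ∷ y) = true
((_ , true)  ∷ x) ≺ ((_ , false) ∷ y) = false
((_ , true)  ∷ x) ≺ ((_ , true)  ∷ y) = x ≺ y

isRecord : ∀ {M h} → Value M h → List (Value M h) → Bool
isRecord x xs = all (_≺ x) xs

⟦_⟧ : Bool → ℚ
⟦ b ⟧ = if b then 1ℚ else 0ℚ

-- 1/(k+1) + … + 1/(k+e)
harmonic : ℕ → ℕ → ℚ
harmonic k zero    = 0ℚ
harmonic k (suc e) = recip k + harmonic (suc k) e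

0≤harmonic : ∀ k e → 0ℚ ≤ℚ harmonic k e
0≤harmonic k zero    = ℚ.≤-refl
0≤harmonic k (suc e) = 0≤+ (0≤recip k) (0≤harmonic (suc k) e)

harmonic-pos : ∀ h → ℚ.Positive (harmonic 0 (suc h))
harmonic-pos h = ℚ.positive (ℚ.+-mono-<-≤
  (ℚ.positive⁻¹ (recip 0)) (0≤harmonic 1 h))

-- A cluster of n ≤ h + 2 values on h + 1 levels splits with weights 1, 1/2, ..., 1/(n - 1) and
-- stays together with weight 1/n + ... + 1/(h + 1). The total is the same harmonic number for all
-- these n, so one normalisation serves clusters of different sizes.
recipHarmonic : ℕ → ℚ
recipHarmonic h = (1/ harmonic 0 (suc h)) {{ℚ.pos⇒nonZero (harmonic 0 (suc h)) {{harmonic-pos h}}}}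

recipHarmonic-inverse : ∀ h → recipHarmonic h * harmonic 0 (suc h) ≡ 1ℚ
recipHarmonic-inverse h = ℚ.*-inverseˡ (harmonic 0 (suc h)) {{ℚ.pos⇒nonZero (harmonic 0 (suc h)) {{harmonic-pos h}}}}

0≤recipHarmonic : ∀ h → 0ℚ ≤ℚ recipHarmonic h
0≤recipHarmonic h = ℚ.<⇒≤ (ℚ.positive⁻¹ (recipHarmonic h) {{ℚ.1/pos⇒pos (harmonic 0 (suc h)) {{harmonic-pos h}}}})

module Hierarchy {M : ℕ} (digit : Measure (Fin M)) (pair : Measure (Fin M × Fin M)) where

  -- The list of values is in increasing order. A cluster of n ≥ 1 values splits
  -- into a lower part of size i and an upper part of size n − i with weight 1/i,
  -- and stays together for one more level with weight 1/n + … + 1/(h+1). This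
  -- is the law under which the digits carry no information on where the
  -- maximum is.
  mutual

    hierarchy : ∀ h → ℕ → Measure (List (Value M h))
    hierarchy h       zero          = dirac []
    hierarchy zero    (suc zero)    = dirac ([] ∷ [])
    hierarchy zero    (suc (suc n)) = []
    hierarchy (suc h) (suc k)       = scale (recipHarmonic h) (together h k (suc h ∸ k) ++ split h 0 k)

    together : ∀ h → ℕ → ℕ → Measure (List (Value M (suc h)))
    together h k zero    = []
    together h k (suc e) = scale (harmonic k (suc e))
      (digit >>= λ c → hierarchy h (suc k) >>= λ xs → dirac (map ((c , false) ∷_) xs))

    -- The splits into sizes (i + 1, j), (i + 2, j − 1), …, (i + j, 1).
    split : ∀ h → ℕ → ℕ → Measure (List (Value M (suc h)))
    split h i zero    = []
    split h i (suc j) = scale (recip i)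
      (pair >>= λ (a , b) → hierarchy h (suc i) >>= λ xs → hierarchy h (suc j) >>= λ ys →
        dirac (map ((a , false) ∷_) xs ++ map ((b , true) ∷_) ys)) ++ split h (suc i) j

  mutual

    hierarchy-length : ∀ h n → All (λ o → length (proj₂ o) ≡ n) (hierarchy h n)
    hierarchy-length h       zero          = All-dirac refl
    hierarchy-length zero    (suc zero)    = All-dirac refl
    hierarchy-length zero    (suc (suc n)) = []
    hierarchy-length (suc h) (suc k)       = All-scale (recipHarmonic h)
      (All.++⁺ (together-length h k (suc h ∸ k)) (split-length h 0 k k refl))

    together-length : ∀ h k e → All (λ o → length (proj₂ o) ≡ suc k) (together h k e)
    together-length h k zero    = []
    together-length h k (suc e) = All-scale (harmonic k (suc e))
      (All->>= (All.universal (λ _ → tt) digit) λ c _ →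
       All->>= (hierarchy-length h (suc k)) λ xs |xs| → All-dirac (trans (List.length-map _ xs) |xs|))

    split-length : ∀ h i j k → i ℕ.+ j ≡ k → All (λ o → length (proj₂ o) ≡ suc k) (split h i j)
    split-length h i zero    k i+j≡k = []
    split-length h i (suc j) k i+j≡k = All.++⁺
      (All-scale (recip i)
        (All->>= (All.universal (λ _ → tt) pair) λ (a , b) _ →
         All->>= (hierarchy-length h (suc i)) λ xs |xs| →
         All->>= (hierarchy-length h (suc j)) λ ys |ys| →
           All-dirac (trans (List.length-++ (map _ xs)) (trans
             (cong₂ ℕ._+_ (trans (List.length-map _ xs) |xs|) (trans (List.length-map _ ys) |ys|))
             (cong suc i+j≡k)))))
      (split-length h (suc i) j k (trans (sym (ℕ.+-suc i j)) i+j≡k))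

  mutual

    hierarchy-nonNeg : NonNeg digit → NonNeg pair → ∀ h n → NonNeg (hierarchy h n)
    hierarchy-nonNeg d p h       zero          = NonNeg-dirac
    hierarchy-nonNeg d p zero    (suc zero)    = NonNeg-dirac
    hierarchy-nonNeg d p zero    (suc (suc n)) = []
    hierarchy-nonNeg d p (suc h) (suc k)       = NonNeg-scale (0≤recipHarmonic h)
      (All.++⁺ (together-nonNeg d p h k (suc h ∸ k)) (split-nonNeg d p h 0 k))

    together-nonNeg : NonNeg digit → NonNeg pair → ∀ h k e → NonNeg (together h k e)
    together-nonNeg d p h k zero    = []
    together-nonNeg d p h k (suc e) = NonNeg-scale (0≤harmonic k (suc e))
      (NonNeg->>= d λ c → NonNeg->>= (hierarchy-nonNeg d p h (suc k)) λ xs → NonNeg-dirac)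

    split-nonNeg : NonNeg digit → NonNeg pair → ∀ h i j → NonNeg (split h i j)
    split-nonNeg d p h i zero    = []
    split-nonNeg d p h i (suc j) = All.++⁺
      (NonNeg-scale (0≤recip i)
        (NonNeg->>= p λ _ → NonNeg->>= (hierarchy-nonNeg d p h (suc i)) λ xs →
         NonNeg->>= (hierarchy-nonNeg d p h (suc j)) λ ys → NonNeg-dirac))
      (split-nonNeg d p h (suc i) j)

  -- Lists of arrivals have the latest value first.
  P : ∀ h → ℕ → (List (Value M h) → ℚ) → ℚ
  P h n f = ∫ (hierarchy h n) λ xs → orderings n xs f

  P-linear : ∀ h n → Linear (P h n)
  P-linear h n = record
    { ext = λ f≡g → ∫.ext (hierarchy h n) λ xs → orderings.ext n xs f≡g
    ; add = λ f g → trans (∫.ext (hierarchy h n) λ xs → orderings.add n xs f g) (∫.add (hierarchy h n) _ _)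
    ; mul = λ c f → trans (∫.ext (hierarchy h n) λ xs → orderings.mul n xs c f) (∫.mul (hierarchy h n) c _)
    }

  module P (h n : ℕ) = Linear (P-linear h n)

  -- An ordering of n + 1 values is nonempty, so the values of `f` and `g` at `[]` do not matter;
  -- `skip` and `ifRecord` below take a default value there.
  P-∷ : ∀ h n f g → (∀ x xs → f (x ∷ xs) ≡ g (x ∷ xs)) → P h (suc n) f ≡ P h (suc n) g
  P-∷ h n f g f≡g = ∫.ext (hierarchy h (suc n)) λ xs → select.ext xs λ (x , r) → orderings.ext n r λ ys → f≡g x ys

  P-length : ∀ h n f g → (∀ xs → length xs ≡ n → f xs ≡ g xs) → P h n f ≡ P h n g
  P-length h n f g f≡g = ∫-cong (hierarchy-length h n) λ xs |xs| →
    orderings-cong n xs |xs| λ ys ys↭xs → f≡g ys (trans (↭-length ys↭xs) |xs|)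

  P-mono-∷ : NonNeg digit → NonNeg pair → ∀ h n f g → (∀ x xs → f (x ∷ xs) ≤ℚ g (x ∷ xs)) →
             P h (suc n) f ≤ℚ P h (suc n) g
  P-mono-∷ d p h n f g f≤g = ∫-mono (hierarchy-nonNeg d p h (suc n)) λ xs →
    select-mono xs λ (x , r) → orderings-mono n r λ ys → f≤g x ys

  P-0 : ∀ h f → P h 0 f ≡ f []
  P-0 h f = ∫-dirac [] (λ xs → orderings 0 xs f)

  togetherP : ∀ h → ℕ → (List (Value M (suc h)) → ℚ) → ℚ
  togetherP h n f = ∫ digit λ c → P h n λ xs → f (map ((c , false) ∷_) xs)

  splitP : ∀ h → ℕ → ℕ → (List (Value M (suc h)) → ℚ) → ℚ
  splitP h i j f = ∫ pair λ (a , b) → P h i λ xs → P h j λ ys →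
    shuffles (map ((a , false) ∷_) xs) (map ((b , true) ∷_) ys) f

-- The indices are one less than the sizes of the parts, so that `recip i` is the reciprocal of the
-- lower size.
sumSplits : (ℕ → ℕ → ℚ) → ℕ → ℕ → ℚ
sumSplits q i zero    = 0ℚ
sumSplits q i (suc j) = recip i * q i j + sumSplits q (suc i) j

sumSplits-cong : ∀ {q q′} i j → (∀ i′ j′ → i′ ℕ.+ suc j′ ≡ i ℕ.+ j → q i′ j′ ≡ q′ i′ j′) →
                 sumSplits q i j ≡ sumSplits q′ i j
sumSplits-cong i zero    q≡q′ = refl
sumSplits-cong i (suc j) q≡q′ = cong₂ _+_ (cong (recip i *_) (q≡q′ i j refl))
  (sumSplits-cong (suc i) j λ i′ j′ eq → q≡q′ i′ j′ (trans eq (sym (ℕ.+-suc i j))))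

-- For deleting a record, which shrinks the upper part: the weights depend on the lower part only,
-- so all terms are again weighted splits except the last, whose upper part has become empty.
sumSplits-last : ∀ (q : ℕ → ℕ → ℚ) i j →
                 sumSplits (λ i j → q (suc i) j) i (suc j) ≡
                 sumSplits (λ i j → q (suc i) (suc j)) i j + recip (i ℕ.+ j) * q (suc (i ℕ.+ j)) 0
sumSplits-last q i zero    rewrite ℕ.+-identityʳ i =
  ℚ.+-comm (recip i * q (suc i) 0) 0ℚ
sumSplits-last q i (suc j) rewrite ℕ.+-suc i j =
  trans (cong (_+_ (recip i * q (suc i) (suc j))) (sumSplits-last q (suc i) j))
    (sym (ℚ.+-assoc (recip i * q (suc i) (suc j))
      (sumSplits (λ i j → q (suc i) (suc j)) (suc i) j) (recip (suc (i ℕ.+ j)) * q (suc (suc (i ℕ.+ j))) 0)))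

-- For deleting any value. The sizes (i + 1, j + 1) arise from (i + 2, j + 1) with coefficient (i +
-- 2)/(i + 2) = 1 and from (i + 1, j + 2) with (j + 2)/(i + 1); the sum (i + j + 3)/(i + 1) is the
-- old number of values times the weight of the new split. The two outer terms are those in which a
-- part may become empty.
sumSplits-drop : ∀ (q : ℕ → ℕ → ℚ) i j →
                 sumSplits (λ i j → ι (suc i) * q i (suc j) + ι (suc j) * q (suc i) j) i (suc j) ≡
                 q i (suc j) + ι (suc (suc (i ℕ.+ j))) * sumSplits (λ i j → q (suc i) (suc j)) i j +
                 recip (i ℕ.+ j) * q (suc (i ℕ.+ j)) 0
sumSplits-drop q i zero    rewrite ℕ.+-identityʳ i = modulo (q i 1) (recip-inverse i)
  (solve 5 (λ r n N x y → r :* (n :* x :+ (con 1ℚ :+ con 0ℚ) :* y) :+ con 0ℚ :=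
                          x :+ N :* con 0ℚ :+ r :* y :+ (n :* r :- con 1ℚ) :* x) refl
    (recip i) (ι (suc i)) (ι (suc (suc i))) (q i 1) (q (suc i) 0))
sumSplits-drop q i (suc j) rewrite ℕ.+-suc i j = trans
  (cong (_+_ (recip i * (ι (suc i) * q i (suc (suc j)) + ι (suc (suc j)) * q (suc i) (suc j))))
    (sumSplits-drop q (suc i) j))
  (step (recip i) (ι (suc i)) (q i (suc (suc j))) (ι (suc (suc j))) (q (suc i) (suc j))
    (ι (suc (suc (suc (i ℕ.+ j))))) (sumSplits (λ i j → q (suc i) (suc j)) (suc i) j)
    (recip (suc (i ℕ.+ j)) * q (suc (suc (i ℕ.+ j))) 0)
    (recip-inverse i)
    (trans (sym (ι-+ (suc i) (suc (suc j))))
      (cong (λ n → ι (suc n)) (trans (ℕ.+-suc i (suc j)) (cong suc (ℕ.+-suc i j))))))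
  where
  step : ∀ r n x m y N s z → n * r ≡ 1ℚ → n + m ≡ N →
         r * (n * x + m * y) + (y + N * s + z) ≡ x + N * (r * y + s) + z
  step r n x m y N s z n*r≡1 refl = modulo (x - y) n*r≡1
    (solve 7 (λ r n x m y s z → r :* (n :* x :+ m :* y) :+ (y :+ (n :+ m) :* s :+ z) :=
                                x :+ (n :+ m) :* (r :* y :+ s) :+ z :+ (n :* r :- con 1ℚ) :* (x :- y)) refl
      r n x m y s z)

-- Records carry no information

module Recursion {M : ℕ} (digit : Measure (Fin M)) (pair : Measure (Fin M × Fin M)) where

  open Hierarchy digit pair

  ∫together : ∀ h → ℕ → (List (Value M (suc h)) → ℚ) → ℚ
  ∫together h n Φ = ∫ digit λ c → ∫ (hierarchy h n) λ xs → Φ (map ((c , false) ∷_) xs)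

  ∫split : ∀ h → ℕ → ℕ → (List (Value M (suc h)) → ℚ) → ℚ
  ∫split h i j Φ = ∫ pair λ (a , b) → ∫ (hierarchy h i) λ xs → ∫ (hierarchy h j) λ ys →
    Φ (map ((a , false) ∷_) xs ++ map ((b , true) ∷_) ys)

  together-∫ : ∀ h k e Φ → ∫ (together h k e) Φ ≡ harmonic k e * ∫together h (suc k) Φ
  together-∫ h k zero    Φ = sym (ℚ.*-zeroˡ (∫together h (suc k) Φ))
  together-∫ h k (suc e) Φ = trans (∫-scale (harmonic k (suc e)) _ Φ)
    (cong (harmonic k (suc e) *_)
      (trans (∫->>= digit _ Φ) (∫.ext digit λ c →
        trans (∫->>= (hierarchy h (suc k)) _ Φ) (∫.ext (hierarchy h (suc k)) λ xs →
          ∫-dirac (map ((c , false) ∷_) xs) Φ))))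

  split-∫ : ∀ h i j Φ → ∫ (split h i j) Φ ≡ sumSplits (λ i j → ∫split h (suc i) (suc j) Φ) i j
  split-∫ h i zero    Φ = refl
  split-∫ h i (suc j) Φ = trans (∫-++ (scale _ _) (split h (suc i) j) Φ)
    (cong₂ _+_
      (trans (∫-scale (recip i) _ Φ) (cong (recip i *_)
        (trans (∫->>= pair _ Φ) (∫.ext pair λ (a , b) →
          trans (∫->>= (hierarchy h (suc i)) _ Φ) (∫.ext (hierarchy h (suc i)) λ xs →
            trans (∫->>= (hierarchy h (suc j)) _ Φ) (∫.ext (hierarchy h (suc j)) λ ys →
              ∫-dirac (map ((a , false) ∷_) xs ++ map ((b , true) ∷_) ys) Φ))))))
      (split-∫ h (suc i) j Φ))

  hierarchy-∫ : ∀ h k Φ → ∫ (hierarchy (suc h) (suc k)) Φ ≡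
                recipHarmonic h * (harmonic k (suc h ∸ k) * ∫together h (suc k) Φ +
                                   sumSplits (λ i j → ∫split h (suc i) (suc j) Φ) 0 k)
  hierarchy-∫ h k Φ = trans (∫-scale (recipHarmonic h) _ Φ)
    (cong (recipHarmonic h *_) (trans (∫-++ (together h k (suc h ∸ k)) (split h 0 k) Φ)
      (cong₂ _+_ (together-∫ h k (suc h ∸ k) Φ) (split-∫ h 0 k Φ))))

  ∫split-orderings : ∀ h i j f → ∫split h i j (λ zs → orderings (i ℕ.+ j) zs f) ≡ splitP h i j f
  ∫split-orderings h i j f = ∫.ext pair λ (a , b) → at a b
    where
    module _ (a b : Fin M) where
      lo hi : List (Value M h) → List (Value M (suc h))
      lo = map ((a , false) ∷_)
      hi = map ((b , true) ∷_)
      at : ∫ (hierarchy h i) (λ xs → ∫ (hierarchy h j) λ ys → orderings (i ℕ.+ j) (lo xs ++ hi ys) f) ≡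
           P h i (λ xs → P h j λ ys → shuffles (lo xs) (hi ys) f)
      at = ∫-cong (hierarchy-length h i) λ xs |xs| → trans
        (∫-cong (hierarchy-length h j) λ ys |ys| → trans
          (orderings-++ i j (lo xs) (hi ys)
            (trans (List.length-map _ xs) |xs|) (trans (List.length-map _ ys) |ys|) f)
          (trans
            (orderings-map ((a , false) ∷_) i xs (λ us → orderings j (hi ys) λ vs → shuffles us vs f))
            (orderings.ext i xs
              {λ us → orderings j (hi ys) λ vs → shuffles (lo us) vs f}
              {λ us → orderings j ys λ vs → shuffles (lo us) (hi vs) f}
              λ us → orderings-map ((b , true) ∷_) j ys (λ vs → shuffles (lo us) vs f))))
        (sym (fubini (orderings-linear i xs) (hierarchy h j)
          (λ us ys → orderings j ys λ vs → shuffles (lo us) (hi vs) f)))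

  P-suc : ∀ h k f → P (suc h) (suc k) f ≡
          recipHarmonic h * (harmonic k (suc h ∸ k) * togetherP h (suc k) f +
                             sumSplits (λ i j → splitP h (suc i) (suc j) f) 0 k)
  P-suc h k f = trans (hierarchy-∫ h k (λ xs → orderings (suc k) xs f))
    (cong (recipHarmonic h *_) (cong₂ _+_
      (cong (harmonic k (suc h ∸ k) *_) (∫.ext digit λ c → ∫.ext (hierarchy h (suc k)) λ xs →
        orderings-map ((c , false) ∷_) (suc k) xs f))
      (sumSplits-cong 0 k λ i j eq → trans
        (cong (λ n → ∫split h (suc i) (suc j) (λ xs → orderings (suc n) xs f)) (sym eq))
        (∫split-orderings h (suc i) (suc j) f))))

all-map : ∀ {A B : Set} (p : B → Bool) (φ : A → B) xs → all p (map φ xs) ≡ all (λ x → p (φ x)) xs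
all-map p φ []       = refl
all-map p φ (x ∷ xs) = cong (p (φ x) ∧_) (all-map p φ xs)

all-true : ∀ {A : Set} (xs : List A) → all (λ _ → true) xs ≡ true
all-true []       = refl
all-true (x ∷ xs) = all-true xs

isRecord-map : ∀ {M h} (c : Fin M) s (x : Value M h) xs →
               isRecord ((c , s) ∷ x) (map ((c , s) ∷_) xs) ≡ isRecord x xs
isRecord-map c false x xs = all-map _ _ xs
isRecord-map c true  x xs = all-map _ _ xs

-- Whether all elements satisfy `p` is the same for every interleaving, so the record flag of a new
-- value can be taken out of the sum over interleavings of the earlier ones.
shuffles-all : ∀ {A : Set} (p : A → Bool) (xs ys : List A) (F : Bool → List A → ℚ) →
               shuffles xs ys (λ zs → F (all p zs) zs) ≡ shuffles xs ys (λ zs → F (all p xs ∧ all p ys) zs)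
shuffles-all p []       ys       F = refl
shuffles-all p (x ∷ xs) []       F = cong (λ b → F b (x ∷ xs))
  (sym (∧-identityʳ (all p (x ∷ xs))))
shuffles-all p (x ∷ xs) (y ∷ ys) F = cong₂ _+_
  (trans (shuffles-all p xs (y ∷ ys) (λ b zs → F (p x ∧ b) (x ∷ zs)))
    (shuffles.ext xs (y ∷ ys) λ zs → cong (λ b → F b (x ∷ zs)) (sym (∧-assoc (p x) (all p xs) _))))
  (trans (shuffles-all p (x ∷ xs) ys (λ b zs → F (p y ∧ b) (y ∷ zs)))
    (shuffles.ext (x ∷ xs) ys λ zs → cong (λ b → F b (y ∷ zs)) (rotate (p y) (p x ∧ all p xs) (all p ys))))
  where
  rotate : ∀ a b c → a ∧ (b ∧ c) ≡ b ∧ (a ∧ c)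
  rotate a b c = trans (sym (∧-assoc a b c)) (trans (cong (_∧ c) (∧-comm a b)) (∧-assoc b a c))

-- `δ` is what a player sees of a digit: everything for cardinal players, nothing (`D = ⊤`) for
-- ordinal ones.
module Views {M : ℕ} {D : Set} (δ : Fin M → D) where

  View : ℕ → Set
  View h = Vec D h × Bool

  view : ∀ {h} → List (Value M h) → List (View h)
  view []       = []
  view (x ∷ xs) = (Vec.map (λ (c , _) → δ c) x , isRecord x xs) ∷ view xs

  prefix : ∀ {h} → D → List (View h) → List (View (suc h))
  prefix d = map λ (v , r) → d ∷ v , r

  view-map : ∀ {h} c s (xs : List (Value M h)) → view (map ((c , s) ∷_) xs) ≡ prefix (δ c) (view xs)
  view-map c s []       = refl
  view-map c s (x ∷ xs) = cong₂ (λ r vs → (δ c ∷ Vec.map (λ (c , _) → δ c) x , r) ∷ vs)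
    (isRecord-map c s x xs) (view-map c s xs)

  -- Interleaves the views of a lower and an upper part: once the upper part
  -- has begun, the lower part contains no more records.
  merge : ∀ {h} → List (View h) → List (View h) → (List (View h) → ℚ) → ℚ
  merge []             ys       g = g ys
  merge (x ∷ xs)       []       g = g (x ∷ xs)
  merge ((v , r) ∷ xs) (y ∷ ys) g =
    merge xs (y ∷ ys) (λ zs → g ((v , false) ∷ zs)) + merge ((v , r) ∷ xs) ys (λ zs → g (y ∷ zs))

  merge-[] : ∀ {h} (xs : List (View h)) g → merge xs [] g ≡ g xs
  merge-[] []       g = refl
  merge-[] (x ∷ xs) g = refl

  module _ {h : ℕ} (a b : Fin M) where

    private
      lo hi : List (Value M h) → List (Value M (suc h))
      lo = map ((a , false) ∷_)
      hi = map ((b , true) ∷_)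

    not-record-lo : ∀ x xs y ys →
                    isRecord ((a , false) ∷ x) (lo xs) ∧ isRecord ((a , false) ∷ x) (hi (y ∷ ys)) ≡ false
    not-record-lo x xs y ys = ∧-zeroʳ (isRecord ((a , false) ∷ x) (lo xs))

    record-hi : ∀ xs y ys →
                isRecord ((b , true) ∷ y) (lo xs) ∧ isRecord ((b , true) ∷ y) (hi ys) ≡ isRecord y ys
    record-hi xs y ys = trans
      (cong (_∧ isRecord ((b , true) ∷ y) (hi ys)) (trans (all-map _ _ xs) (all-true xs)))
      (isRecord-map b true y ys)

    -- The view of an interleaving is a function of the views of the parts. Hence the laws of the
    -- parts, which speak of views only, can be applied under the interleaving.
    shuffles-view : ∀ xs ys (g : List (View (suc h)) → ℚ) →
                    shuffles (lo xs) (hi ys) (λ zs → g (view zs)) ≡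
                    merge (prefix (δ a) (view xs)) (prefix (δ b) (view ys)) g
    shuffles-view []       ys       g = cong g (view-map b true ys)
    shuffles-view (x ∷ xs) []       g = cong g (view-map a false (x ∷ xs))
    shuffles-view (x ∷ xs) (y ∷ ys) g = cong₂ _+_
      (trans
        (shuffles-all (_≺ ((a , false) ∷ x)) (lo xs) (hi (y ∷ ys)) (λ r zs → g ((_ , r) ∷ view zs)))
        (trans
          (cong (λ r → shuffles (lo xs) (hi (y ∷ ys)) (λ zs → g ((_ , r) ∷ view zs)))
            (not-record-lo x xs y ys))
          (shuffles-view xs (y ∷ ys) (λ vs → g ((_ , false) ∷ vs)))))
      (trans
        (shuffles-all (_≺ ((b , true) ∷ y)) (lo (x ∷ xs)) (hi ys) (λ r zs → g ((_ , r) ∷ view zs)))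
        (trans
          (cong (λ r → shuffles (lo (x ∷ xs)) (hi ys) (λ zs → g ((_ , r) ∷ view zs)))
            (record-hi (x ∷ xs) y ys))
          (shuffles-view (x ∷ xs) ys (λ vs → g ((_ , isRecord y ys) ∷ vs)))))

-- Once a part of a split has been deleted entirely, the player must be unable to tell the remainder
-- from a cluster that stayed together. This is why both marginals of `pair`, as far as `δ` shows
-- them, have to agree with `digit`.
module Process {M : ℕ} (digit : Measure (Fin M)) (pair : Measure (Fin M × Fin M))
  {D : Set} (δ : Fin M → D)
  (mass  : ∫ digit (λ _ → 1ℚ) ≡ 1ℚ)
  (lower : ∀ (g : D → ℚ) → ∫ pair (λ (a , b) → g (δ a)) ≡ ∫ digit (λ c → g (δ c)))
  (upper : ∀ (g : D → ℚ) → ∫ pair (λ (a , b) → g (δ b)) ≡ ∫ digit (λ c → g (δ c)))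
  where

  open Hierarchy digit pair
  open Recursion digit pair
  open Views δ

  skip : ∀ {h} → (List (View h) → ℚ) → List (Value M h) → ℚ
  skip g []       = 0ℚ
  skip g (x ∷ xs) = g (view xs)

  ifRecord : ∀ {h} → (List (View h) → ℚ) → List (Value M h) → ℚ
  ifRecord g []       = 0ℚ
  ifRecord g (x ∷ xs) = ⟦ isRecord x xs ⟧ * g (view xs)

  mergedP : ∀ h → ℕ → ℕ → (List (View (suc h)) → ℚ) → ℚ
  mergedP h i j g = ∫ pair λ (a , b) → P h i λ xs → P h j λ ys →
    merge (prefix (δ a) (view xs)) (prefix (δ b) (view ys)) g

  prefixedP : ∀ h → ℕ → (List (View (suc h)) → ℚ) → ℚ
  prefixedP h n g = ∫ digit λ c → P h n λ xs → g (prefix (δ c) (view xs))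

  mergedP-0ˡ : ∀ h j g → mergedP h 0 j g ≡ prefixedP h j g
  mergedP-0ˡ h j g = trans (∫.ext pair λ (a , b) → P-0 h (λ xs → P h j λ ys →
      merge (prefix (δ a) (view xs)) (prefix (δ b) (view ys)) g))
    (upper λ d → P h j λ ys → g (prefix d (view ys)))

  mergedP-0ʳ : ∀ h i g → mergedP h i 0 g ≡ prefixedP h i g
  mergedP-0ʳ h i g = trans
    (∫.ext pair λ (a , b) → P.ext h i λ xs → trans
      (P-0 h (λ ys → merge (prefix (δ a) (view xs)) (prefix (δ b) (view ys)) g))
      (merge-[] (prefix (δ a) (view xs)) g))
    (lower λ d → P h i λ xs → g (prefix d (view xs)))

  togetherP-view : ∀ h n (g : List (View (suc h)) → ℚ) →
                   togetherP h n (λ xs → g (view xs)) ≡ prefixedP h n g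
  togetherP-view h n g = ∫.ext digit λ c → P.ext h n λ xs → cong g (view-map c false xs)

  splitP-view : ∀ h i j (g : List (View (suc h)) → ℚ) →
                splitP h i j (λ xs → g (view xs)) ≡ mergedP h i j g
  splitP-view h i j g = ∫.ext pair λ (a , b) → P.ext h i λ xs → P.ext h j λ ys → shuffles-view a b xs ys g

  -- Since P h k has total mass k !, these laws say that the next value is a record
  -- with probability 1/(k + 1), independently of what has been seen.
  SkipLaw RecordLaw : ℕ → ℕ → Set
  SkipLaw   h k = ∀ (g : List (View h) → ℚ) → P h (suc k) (skip g) ≡ ι (suc k) * P h k (λ xs → g (view xs))
  RecordLaw h k = ∀ (g : List (View h) → ℚ) → P h (suc k) (ifRecord g) ≡ P h k (λ xs → g (view xs))

  -- The latest arrival lies in the lower or in the upper part. Either way the earlier arrivals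
  -- interleave the other part with the shortened one, to which its own law applies.
  splitP-skip : ∀ h i j → SkipLaw h i → SkipLaw h j → ∀ g →
                splitP h (suc i) (suc j) (skip g) ≡
                ι (suc i) * mergedP h i (suc j) g + ι (suc j) * mergedP h (suc i) j g
  splitP-skip h i j skipⁱ skipʲ g = trans (∫.ext pair λ (a , b) → at a b)
    (trans (∫.add pair _ _) (cong₂ _+_ (∫.mul pair (ι (suc i)) _) (∫.mul pair (ι (suc j)) _)))
    where
    module _ (a b : Fin M) where
      lo hi : List (Value M h) → List (Value M (suc h))
      lo = map ((a , false) ∷_)
      hi = map ((b , true) ∷_)
      m : List (View h) → List (View h) → ℚ
      m vs ws = merge (prefix (δ a) vs) (prefix (δ b) ws) g
      both : ∀ x xs y ys → shuffles (lo (x ∷ xs)) (hi (y ∷ ys)) (skip g) ≡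
             m (view xs) (view (y ∷ ys)) + m (view (x ∷ xs)) (view ys)
      both x xs y ys = cong₂ _+_ (shuffles-view a b xs (y ∷ ys) g) (shuffles-view a b (x ∷ xs) ys g)
      at : P h (suc i) (λ xs → P h (suc j) λ ys → shuffles (lo xs) (hi ys) (skip g)) ≡
           ι (suc i) * P h i (λ xs → P h (suc j) λ ys → m (view xs) (view ys)) +
           ι (suc j) * P h (suc i) (λ xs → P h j λ ys → m (view xs) (view ys))
      at = begin
        P h (suc i) (λ xs → P h (suc j) λ ys → shuffles (lo xs) (hi ys) (skip g))
          ≡⟨ P-∷ h i (λ xs → P h (suc j) λ ys → shuffles (lo xs) (hi ys) (skip g))
                   (λ xs → P h (suc j) λ ys → skip (λ vs → m vs (view ys)) xs + skip (m (view xs)) ys)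
               (λ x xs → P-∷ h j (λ ys → shuffles (lo (x ∷ xs)) (hi ys) (skip g))
                                 (λ ys → m (view xs) (view ys) + skip (m (view (x ∷ xs))) ys)
                           λ y ys → both x xs y ys) ⟩
        P h (suc i) (λ xs → P h (suc j) λ ys → skip (λ vs → m vs (view ys)) xs + skip (m (view xs)) ys)
          ≡⟨ P.ext h (suc i) (λ xs → P.add h (suc j) (λ ys → skip (λ vs → m vs (view ys)) xs)
                                                     (λ ys → skip (m (view xs)) ys)) ⟩
        P h (suc i) (λ xs → P h (suc j) (λ ys → skip (λ vs → m vs (view ys)) xs) +
                            P h (suc j) (skip (m (view xs))))
          ≡⟨ P.add h (suc i) (λ xs → P h (suc j) λ ys → skip (λ vs → m vs (view ys)) xs)
                             (λ xs → P h (suc j) (skip (m (view xs)))) ⟩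
        P h (suc i) (λ xs → P h (suc j) λ ys → skip (λ vs → m vs (view ys)) xs) +
        P h (suc i) (λ xs → P h (suc j) (skip (m (view xs))))
          ≡⟨ cong₂ _+_
               (trans (P-∷ h i (λ xs → P h (suc j) λ ys → skip (λ vs → m vs (view ys)) xs)
                              (skip λ vs → P h (suc j) λ ys → m vs (view ys)) λ x xs → refl)
                 (skipⁱ λ vs → P h (suc j) λ ys → m vs (view ys)))
               (trans (P.ext h (suc i) λ xs → skipʲ (m (view xs)))
                 (P.mul h (suc i) (ι (suc j)) (λ xs → P h j λ ys → m (view xs) (view ys)))) ⟩
        ι (suc i) * P h i (λ xs → P h (suc j) λ ys → m (view xs) (view ys)) +
        ι (suc j) * P h (suc i) (λ xs → P h j λ ys → m (view xs) (view ys))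
          ∎
        where open ≡-Reasoning

  -- A latest arrival from the lower part is no record, because the nonempty upper part has been
  -- seen; one from the upper part is a record exactly if it is one within that part.
  splitP-record : ∀ h i j → RecordLaw h j → ∀ g →
                  splitP h (suc i) (suc j) (ifRecord g) ≡ mergedP h (suc i) j g
  splitP-record h i j recordʲ g = ∫.ext pair λ (a , b) → at a b
    where
    module _ (a b : Fin M) where
      lo hi : List (Value M h) → List (Value M (suc h))
      lo = map ((a , false) ∷_)
      hi = map ((b , true) ∷_)
      m : List (View h) → List (View h) → ℚ
      m vs ws = merge (prefix (δ a) vs) (prefix (δ b) ws) g
      weighted : Bool → List (Value M (suc h)) → ℚ
      weighted r zs = ⟦ r ⟧ * g (view zs)
      both : ∀ x xs y ys → shuffles (lo (x ∷ xs)) (hi (y ∷ ys)) (ifRecord g) ≡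
             ifRecord (m (view (x ∷ xs))) (y ∷ ys)
      both x xs y ys = trans
        (cong₂ _+_
          (trans (shuffles-all (_≺ ((a , false) ∷ x)) (lo xs) (hi (y ∷ ys)) weighted)
            (trans (cong (λ r → shuffles (lo xs) (hi (y ∷ ys)) (weighted r)) (not-record-lo a b x xs y ys))
              (trans (shuffles.mul (lo xs) (hi (y ∷ ys)) 0ℚ (λ zs → g (view zs)))
                (ℚ.*-zeroˡ (shuffles (lo xs) (hi (y ∷ ys)) (λ zs → g (view zs)))))))
          (trans (shuffles-all (_≺ ((b , true) ∷ y)) (lo (x ∷ xs)) (hi ys) weighted)
            (trans (cong (λ r → shuffles (lo (x ∷ xs)) (hi ys) (weighted r)) (record-hi a b (x ∷ xs) y ys))
              (trans (shuffles.mul (lo (x ∷ xs)) (hi ys) ⟦ isRecord y ys ⟧ (λ zs → g (view zs)))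
                (cong (⟦ isRecord y ys ⟧ *_) (shuffles-view a b (x ∷ xs) ys g))))))
        (ℚ.+-identityˡ (⟦ isRecord y ys ⟧ * m (view (x ∷ xs)) (view ys)))
      at : P h (suc i) (λ xs → P h (suc j) λ ys → shuffles (lo xs) (hi ys) (ifRecord g)) ≡
           P h (suc i) (λ xs → P h j λ ys → m (view xs) (view ys))
      at = trans
        (P-∷ h i (λ xs → P h (suc j) λ ys → shuffles (lo xs) (hi ys) (ifRecord g))
                 (λ xs → P h (suc j) (ifRecord (m (view xs))))
           λ x xs → P-∷ h j (λ ys → shuffles (lo (x ∷ xs)) (hi ys) (ifRecord g))
                            (ifRecord (m (view (x ∷ xs))))
             λ y ys → both x xs y ys)
        (P.ext h (suc i) λ xs → recordʲ (m (view xs)))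

  togetherP-skip : ∀ h k → SkipLaw h k → ∀ g →
                   togetherP h (suc k) (skip g) ≡ ι (suc k) * prefixedP h k g
  togetherP-skip h k skipᵏ g = trans
    (∫.ext digit λ c → trans
      (P-∷ h k (λ xs → skip g (map ((c , false) ∷_) xs)) (skip λ vs → g (prefix (δ c) vs))
        λ x xs → cong g (view-map c false xs))
      (skipᵏ λ vs → g (prefix (δ c) vs)))
    (∫.mul digit (ι (suc k)) _)

  togetherP-record : ∀ h k → RecordLaw h k → ∀ g →
                     togetherP h (suc k) (ifRecord g) ≡ prefixedP h k g
  togetherP-record h k recordᵏ g = ∫.ext digit λ c → trans
    (P-∷ h k (λ xs → ifRecord g (map ((c , false) ∷_) xs)) (ifRecord λ vs → g (prefix (δ c) vs))
      λ x xs → cong₂ (λ r v → ⟦ r ⟧ * v) (isRecord-map c false x xs) (cong g (view-map c false xs)))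
    (recordᵏ λ vs → g (prefix (δ c) vs))

  -- A single value can only stay together, which for n = 1 has the whole harmonic number as its
  -- weight.
  total-1 : ∀ h c → P h 1 (λ _ → c) ≡ c
  total-1 zero    c = trans (∫-dirac _ _) (ℚ.+-identityʳ c)
  total-1 (suc h) c = trans (P-suc h 0 (λ _ → c)) (trans
    (cong (λ o → recipHarmonic h * (harmonic 0 (suc h) * o + 0ℚ))
      (trans (∫.ext digit λ _ → total-1 h c) (trans (∫.const digit c) (cong (c *_) mass))))
    (modulo c (recipHarmonic-inverse h)
      (solve 3 (λ r t c → r :* (t :* (c :* con 1ℚ) :+ con 0ℚ) := c :+ (r :* t :- con 1ℚ) :* c) refl
        (recipHarmonic h) (harmonic 0 (suc h)) c)))

  skip-first : ∀ h → SkipLaw h 0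
  skip-first h g = trans
    (∫.ext (hierarchy h 1) λ xs → select.ext xs λ _ → refl)
    (trans (total-1 h (g [])) (trans
      (solve 1 (λ c → c := (con 1ℚ :+ con 0ℚ) :* c) refl (g []))
      (cong (ι 1 *_) (sym (P-0 h λ xs → g (view xs))))))

  record-first : ∀ h → RecordLaw h 0
  record-first h g = trans
    (∫.ext (hierarchy h 1) λ xs → select.ext xs λ _ → ℚ.*-identityˡ (g []))
    (trans (total-1 h (g [])) (sym (P-0 h λ xs → g (view xs))))

  -- For k = h the harmonic sum is empty: a cluster at full capacity cannot stay together. In that
  -- case the law one level below, which would concern more values than fit there, does not have to
  -- be supplied.
  together-step : ∀ h k {x y} → (suc k ≤ h → x ≡ y) →
                  harmonic (suc k) (h ∸ k) * x ≡ harmonic (suc k) (h ∸ k) * y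
  together-step h k {x} {y} x≡y with h ∸ k in eq
  ... | zero  = trans (ℚ.*-zeroˡ x) (sym (ℚ.*-zeroˡ y))
  ... | suc e = cong (harmonic (suc k) (suc e) *_)
    (x≡y (ℕ.m∸n≢0⇒n<m λ h∸k≡0 → ℕ.1+n≢0 (trans (sym eq) h∸k≡0)))

  -- The term `recip k` is split off because it is the difference between the weights of staying
  -- together for k + 1 and for k + 2 values.
  P-view-suc : ∀ h k → k ≤ h → ∀ g → P (suc h) (suc k) (λ xs → g (view xs)) ≡
               recipHarmonic h * ((recip k + harmonic (suc k) (h ∸ k)) * prefixedP h (suc k) g +
                                  sumSplits (λ i j → mergedP h (suc i) (suc j) g) 0 k)
  P-view-suc h k k≤h g = trans (P-suc h k (λ xs → g (view xs))) (cong (recipHarmonic h *_)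
    (cong₂ _+_
      (cong₂ _*_ (cong (harmonic k) (ℕ.+-∸-assoc 1 k≤h)) (togetherP-view h (suc k) g))
      (sumSplits-cong 0 k λ i j _ → splitP-view h (suc i) (suc j) g)))

  sizes≤ : ∀ {h k i j} → k ≤ h → i ℕ.+ suc j ≡ suc k → i ≤ h × j ≤ h
  sizes≤ {i = i} {j} k≤h eq = ℕ.≤-trans (ℕ.m≤m+n i j) i+j≤h , ℕ.≤-trans (ℕ.m≤n+m j i) i+j≤h
    where
    i+j≤h = ℕ.≤-trans (ℕ.≤-reflexive (ℕ.suc-injective (trans (sym (ℕ.+-suc i j)) eq))) k≤h

  -- Induction on the number of levels. If the deleted value was alone in its part, the split
  -- becomes a cluster that stays together. In the inductive clause these two boundary terms
  -- contribute 1 + 1/(k + 1) = (k + 2)/(k + 1), that is, k + 2 times the term by which the weight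
  -- of staying together has to grow when one of k + 2 values goes.
  skip-law : ∀ h k → k ≤ h → SkipLaw h k
  skip-law h       zero    _         g = skip-first h g
  skip-law (suc h) (suc k) (s≤s k≤h) g = begin
    P (suc h) (suc (suc k)) (skip g)
      ≡⟨ P-suc h (suc k) (skip g) ⟩
    r * (H * togetherP h (suc (suc k)) (skip g) +
         sumSplits (λ i j → splitP h (suc i) (suc j) (skip g)) 0 (suc k))
      ≡⟨ cong (r *_) (cong₂ _+_
           (together-step h k λ k<h → togetherP-skip h (suc k) (skip-law h (suc k) k<h) g)
           (trans
             (sumSplits-cong 0 (suc k) λ i j eq → splitP-skip h i j
               (skip-law h i (proj₁ (sizes≤ k≤h eq))) (skip-law h j (proj₂ (sizes≤ k≤h eq))) g)
             (sumSplits-drop (λ i j → mergedP h i j g) 0 k))) ⟩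
    r * (H * (N * R) + (mergedP h 0 (suc k) g + N * S + recip k * mergedP h (suc k) 0 g))
      ≡⟨ cong₂ (λ q q′ → r * (H * (N * R) + (q + N * S + recip k * q′)))
           (mergedP-0ˡ h (suc k) g) (mergedP-0ʳ h (suc k) g) ⟩
    r * (H * (N * R) + (R + N * S + recip k * R))
      ≡⟨ modulo (- (r * R)) (recip-inverse k)
           (solve 6 (λ r H n R S c → r :* (H :* ((con 1ℚ :+ n) :* R) :+ (R :+ (con 1ℚ :+ n) :* S :+ c :* R)) :=
              (con 1ℚ :+ n) :* (r :* ((c :+ H) :* R :+ S)) :+ (n :* c :- con 1ℚ) :* (:- (r :* R))) refl
              r H (ι (suc k)) R S (recip k)) ⟩
    N * (r * ((recip k + H) * R + S))
      ≡⟨ cong (N *_) (sym (P-view-suc h k k≤h g)) ⟩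
    N * P (suc h) (suc k) (λ xs → g (view xs))
      ∎
    where
    open ≡-Reasoning
    r H N R S : ℚ
    r = recipHarmonic h
    H = harmonic (suc k) (h ∸ k)
    N = ι (suc (suc k))
    R = prefixedP h (suc k) g
    S = sumSplits (λ i j → mergedP h (suc i) (suc j) g) 0 k

  -- Removing a record leaves the lower part, hence the weight of the split, unchanged. An upper
  -- part of a single value disappears; its split, of weight 1/(k + 1), supplies exactly the term
  -- missing from the weight of staying together.
  record-law : ∀ h k → k ≤ h → RecordLaw h k
  record-law h       zero    _         g = record-first h g
  record-law (suc h) (suc k) (s≤s k≤h) g = begin
    P (suc h) (suc (suc k)) (ifRecord g)
      ≡⟨ P-suc h (suc k) (ifRecord g) ⟩
    r * (H * togetherP h (suc (suc k)) (ifRecord g) +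
         sumSplits (λ i j → splitP h (suc i) (suc j) (ifRecord g)) 0 (suc k))
      ≡⟨ cong (r *_) (cong₂ _+_
           (together-step h k λ k<h → togetherP-record h (suc k) (record-law h (suc k) k<h) g)
           (trans
             (sumSplits-cong 0 (suc k) λ i j eq → splitP-record h i j
               (record-law h j (proj₂ (sizes≤ k≤h eq))) g)
             (sumSplits-last (λ i j → mergedP h i j g) 0 k))) ⟩
    r * (H * R + (S + recip k * mergedP h (suc k) 0 g))
      ≡⟨ cong (λ q → r * (H * R + (S + recip k * q))) (mergedP-0ʳ h (suc k) g) ⟩
    r * (H * R + (S + recip k * R))
      ≡⟨ solve 5 (λ r H R S c → r :* (H :* R :+ (S :+ c :* R)) := r :* ((c :+ H) :* R :+ S)) refl
           r H R S (recip k) ⟩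
    r * ((recip k + H) * R + S)
      ≡⟨ sym (P-view-suc h k k≤h g) ⟩
    P (suc h) (suc k) (λ xs → g (view xs))
      ∎
    where
    open ≡-Reasoning
    r H R S : ℚ
    r = recipHarmonic h
    H = harmonic (suc k) (h ∸ k)
    R = prefixedP h (suc k) g
    S = sumSplits (λ i j → mergedP h (suc i) (suc j) g) 0 k

-- Optimal play

data Status : Set where
  waiting holding lost : Status

step : Status → Bool → Bool → Status
step waiting true  true  = holding
step waiting true  false = lost
step waiting false r     = waiting
step holding a     true  = lost
step holding a     false = holding
step lost    a     r     = lost

-- Latest observation first; the second components are the record flags. An
-- accepted record is held until a later record shows that it is not the maximum.
status : {V : Set} → (List (V × Bool) → Bool) → List (V × Bool) → Status
status accept []       = waiting
status accept (o ∷ os) = step (status accept os) (accept (o ∷ os)) (proj₂ o)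

won : Status → ℚ
won waiting = 0ℚ
won holding = 1ℚ
won lost    = 0ℚ

-- n times the winning probability from optimal play in a game with n = k + e
-- arrivals, of which the first k have been rejected.
value : ℕ → ℕ → ℚ
value k zero    = 0ℚ
value k (suc e) = recip k * (ι k * value (suc k) e + (ι (suc k) ⊔ value (suc k) e))

0≤value : ∀ k e → 0ℚ ≤ℚ value k e
0≤value k zero    = ℚ.≤-refl
0≤value k (suc e) = 0≤* (0≤recip k) (0≤+ (0≤* (0≤ι k) (0≤value (suc k) e))
  (ℚ.≤-trans (0≤ι (suc k)) (ℚ.p≤p⊔q (ι (suc k)) (value (suc k) e))))

-- In the scale of `value`, where probabilities are multiplied by n = k + e. A held value is the
-- maximum of the first k arrivals, hence of all n with probability k/n.
potential : ℕ → ℕ → Status → ℚ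
potential k e waiting = value k e
potential k e holding = ι k
potential k e lost    = 0ℚ

-- `base` is the potential after a next value that is no record, `gain` the change if it is a record
-- and the better decision is taken. The division matches the two laws: `SkipLaw` integrates `base`,
-- `RecordLaw` integrates `gain`.
base gain : ℕ → ℕ → Status → ℚ
base k e waiting = value (suc k) e
base k e holding = ι (suc k)
base k e lost    = 0ℚ
gain k e waiting = ι (suc k) ⊔ value (suc k) e - value (suc k) e
gain k e holding = - ι (suc k)
gain k e lost    = 0ℚ

-- The Bellman equation for records of probability 1/(k + 1), multiplied by k + 1.
base+gain : ∀ k e s → ι (suc k) * base k e s + gain k e s ≡ ι (suc k) * potential k (suc e) s
base+gain k e waiting = trans
  (solve 3 (λ n v m → (con 1ℚ :+ n) :* v :+ (m :- v) := n :* v :+ m) refl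
    (ι k) (value (suc k) e) (ι (suc k) ⊔ value (suc k) e))
  (sym (cancel-recip k (ι k * value (suc k) e + (ι (suc k) ⊔ value (suc k) e))))
base+gain k e holding =
  solve 1 (λ n → (con 1ℚ :+ n) :* (con 1ℚ :+ n) :+ (:- (con 1ℚ :+ n)) := (con 1ℚ :+ n) :* n) refl (ι k)
base+gain k e lost    = ℚ.+-identityʳ (ι (suc k) * 0ℚ)

b+1*[a-b]≡a : ∀ a b → b + 1ℚ * (a - b) ≡ a
b+1*[a-b]≡a = solve 2 (λ a b → b :+ con 1ℚ :* (a :- b) := a) refl

a+0*b≡a : ∀ a b → a + 0ℚ * b ≡ a
a+0*b≡a = solve 2 (λ a b → a :+ con 0ℚ :* b := a) refl

-- The supermartingale step. There is slack only if a value that is no record is accepted, or if a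
-- record is met with the worse of the two decisions.
potential-step≤ : ∀ k e s a r → potential (suc k) e (step s a r) ≤ℚ base k e s + ⟦ r ⟧ * gain k e s
potential-step≤ k e waiting true  true  = ℚ.≤-trans (ℚ.p≤p⊔q (ι (suc k)) (value (suc k) e))
  (ℚ.≤-reflexive (sym (b+1*[a-b]≡a (ι (suc k) ⊔ value (suc k) e) (value (suc k) e))))
potential-step≤ k e waiting true  false = ℚ.≤-trans (0≤value (suc k) e)
  (ℚ.≤-reflexive (sym (a+0*b≡a (value (suc k) e) (gain k e waiting))))
potential-step≤ k e waiting false true  = ℚ.≤-trans (ℚ.p≤q⊔p (ι (suc k)) (value (suc k) e))
  (ℚ.≤-reflexive (sym (b+1*[a-b]≡a (ι (suc k) ⊔ value (suc k) e) (value (suc k) e))))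
potential-step≤ k e waiting false false = ℚ.≤-reflexive (sym (a+0*b≡a (value (suc k) e) (gain k e waiting)))
potential-step≤ k e holding a     true  =
  ℚ.≤-reflexive (solve 1 (λ n → con 0ℚ := n :+ con 1ℚ :* (:- n)) refl (ι (suc k)))
potential-step≤ k e holding a     false = ℚ.≤-reflexive (sym (a+0*b≡a (ι (suc k)) (gain k e holding)))
potential-step≤ k e lost    a     r     =
  ℚ.≤-reflexive (solve 1 (λ b → con 0ℚ := con 0ℚ :+ b :* con 0ℚ) refl ⟦ r ⟧)

worthwhile : ℕ → ℕ → Bool
worthwhile n k = does (value k (n ∸ k) ℚ.≤? ι k)

-- Reads only the flags and the time, so the same rule makes sense for views with and without
-- digits.
threshold : {V : Set} → ℕ → List (V × Bool) → Bool
threshold n []             = false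
threshold n ((_ , r) ∷ os) = r ∧ worthwhile n (suc (length os))

-- The comparison in `worthwhile` selects the larger side of `⊔`, and nothing but records is
-- accepted, so both sources of slack vanish.
potential-step≡ : ∀ k e s r → potential (suc k) e (step s (r ∧ worthwhile (suc k ℕ.+ e) (suc k)) r) ≡
                  base k e s + ⟦ r ⟧ * gain k e s
potential-step≡ k e waiting false = sym (a+0*b≡a (value (suc k) e) (gain k e waiting))
potential-step≡ k e waiting true rewrite ℕ.m+n∸m≡n k e =
  trans (choice (value (suc k) e ℚ.≤? ι (suc k)))
    (sym (b+1*[a-b]≡a (ι (suc k) ⊔ value (suc k) e) (value (suc k) e)))
  where
  choice : (d : Dec (value (suc k) e ≤ℚ ι (suc k))) →
           potential (suc k) e (step waiting (does d) true) ≡ ι (suc k) ⊔ value (suc k) e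
  choice (yes v≤k) = sym (ℚ.p≥q⇒p⊔q≡p v≤k)
  choice (no  v≰k) = sym (ℚ.p≤q⇒p⊔q≡q (ℚ.<⇒≤ (ℚ.≰⇒> v≰k)))
potential-step≡ k e holding false = sym (a+0*b≡a (ι (suc k)) (gain k e holding))
potential-step≡ k e holding true  = solve 1 (λ n → con 0ℚ := n :+ con 1ℚ :* (:- n)) refl (ι (suc k))
potential-step≡ k e lost    r     = solve 1 (λ b → con 0ℚ := con 0ℚ :+ b :* con 0ℚ) refl ⟦ r ⟧

potential-end : ∀ n s → potential n 0 s ≡ ι n * won s
potential-end n waiting = sym (ℚ.*-zeroʳ (ι n))
potential-end n holding = sym (ℚ.*-identityʳ (ι n))
potential-end n lost    = sym (ℚ.*-zeroʳ (ι n))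

module Optimal {M : ℕ} (digit : Measure (Fin M)) (pair : Measure (Fin M × Fin M))
  (0≤digit : NonNeg digit) (0≤pair : NonNeg pair)
  {D : Set} (δ : Fin M → D)
  (mass  : ∫ digit (λ _ → 1ℚ) ≡ 1ℚ)
  (lower : ∀ (g : D → ℚ) → ∫ pair (λ (a , b) → g (δ a)) ≡ ∫ digit (λ c → g (δ c)))
  (upper : ∀ (g : D → ℚ) → ∫ pair (λ (a , b) → g (δ b)) ≡ ∫ digit (λ c → g (δ c)))
  where

  open Hierarchy digit pair
  open Views δ
  open Process digit pair δ mass lower upper

  expected : ∀ {h} → (List (View h) → Bool) → ℕ → ℕ → ℚ
  expected {h} accept k e = P h k λ xs → potential k e (status accept (view xs))

  P-base+gain : ∀ h k e (accept : List (View h) → Bool) → k ≤ h →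
                P h (suc k) (λ xs → skip (λ vs → base k e (status accept vs)) xs +
                                    ifRecord (λ vs → gain k e (status accept vs)) xs) ≡
                ι (suc k) * expected accept k (suc e)
  P-base+gain h k e accept k≤h = begin
    P h (suc k) (λ xs → skip B xs + ifRecord G xs)
      ≡⟨ P.add h (suc k) (skip B) (ifRecord G) ⟩
    P h (suc k) (skip B) + P h (suc k) (ifRecord G)
      ≡⟨ cong₂ _+_ (skip-law h k k≤h B) (record-law h k k≤h G) ⟩
    ι (suc k) * P h k (λ xs → B (view xs)) + P h k (λ xs → G (view xs))
      ≡⟨ cong (λ q → q + P h k (λ xs → G (view xs))) (sym (P.mul h k (ι (suc k)) (λ xs → B (view xs)))) ⟩
    P h k (λ xs → ι (suc k) * B (view xs)) + P h k (λ xs → G (view xs))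
      ≡⟨ sym (P.add h k (λ xs → ι (suc k) * B (view xs)) (λ xs → G (view xs))) ⟩
    P h k (λ xs → ι (suc k) * B (view xs) + G (view xs))
      ≡⟨ P.ext h k (λ xs → base+gain k e (status accept (view xs))) ⟩
    P h k (λ xs → ι (suc k) * potential k (suc e) (status accept (view xs)))
      ≡⟨ P.mul h k (ι (suc k)) (λ xs → potential k (suc e) (status accept (view xs))) ⟩
    ι (suc k) * expected accept k (suc e)
      ∎
    where
    open ≡-Reasoning
    B G : List (View h) → ℚ
    B vs = base k e (status accept vs)
    G vs = gain k e (status accept vs)

  -- The factorial is the total mass of `P h k`. Each step of the induction on k undoes one arrival,
  -- down to the potential of the empty game.
  expected≤ : ∀ h k e (accept : List (View h) → Bool) → k ≤ suc h →
              expected accept k e ≤ℚ ι (k !) * value 0 (k ℕ.+ e)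
  expected≤ h zero    e accept _         = ℚ.≤-reflexive (trans
    (P-0 h λ xs → potential 0 e (status accept (view xs)))
    (solve 1 (λ v → v := (con 1ℚ :+ con 0ℚ) :* v) refl (value 0 e)))
  expected≤ h (suc k) e accept (s≤s k≤h) = begin
    expected accept (suc k) e
      ≤⟨ P-mono-∷ 0≤digit 0≤pair h k
           (λ xs → potential (suc k) e (status accept (view xs)))
           (λ xs → skip (λ vs → base k e (status accept vs)) xs +
                   ifRecord (λ vs → gain k e (status accept vs)) xs)
           (λ x xs → potential-step≤ k e (status accept (view xs)) (accept (view (x ∷ xs))) (isRecord x xs)) ⟩
    P h (suc k) (λ xs → skip (λ vs → base k e (status accept vs)) xs +
                        ifRecord (λ vs → gain k e (status accept vs)) xs)
      ≡⟨ P-base+gain h k e accept k≤h ⟩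
    ι (suc k) * expected accept k (suc e)
      ≤⟨ *-monoˡ (0≤ι (suc k)) (expected≤ h k (suc e) accept (ℕ.m≤n⇒m≤1+n k≤h)) ⟩
    ι (suc k) * (ι (k !) * value 0 (k ℕ.+ suc e))
      ≡⟨ sym (ℚ.*-assoc (ι (suc k)) (ι (k !)) (value 0 (k ℕ.+ suc e))) ⟩
    ι (suc k) * ι (k !) * value 0 (k ℕ.+ suc e)
      ≡⟨ cong₂ (λ q n → q * value 0 n) (sym (ι-* (suc k) (k !))) (ℕ.+-suc k e) ⟩
    ι (suc k !) * value 0 (suc k ℕ.+ e)
      ∎
    where open ℚ.≤-Reasoning

  expected-threshold : ∀ h n k e → k ℕ.+ e ≡ n → k ≤ suc h →
                       expected {h} (threshold n) k e ≡ ι (k !) * value 0 n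
  expected-threshold h n zero    e refl _         = trans
    (P-0 h λ xs → potential 0 e (status (threshold e) (view xs)))
    (solve 1 (λ v → v := (con 1ℚ :+ con 0ℚ) :* v) refl (value 0 e))
  expected-threshold h n (suc k) e refl (s≤s k≤h) = begin
    expected {h} (threshold n) (suc k) e
      ≡⟨ P-length h (suc k) (λ xs → potential (suc k) e (status (threshold n) (view xs)))
           (λ xs → skip (λ vs → base k e (status (threshold n) vs)) xs +
                   ifRecord (λ vs → gain k e (status (threshold n) vs)) xs)
           (λ { (x ∷ xs) |x∷xs| → trans
                (cong (λ l → potential (suc k) e (step (status (threshold n) (view xs))
                               (isRecord x xs ∧ worthwhile n (suc l)) (isRecord x xs)))
                  (trans (view-length xs) (ℕ.suc-injective |x∷xs|)))
                (potential-step≡ k e (status (threshold n) (view xs)) (isRecord x xs)) }) ⟩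
    P h (suc k) (λ xs → skip (λ vs → base k e (status (threshold n) vs)) xs +
                        ifRecord (λ vs → gain k e (status (threshold n) vs)) xs)
      ≡⟨ P-base+gain h k e (threshold n) k≤h ⟩
    ι (suc k) * expected {h} (threshold n) k (suc e)
      ≡⟨ cong (ι (suc k) *_) (expected-threshold h n k (suc e) (ℕ.+-suc k e) (ℕ.m≤n⇒m≤1+n k≤h)) ⟩
    ι (suc k) * (ι (k !) * value 0 n)
      ≡⟨ sym (ℚ.*-assoc (ι (suc k)) (ι (k !)) (value 0 n)) ⟩
    ι (suc k) * ι (k !) * value 0 n
      ≡⟨ cong (_* value 0 n) (sym (ι-* (suc k) (k !))) ⟩
    ι (suc k !) * value 0 n
      ∎
    where
    open ≡-Reasoning
    view-length : ∀ xs → length (view {h} xs) ≡ length xs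
    view-length []       = refl
    view-length (x ∷ xs) = cong suc (view-length xs)

  ι*expected : ∀ h n (accept : List (View h) → Bool) →
               expected accept n 0 ≡ ι n * P h n (λ xs → won (status accept (view xs)))
  ι*expected h n accept = trans
    (P.ext h n λ xs → potential-end n (status accept (view xs)))
    (P.mul h n (ι n) (λ xs → won (status accept (view xs))))

  win≤ : ∀ h n (accept : List (View h) → Bool) → n ≤ suc h →
         ι n * P h n (λ xs → won (status accept (view xs))) ≤ℚ ι (n !) * value 0 n
  win≤ h n accept n≤ = subst₂ _≤ℚ_ (ι*expected h n accept) (cong (λ m → ι (n !) * value 0 m) (ℕ.+-identityʳ n))
    (expected≤ h n 0 accept n≤)

  win-threshold : ∀ h n → n ≤ suc h →
                  ι n * P h n (λ xs → won (status (threshold n) (view xs))) ≡ ι (n !) * value 0 n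
  win-threshold h n n≤ = trans (sym (ι*expected h n (threshold n)))
    (expected-threshold h n n 0 (ℕ.+-identityʳ n) n≤)

-- Comparison of the acyclic and the cyclic hierarchy

sumFin : ∀ {n} → (Fin n → ℚ) → ℚ
sumFin {zero}  f = 0ℚ
sumFin {suc n} f = f zero + sumFin (λ i → f (suc i))

sumFin-const : ∀ n c → sumFin {n} (λ _ → c) ≡ ι n * c
sumFin-const zero    c = sym (ℚ.*-zeroˡ c)
sumFin-const (suc n) c = trans (cong (_+_ c) (sumFin-const n c))
  (solve 2 (λ c n → c :+ n :* c := (con 1ℚ :+ n) :* c) refl c (ι n))

sumFin-last : ∀ n (f : Fin (suc n) → ℚ) → sumFin f ≡ sumFin (λ i → f (inject₁ i)) + f (Fin.fromℕ n)
sumFin-last zero    f = ℚ.+-comm (f zero) 0ℚ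
sumFin-last (suc n) f = trans (cong (_+_ (f zero)) (sumFin-last n (λ i → f (suc i))))
  (sym (ℚ.+-assoc (f zero) (sumFin (λ i → f (suc (inject₁ i)))) (f (suc (Fin.fromℕ n)))))

∫-tabulate : ∀ {A : Set} {n} w (φ : Fin n → A) f → ∫ (tabulate λ i → w , φ i) f ≡ w * sumFin (λ i → f (φ i))
∫-tabulate {n = zero}  w φ f = sym (ℚ.*-zeroʳ w)
∫-tabulate {n = suc n} w φ f = trans (cong (_+_ (w * f (φ zero))) (∫-tabulate w (λ i → φ (suc i)) f))
  (sym (ℚ.*-distribˡ-+ w (f (φ zero)) (sumFin (λ i → f (φ (suc i))))))

pow : ℚ → ℕ → ℚ
pow r zero    = 1ℚ
pow r (suc n) = r * pow r n

0≤pow : ∀ {r} → 0ℚ ≤ℚ r → ∀ n → 0ℚ ≤ℚ pow r n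
0≤pow 0≤r zero    = 0≤1
0≤pow 0≤r (suc n) = 0≤* 0≤r (0≤pow 0≤r n)

pow-+ : ∀ r m n → pow r (m ℕ.+ n) ≡ pow r m * pow r n
pow-+ r zero    n = sym (ℚ.*-identityˡ (pow r n))
pow-+ r (suc m) n = trans (cong (r *_) (pow-+ r m n)) (sym (ℚ.*-assoc r (pow r m) (pow r n)))

sumSplits-mono : ∀ {q q′} c i j → (∀ i′ j′ → i′ ℕ.+ suc j′ ≡ i ℕ.+ j → q i′ j′ ≤ℚ c * q′ i′ j′) →
                 sumSplits q i j ≤ℚ c * sumSplits q′ i j
sumSplits-mono {q} {q′} c i zero    q≤q′ = ℚ.≤-reflexive (sym (ℚ.*-zeroʳ c))
sumSplits-mono {q} {q′} c i (suc j) q≤q′ = ℚ.≤-trans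
  (ℚ.+-mono-≤ (*-monoˡ (0≤recip i) (q≤q′ i j refl))
    (sumSplits-mono {q} {q′} c (suc i) j λ i′ j′ eq → q≤q′ i′ j′ (trans eq (sym (ℕ.+-suc i j)))))
  (ℚ.≤-reflexive (solve 4 (λ r c x y → r :* (c :* x) :+ c :* y := c :* (r :* x :+ y)) refl
    (recip i) c (q′ i j) (sumSplits q′ (suc i) j)))

module Domination {M : ℕ} (digit : Measure (Fin M)) (pair pair′ : Measure (Fin M × Fin M))
  (0≤digit : NonNeg digit) (0≤pair : NonNeg pair) (0≤pair′ : NonNeg pair′)
  (ρ : ℚ) (0≤ρ : 0ℚ ≤ℚ ρ)
  (dominated : ∀ f → (∀ p → 0ℚ ≤ℚ f p) → ∫ pair f ≤ℚ ρ * ∫ pair′ f)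
  where

  open Hierarchy digit pair using (hierarchy; hierarchy-nonNeg)
  open Hierarchy digit pair′ using () renaming (hierarchy to hierarchy′; hierarchy-nonNeg to hierarchy′-nonNeg)
  open Recursion digit pair using (∫together; ∫split; hierarchy-∫)
  open Recursion digit pair′ using ()
    renaming (∫together to ∫together′; ∫split to ∫split′; hierarchy-∫ to hierarchy′-∫)

  -- Separating k + 1 values takes exactly k splits, each of which costs one factor `ρ`.
  Dominated : ℕ → ℕ → Set
  Dominated h k = ∀ Φ → (∀ xs → 0ℚ ≤ℚ Φ xs) →
                  ∫ (hierarchy h (suc k)) Φ ≤ℚ pow ρ k * ∫ (hierarchy′ h (suc k)) Φ

  together-dominated : ∀ h k → Dominated h k → ∀ Φ → (∀ xs → 0ℚ ≤ℚ Φ xs) →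
                       ∫together h (suc k) Φ ≤ℚ pow ρ k * ∫together′ h (suc k) Φ
  together-dominated h k dom Φ 0≤Φ = ℚ.≤-trans
    (∫-mono 0≤digit λ c → dom (λ xs → Φ (map ((c , false) ∷_) xs)) (λ xs → 0≤Φ _))
    (ℚ.≤-reflexive (∫.mul digit (pow ρ k) _))

  -- The exponent counts i splits in the lower part, j in the upper part and the present one. The
  -- law is exchanged in the upper part, in the lower part and at the pair in turn, with a
  -- nonnegative integrand each time.
  split-dominated : ∀ h i j → Dominated h i → Dominated h j → ∀ Φ → (∀ xs → 0ℚ ≤ℚ Φ xs) →
                    ∫split h (suc i) (suc j) Φ ≤ℚ pow ρ (i ℕ.+ suc j) * ∫split′ h (suc i) (suc j) Φ
  split-dominated h i j domⁱ domʲ Φ 0≤Φ = begin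
    ∫split h (suc i) (suc j) Φ
      ≤⟨ (∫-mono 0≤pair λ (a , b) → ∫-mono (hierarchy-nonNeg 0≤digit 0≤pair h (suc i)) λ xs →
           domʲ (λ ys → Φ (joined (a , b) xs ys)) (λ ys → 0≤Φ _)) ⟩
    ∫ pair (λ p → ∫ (hierarchy h (suc i)) λ xs → pow ρ j * inner p xs)
      ≤⟨ (∫-mono 0≤pair λ p → domⁱ (λ xs → pow ρ j * inner p xs)
           (λ xs → 0≤* (0≤pow 0≤ρ j) (0≤inner p xs))) ⟩
    ∫ pair (λ p → pow ρ i * ∫ (hierarchy′ h (suc i)) (λ xs → pow ρ j * inner p xs))
      ≤⟨ dominated _ (λ p → 0≤* (0≤pow 0≤ρ i) (∫-0≤ (hierarchy′-nonNeg 0≤digit 0≤pair′ h (suc i))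
           λ xs → 0≤* (0≤pow 0≤ρ j) (0≤inner p xs))) ⟩
    ρ * ∫ pair′ (λ p → pow ρ i * ∫ (hierarchy′ h (suc i)) (λ xs → pow ρ j * inner p xs))
      ≡⟨ cong (ρ *_) (trans
           (∫.mul pair′ (pow ρ i) (λ p → ∫ (hierarchy′ h (suc i)) (λ xs → pow ρ j * inner p xs)))
           (cong (pow ρ i *_) (trans
             (∫.ext pair′ λ p → ∫.mul (hierarchy′ h (suc i)) (pow ρ j) (inner p))
             (∫.mul pair′ (pow ρ j) (λ p → ∫ (hierarchy′ h (suc i)) (inner p)))))) ⟩
    ρ * (pow ρ i * (pow ρ j * ∫split′ h (suc i) (suc j) Φ))
      ≡⟨ trans
           (solve 4 (λ r x y s → r :* (x :* (y :* s)) := x :* (r :* y) :* s) refl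
             ρ (pow ρ i) (pow ρ j) (∫split′ h (suc i) (suc j) Φ))
           (cong (_* ∫split′ h (suc i) (suc j) Φ) (sym (pow-+ ρ i (suc j)))) ⟩
    pow ρ (i ℕ.+ suc j) * ∫split′ h (suc i) (suc j) Φ
      ∎
    where
    open ℚ.≤-Reasoning
    joined : Fin M × Fin M → List (Value M h) → List (Value M h) → List (Value M (suc h))
    joined (a , b) xs ys = map ((a , false) ∷_) xs ++ map ((b , true) ∷_) ys
    inner : Fin M × Fin M → List (Value M h) → ℚ
    inner p xs = ∫ (hierarchy′ h (suc j)) λ ys → Φ (joined p xs ys)
    0≤inner : ∀ p xs → 0ℚ ≤ℚ inner p xs
    0≤inner p xs = ∫-0≤ (hierarchy′-nonNeg 0≤digit 0≤pair′ h (suc j)) λ ys → 0≤Φ _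

  hierarchy-dominated : ∀ h k → Dominated h k
  hierarchy-dominated zero    zero    Φ 0≤Φ = ℚ.≤-reflexive (sym (ℚ.*-identityˡ (∫ (dirac ([] ∷ [])) Φ)))
  hierarchy-dominated zero    (suc k) Φ 0≤Φ = ℚ.≤-reflexive (sym (ℚ.*-zeroʳ (pow ρ (suc k))))
  hierarchy-dominated (suc h) k       Φ 0≤Φ = begin
    ∫ (hierarchy (suc h) (suc k)) Φ
      ≡⟨ hierarchy-∫ h k Φ ⟩
    r * (H * ∫together h (suc k) Φ + sumSplits (λ i j → ∫split h (suc i) (suc j) Φ) 0 k)
      ≤⟨ *-monoˡ (0≤recipHarmonic h) (ℚ.+-mono-≤
           (*-monoˡ (0≤harmonic k (suc h ∸ k)) (together-dominated h k (hierarchy-dominated h k) Φ 0≤Φ))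
           (sumSplits-mono (pow ρ k) 0 k λ i j eq →
             subst (λ n → ∫split h (suc i) (suc j) Φ ≤ℚ pow ρ n * ∫split′ h (suc i) (suc j) Φ) eq
               (split-dominated h i j (hierarchy-dominated h i) (hierarchy-dominated h j) Φ 0≤Φ))) ⟩
    r * (H * (pow ρ k * T′) + pow ρ k * S′)
      ≡⟨ solve 5 (λ r H p t s → r :* (H :* (p :* t) :+ p :* s) := p :* (r :* (H :* t :+ s))) refl
           r H (pow ρ k) T′ S′ ⟩
    pow ρ k * (r * (H * T′ + S′))
      ≡⟨ cong (pow ρ k *_) (sym (hierarchy′-∫ h k Φ)) ⟩
    pow ρ k * ∫ (hierarchy′ (suc h) (suc k)) Φ
      ∎
    where
    open ℚ.≤-Reasoning
    r H T′ S′ : ℚ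
    r  = recipHarmonic h
    H  = harmonic k (suc h ∸ k)
    T′ = ∫together′ h (suc k) Φ
    S′ = sumSplits (λ i j → ∫split′ h (suc i) (suc j) Φ) 0 k

-- Agreement of bits and numbers in sorted lists

number : ∀ {M h} → Vec (Fin M) h → Fin (M ^ h)
number []      = zero
number (c ∷ x) = combine c (number x)

digits : ∀ {M h} → Value M h → Vec (Fin M) h
digits = Vec.map proj₁

-- Demands that the bits and the numbers order the two values alike; with the cyclic pair (M - 1, 0)
-- they would not. Both directions of `≺` are kept, to establish record flags as well as to refute
-- them.
Below : ∀ {M h} → Value M h → Value M h → Set
Below x y = x ≺ y ≡ true × y ≺ x ≡ false × number (digits x) Fin.< number (digits y)

Sorted : ∀ {M h} → List (Value M h) → Set
Sorted = AllPairs Below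

combine-monoʳ-< : ∀ {m n} (c : Fin m) {i j : Fin n} → i Fin.< j → combine c i Fin.< combine c j
combine-monoʳ-< {n = n} c {i} {j} i<j = subst₂ ℕ._<_
  (sym (Fin.toℕ-combine c i)) (sym (Fin.toℕ-combine c j)) (ℕ.+-monoʳ-< (n ℕ.* toℕ c) i<j)

Below-∷ : ∀ {M h} (c : Fin M) s {x y : Value M h} → Below x y → Below ((c , s) ∷ x) ((c , s) ∷ y)
Below-∷ c false (x≺y , y⊀x , x<y) = x≺y , y⊀x , combine-monoʳ-< c x<y
Below-∷ c true  (x≺y , y⊀x , x<y) = x≺y , y⊀x , combine-monoʳ-< c x<y

Sorted-map : ∀ {M h} (c : Fin M) s {xs : List (Value M h)} → Sorted xs → Sorted (map ((c , s) ∷_) xs)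
Sorted-map c s sorted = AllPairs.map⁺ (AllPairs.map (Below-∷ c s) sorted)

-- The first digit is the most significant one in `number`, so `a < b` alone puts every lower value
-- below every upper one.
Sorted-++ : ∀ {M h} {a b : Fin M} → a Fin.< b → {xs ys : List (Value M h)} → Sorted xs → Sorted ys →
            Sorted (map ((a , false) ∷_) xs ++ map ((b , true) ∷_) ys)
Sorted-++ {a = a} {b} a<b {xs} {ys} sorted-xs sorted-ys =
  AllPairs.++⁺ (Sorted-map a false sorted-xs) (Sorted-map b true sorted-ys)
    (All.map⁺ (All.universal (λ x → All.map⁺ (All.universal
      (λ y → refl , refl , Fin.combine-monoˡ-< (number (digits x)) (number (digits y)) a<b) ys)) xs))

module _ {M : ℕ} (digit : Measure (Fin M)) (pair : Measure (Fin M × Fin M))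
  (increasing : All (λ o → proj₁ (proj₂ o) Fin.< proj₂ (proj₂ o)) pair) where

  open Hierarchy digit pair

  mutual

    hierarchy-sorted : ∀ h n → n ≤ suc h → All (λ o → Sorted (proj₂ o)) (hierarchy h n)
    hierarchy-sorted h       zero          _         = All-dirac []
    hierarchy-sorted zero    (suc zero)    _         = All-dirac ([] ∷ [])
    hierarchy-sorted zero    (suc (suc n)) _         = []
    hierarchy-sorted (suc h) (suc k)       (s≤s k≤1+h) = All-scale (recipHarmonic h)
      (All.++⁺ (together-sorted h k (suc h ∸ k) refl) (split-sorted h 0 k k≤1+h))

    together-sorted : ∀ h k e → suc h ∸ k ≡ e → All (λ o → Sorted (proj₂ o)) (together h k e)
    together-sorted h k zero    _  = []
    together-sorted h k (suc e) eq = All-scale (harmonic k (suc e))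
      (All->>= (All.universal (λ _ → tt) digit) λ c _ →
       All->>= (hierarchy-sorted h (suc k) (ℕ.m∸n≢0⇒n<m λ ≡0 → ℕ.1+n≢0 (trans (sym eq) ≡0))) λ xs sorted →
         All-dirac (Sorted-map c false sorted))

    split-sorted : ∀ h i j → i ℕ.+ j ≤ suc h → All (λ o → Sorted (proj₂ o)) (split h i j)
    split-sorted h i zero    _     = []
    split-sorted h i (suc j) i+j≤h = All.++⁺
      (All-scale (recip i)
        (All->>= increasing λ (a , b) a<b →
         All->>= (hierarchy-sorted h (suc i) (ℕ.≤-trans (s≤s (ℕ.m≤m+n i j)) 1+i+j≤1+h)) λ xs sorted-xs →
         All->>= (hierarchy-sorted h (suc j) (ℕ.≤-trans (s≤s (ℕ.m≤n+m j i)) 1+i+j≤1+h)) λ ys sorted-ys →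
           All-dirac (Sorted-++ a<b sorted-xs sorted-ys)))
      (split-sorted h (suc i) j 1+i+j≤1+h)
      where
      1+i+j≤1+h : suc (i ℕ.+ j) ≤ suc h
      1+i+j≤1+h = subst (_≤ suc h) (ℕ.+-suc i j) i+j≤h

-- The digit laws in base M = m + 2

module Digits (m : ℕ) where

  M : ℕ
  M = suc (suc m)

  digit : Measure (Fin M)
  digit = tabulate λ c → recip (suc m) , c

  adjacent cyclic : Measure (Fin M × Fin M)
  adjacent = tabulate λ d → recip m , (inject₁ d , suc d)
  cyclic   = (recip (suc m) , (Fin.fromℕ (suc m) , zero)) ∷ tabulate λ d → recip (suc m) , (inject₁ d , suc d)

  0≤digit : NonNeg digit
  0≤digit = All.tabulate⁺ {f = λ c → recip (suc m) , c} λ _ → 0≤recip (suc m)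

  0≤adjacent : NonNeg adjacent
  0≤adjacent = All.tabulate⁺ {f = λ d → recip m , (inject₁ d , suc d)} λ _ → 0≤recip m

  0≤cyclic : NonNeg cyclic
  0≤cyclic = 0≤recip (suc m) ∷ 
    All.tabulate⁺ {f = λ d → recip (suc m) , (inject₁ d , suc d)} λ _ → 0≤recip (suc m)

  adjacent-increasing : All (λ o → proj₁ (proj₂ o) Fin.< proj₂ (proj₂ o)) adjacent
  adjacent-increasing = All.tabulate⁺ {f = λ d → recip m , (inject₁ d , suc d)} λ d → s≤s (ℕ.≤-reflexive (Fin.toℕ-inject₁ d))

  digit-mass : ∫ digit (λ _ → 1ℚ) ≡ 1ℚ
  digit-mass = trans (∫-tabulate {n = M} (recip (suc m)) id (λ _ → 1ℚ))
    (trans (cong (recip (suc m) *_) (sumFin-const M 1ℚ)) (recip-cancel (suc m) 1ℚ))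

  -- With digits hidden, the marginal conditions of `Process` concern constants only. Thus the laws
  -- hold exactly for `adjacent` too, although its marginals differ from `digit`.
  adjacent-const : ∀ c → ∫ adjacent (λ _ → c) ≡ ∫ digit (λ _ → c)
  adjacent-const c = trans
    (trans (∫-tabulate {n = suc m} (recip m) (λ d → inject₁ d , suc d) (λ _ → c))
      (trans (cong (recip m *_) (sumFin-const (suc m) c)) (recip-cancel m c)))
    (sym (trans (∫.const digit c) (trans (cong (c *_) digit-mass) (ℚ.*-identityʳ c))))

  ∫-cyclic : ∀ f → ∫ cyclic f ≡ recip (suc m) * (f (Fin.fromℕ (suc m) , zero) + sumFin λ d → f (inject₁ d , suc d))
  ∫-cyclic f = trans
    (cong (_+_ (recip (suc m) * f (Fin.fromℕ (suc m) , zero)))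
      (∫-tabulate (recip (suc m)) (λ d → inject₁ d , suc d) f))
    (sym (ℚ.*-distribˡ-+ (recip (suc m)) (f (Fin.fromℕ (suc m) , zero)) (sumFin λ d → f (inject₁ d , suc d))))

  cyclic-lower : ∀ (g : Fin M → ℚ) → ∫ cyclic (λ (a , b) → g a) ≡ ∫ digit g
  cyclic-lower g = trans (∫-cyclic λ (a , b) → g a) (trans
    (cong (recip (suc m) *_) (trans
      (ℚ.+-comm (g (Fin.fromℕ (suc m))) (sumFin λ d → g (inject₁ d)))
      (sym (sumFin-last (suc m) g))))
    (sym (∫-tabulate {n = M} (recip (suc m)) id g)))

  cyclic-upper : ∀ (g : Fin M → ℚ) → ∫ cyclic (λ (a , b) → g b) ≡ ∫ digit g
  cyclic-upper g = trans (∫-cyclic λ (a , b) → g b) (sym (∫-tabulate {n = M} (recip (suc m)) id g))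

  abstract

    ρ : ℚ
    ρ = ι M * recip m

    ρ≡ : ρ ≡ ι M * recip m
    ρ≡ = refl

    0≤ρ : 0ℚ ≤ℚ ρ
    0≤ρ = 0≤* (0≤ι M) (0≤recip m)

    adjacent-dominated : ∀ f → (∀ p → 0ℚ ≤ℚ f p) → ∫ adjacent f ≤ℚ ρ * ∫ cyclic f
    adjacent-dominated f 0≤f = begin
      ∫ adjacent f
        ≡⟨ ∫-tabulate {n = suc m} (recip m) (λ d → inject₁ d , suc d) f ⟩
      recip m * S
        ≤⟨ *-monoˡ (0≤recip m) (subst (_≤ℚ W + S) (ℚ.+-identityˡ S) (ℚ.+-monoˡ-≤ S (0≤f _))) ⟩
      recip m * (W + S)
        ≡⟨ sym (modulo (recip m * (W + S)) (recip-inverse (suc m))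
             (solve 4 (λ n r c t → n :* c :* (r :* t) := c :* t :+ (n :* r :- con 1ℚ) :* (c :* t)) refl
               (ι M) (recip (suc m)) (recip m) (W + S))) ⟩
      ρ * (recip (suc m) * (W + S))
        ≡⟨ cong (ρ *_) (sym (∫-cyclic f)) ⟩
      ρ * ∫ cyclic f
        ∎
      where
      open ℚ.≤-Reasoning
      W S : ℚ
      W = f (Fin.fromℕ (suc m) , zero)
      S = sumFin λ d → f (inject₁ d , suc d)

  module Real  = Hierarchy digit adjacent
  module Ideal = Hierarchy digit cyclic

  module RealProcess  = Process digit adjacent {⊤} (λ _ → tt) digit-mass
    (λ g → adjacent-const (g tt)) (λ g → adjacent-const (g tt))
  module IdealProcess = Process digit cyclic id digit-mass cyclic-lower cyclic-upper

  module RealOptimal  = Optimal digit adjacent 0≤digit 0≤adjacent {⊤} (λ _ → tt) digit-mass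
    (λ g → adjacent-const (g tt)) (λ g → adjacent-const (g tt))
  module IdealOptimal = Optimal digit cyclic 0≤digit 0≤cyclic id digit-mass cyclic-lower cyclic-upper

  open Domination digit adjacent cyclic 0≤digit 0≤adjacent 0≤cyclic ρ 0≤ρ adjacent-dominated public

  -- The skip law for the constant 1 is the recursion of the factorial.
  P-1 : ∀ h n → n ≤ suc h → Real.P h n (λ _ → 1ℚ) ≡ ι (n !)
  P-1 h zero    _         = Real.P-0 h (λ _ → 1ℚ)
  P-1 h (suc k) (s≤s k≤h) = trans
    (Real.P-∷ h k (λ _ → 1ℚ) (RealProcess.skip λ _ → 1ℚ) λ _ _ → refl)
    (trans (RealProcess.skip-law h k k≤h λ _ → 1ℚ)
      (trans (cong (ι (suc k) *_) (P-1 h k (ℕ.m≤n⇒m≤1+n k≤h))) (sym (ι-* (suc k) (k !)))))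

-- Permutations

sum : {A : Set} → List A → (A → ℚ) → ℚ
sum xs f = foldr _+_ 0ℚ (map f xs)

sum-linear : {A : Set} (xs : List A) → Linear (sum xs)
sum-linear xs = record { ext = ext xs ; add = add xs ; mul = mul xs }
  where
  ext : ∀ xs {f g} → (∀ a → f a ≡ g a) → sum xs f ≡ sum xs g
  ext []       f≡g = refl
  ext (x ∷ xs) f≡g = cong₂ _+_ (f≡g x) (ext xs f≡g)
  add : ∀ xs f g → sum xs (λ a → f a + g a) ≡ sum xs f + sum xs g
  add []       f g = refl
  add (x ∷ xs) f g = trans (cong (_+_ (f x + g x)) (add xs f g))
    (interchange (f x) (g x) (sum xs f) (sum xs g))
  mul : ∀ xs c f → sum xs (λ a → c * f a) ≡ c * sum xs f
  mul []       c f = sym (ℚ.*-zeroʳ c)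
  mul (x ∷ xs) c f = trans (cong (_+_ (c * f x)) (mul xs c f)) (sym (ℚ.*-distribˡ-+ c (f x) (sum xs f)))

module sum {A : Set} (xs : List A) = Linear (sum-linear xs)

sum-cong : ∀ {A : Set} {P : A → Set} {xs f g} → All P xs → (∀ a → P a → f a ≡ g a) → sum xs f ≡ sum xs g
sum-cong []       f≡g = refl
sum-cong (p ∷ ps) f≡g = cong₂ _+_ (f≡g _ p) (sum-cong ps f≡g)

sum-mono : {A : Set} (xs : List A) → Monotone (sum xs)
sum-mono []       f≤g = ℚ.≤-refl
sum-mono (x ∷ xs) f≤g = ℚ.+-mono-≤ (f≤g x) (sum-mono xs f≤g)

sum-++ : {A : Set} (xs ys : List A) (f : A → ℚ) → sum (xs ++ ys) f ≡ sum xs f + sum ys f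
sum-++ []       ys f = sym (ℚ.+-identityˡ (sum ys f))
sum-++ (x ∷ xs) ys f = trans (cong (_+_ (f x)) (sum-++ xs ys f)) (sym (ℚ.+-assoc (f x) (sum xs f) (sum ys f)))

sum-map : {A B : Set} (φ : A → B) (xs : List A) (f : B → ℚ) → sum (map φ xs) f ≡ sum xs (λ a → f (φ a))
sum-map φ []       f = refl
sum-map φ (x ∷ xs) f = cong (_+_ (f (φ x))) (sum-map φ xs f)

sum-concatMap : {A B : Set} (k : A → List B) (xs : List A) (f : B → ℚ) →
                sum (concatMap k xs) f ≡ sum xs (λ a → sum (k a) f)
sum-concatMap k []       f = refl
sum-concatMap k (x ∷ xs) f = trans (sum-++ (k x) (concatMap k xs) f)
  (cong (_+_ (sum (k x) f)) (sum-concatMap k xs f))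

sum-tabulate : ∀ {A : Set} {n} (φ : Fin n → A) f → sum (tabulate φ) f ≡ sumFin (λ i → f (φ i))
sum-tabulate {n = zero}  φ f = refl
sum-tabulate {n = suc n} φ f = cong (_+_ (f (φ zero))) (sum-tabulate (λ i → φ (suc i)) f)

sum-comm : {A B : Set} {L : (A → ℚ) → ℚ} → Linear L → (ys : List B) (f : A → B → ℚ) →
           L (λ a → sum ys (f a)) ≡ sum ys (λ b → L (λ a → f a b))
sum-comm lin []       f = Linear.vanish lin
sum-comm {L = L} lin (y ∷ ys) f = trans (Linear.add lin (λ a → f a y) (λ a → sum ys (f a)))
  (cong (_+_ (L (λ a → f a y))) (sum-comm lin ys f))

sumFin-ext : ∀ {n} {f g : Fin n → ℚ} → (∀ i → f i ≡ g i) → sumFin f ≡ sumFin g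
sumFin-ext {zero}  f≡g = refl
sumFin-ext {suc n} f≡g = cong₂ _+_ (f≡g zero) (sumFin-ext λ i → f≡g (suc i))

-- Permutations act on vectors, hence a second version of the sums. The clauses follow those of
-- `removeAt`.
selectᵛ : ∀ {A : Set} {n} → Vec A (suc n) → (A → Vec A n → ℚ) → ℚ
selectᵛ (x ∷ [])         G = G x []
selectᵛ (x ∷ xs@(_ ∷ _)) G = G x xs + selectᵛ xs (λ y r → G y (x ∷ r))

orderingsᵛ : ∀ {A : Set} {n} → Vec A n → (Vec A n → ℚ) → ℚ
orderingsᵛ {n = zero}  xs f = f []
orderingsᵛ {n = suc n} xs f = selectᵛ xs λ x r → orderingsᵛ r λ ys → f (x ∷ ys)

selectᵛ-ext : ∀ {A : Set} {n} (xs : Vec A (suc n)) {F G} → (∀ x r → F x r ≡ G x r) →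
              selectᵛ xs F ≡ selectᵛ xs G
selectᵛ-ext (x ∷ [])         F≡G = F≡G x []
selectᵛ-ext (x ∷ xs@(_ ∷ _)) F≡G = cong₂ _+_ (F≡G x xs) (selectᵛ-ext xs λ y r → F≡G y (x ∷ r))

selectᵛ-add : ∀ {A : Set} {n} (xs : Vec A (suc n)) F G →
              selectᵛ xs (λ x r → F x r + G x r) ≡ selectᵛ xs F + selectᵛ xs G
selectᵛ-add (x ∷ [])         F G = refl
selectᵛ-add (x ∷ xs@(_ ∷ _)) F G = trans
  (cong (_+_ (F x xs + G x xs)) (selectᵛ-add xs (λ y r → F y (x ∷ r)) (λ y r → G y (x ∷ r))))
  (interchange (F x xs) (G x xs) (selectᵛ xs (λ y r → F y (x ∷ r))) (selectᵛ xs (λ y r → G y (x ∷ r))))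

selectᵛ-sumFin : ∀ {A : Set} {n} (xs : Vec A (suc n)) G →
                 selectᵛ xs G ≡ sumFin (λ i → G (lookup xs i) (removeAt xs i))
selectᵛ-sumFin (x ∷ [])         G = sym (ℚ.+-identityʳ (G x []))
selectᵛ-sumFin (x ∷ xs@(_ ∷ _)) G = cong (_+_ (G x xs)) (selectᵛ-sumFin xs (λ y r → G y (x ∷ r)))

selectᵛ-toList : ∀ {A : Set} {n} (xs : Vec A (suc n)) (G : A × List A → ℚ) →
                 select (toList xs) G ≡ selectᵛ xs (λ x r → G (x , toList r))
selectᵛ-toList (x ∷ [])         G = ℚ.+-identityʳ (G (x , []))
selectᵛ-toList (x ∷ xs@(_ ∷ _)) G =
  cong (_+_ (G (x , toList xs))) (selectᵛ-toList xs (λ (y , r) → G (y , x ∷ r)))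

orderingsᵛ-ext : ∀ {A : Set} {n} (xs : Vec A n) {f g} → (∀ ys → f ys ≡ g ys) →
                 orderingsᵛ xs f ≡ orderingsᵛ xs g
orderingsᵛ-ext {n = zero}  xs f≡g = f≡g []
orderingsᵛ-ext {n = suc n} xs f≡g = selectᵛ-ext xs λ x r → orderingsᵛ-ext r λ ys → f≡g (x ∷ ys)

orderingsᵛ-toList : ∀ {A : Set} {n} (xs : Vec A n) (f : List A → ℚ) →
                    orderings n (toList xs) f ≡ orderingsᵛ xs (λ ys → f (toList ys))
orderingsᵛ-toList {n = zero}  []       f = refl
orderingsᵛ-toList {n = suc n} xs       f = trans
  (selectᵛ-toList xs (λ (x , r) → orderings n r λ ys → f (x ∷ ys)))
  (selectᵛ-ext xs λ x r → orderingsᵛ-toList r λ ys → f (x ∷ ys))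

selectᵛ-swap : ∀ {A : Set} {n} (xs : Vec A (suc (suc n))) (H : A → A → Vec A n → ℚ) →
               selectᵛ xs (λ x r → selectᵛ r (λ y r′ → H x y r′)) ≡
               selectᵛ xs (λ x r → selectᵛ r (λ y r′ → H y x r′))
selectᵛ-swap (x ∷ y ∷ [])             H = ℚ.+-comm (H x y []) (H y x [])
selectᵛ-swap (x ∷ xs@(y ∷ ys@(_ ∷ _))) H = begin
  first + selectᵛ xs (λ y r → selectᵛ (x ∷ r) (H y))
    ≡⟨ cong (_+_ first) (unfold H) ⟩
  first + (second + selectᵛ xs (λ y r → selectᵛ r (λ z r′ → H y z (x ∷ r′))))
    ≡⟨ cong (λ s → first + (second + s)) (selectᵛ-swap xs (λ y z r → H y z (x ∷ r))) ⟩
  first + (second + rest)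
    ≡⟨ solve 3 (λ a b c → a :+ (b :+ c) := b :+ (a :+ c)) refl first second rest ⟩
  second + (first + rest)
    ≡⟨ cong (_+_ second) (sym (unfold λ y z r → H z y r)) ⟩
  second + selectᵛ xs (λ y r → selectᵛ (x ∷ r) (λ z r′ → H z y r′))
    ∎
  where
  open ≡-Reasoning
  first second rest : ℚ
  first  = selectᵛ xs (λ y r → H x y r)
  second = selectᵛ xs (λ y r → H y x r)
  rest   = selectᵛ xs (λ y r → selectᵛ r (λ z r′ → H z y (x ∷ r′)))
  cons : ∀ K (r : Vec _ _) → selectᵛ (x ∷ r) K ≡ K x r + selectᵛ r (λ z r′ → K z (x ∷ r′))
  cons K (_ ∷ _) = refl
  unfold : ∀ K → selectᵛ xs (λ y r → selectᵛ (x ∷ r) (K y)) ≡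
           selectᵛ xs (λ y r → K y x r) + selectᵛ xs (λ y r → selectᵛ r (λ z r′ → K y z (x ∷ r′)))
  unfold K = trans (selectᵛ-ext xs λ y r → cons (K y) r)
    (selectᵛ-add xs (λ y r → K y x r) (λ y r → selectᵛ r (λ z r′ → K y z (x ∷ r′))))

-- Bringing the i-th entry to the front permutes the orderings: the induction brings it to the
-- second place, and exchanging the first two choices does the rest.
orderingsᵛ-move : ∀ {A : Set} {n} (xs : Vec A (suc n)) (i : Fin (suc n)) (F : A → Vec A n → ℚ) →
                  orderingsᵛ xs (λ ys → F (lookup ys i) (removeAt ys i)) ≡
                  orderingsᵛ xs (λ ys → F (head ys) (tail ys))
orderingsᵛ-move xs zero F = orderingsᵛ-ext xs
  {λ ys → F (lookup ys zero) (removeAt ys zero)} {λ ys → F (head ys) (tail ys)} λ { (y ∷ ys) → refl }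
orderingsᵛ-move {n = suc n} xs (suc i) F = begin
  selectᵛ xs (λ x r → orderingsᵛ r λ ys → F (lookup ys i) (removeAt (x ∷ ys) (suc i)))
    ≡⟨ (selectᵛ-ext xs λ x r → orderingsᵛ-ext r
         {λ ys → F (lookup ys i) (removeAt (x ∷ ys) (suc i))} {λ ys → F (lookup ys i) (x ∷ removeAt ys i)}
         λ { (y ∷ ys) → refl }) ⟩
  selectᵛ xs (λ x r → orderingsᵛ r λ ys → F (lookup ys i) (x ∷ removeAt ys i))
    ≡⟨ (selectᵛ-ext xs λ x r → orderingsᵛ-move r i (λ y r → F y (x ∷ r))) ⟩
  selectᵛ xs (λ x r → selectᵛ r λ y r′ → orderingsᵛ r′ λ ys → F y (x ∷ ys))
    ≡⟨ selectᵛ-swap xs (λ x y r → orderingsᵛ r λ ys → F y (x ∷ ys)) ⟩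
  selectᵛ xs (λ x r → selectᵛ r λ y r′ → orderingsᵛ r′ λ ys → F x (y ∷ ys))
    ∎
  where open ≡-Reasoning

-- Remembers how `permutations` builds its entries, so that they can be taken apart by induction.
IsPermutation : ∀ n → Vec (Fin n) n → Set
IsPermutation zero    π = ⊤
IsPermutation (suc n) π = ∃₂ λ i p → IsPermutation n p × π ≡ i ∷ Vec.map (punchIn i) p

permutations-sound : ∀ n → All (IsPermutation n) (permutations n)
permutations-sound zero    = tt ∷ []
permutations-sound (suc n) = All.concat⁺ (All.map⁺ (All.tabulate⁺ λ i →
  All.map⁺ (All.map (λ {p} p-perm → i , p , p-perm , refl) (permutations-sound n))))

lookup-punchIn : ∀ {A : Set} {n} (xs : Vec A (suc n)) i j →
                 lookup xs (punchIn i j) ≡ lookup (removeAt xs i) j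
lookup-punchIn (x ∷ xs)         zero    j       = refl
lookup-punchIn (x ∷ xs@(_ ∷ _)) (suc i) zero    = refl
lookup-punchIn (x ∷ xs@(_ ∷ _)) (suc i) (suc j) = lookup-punchIn xs i j

map-lookup-punchIn : ∀ {A : Set} {n k} (xs : Vec A (suc n)) i (p : Vec (Fin n) k) →
                     Vec.map (lookup xs) (Vec.map (punchIn i) p) ≡ Vec.map (lookup (removeAt xs i)) p
map-lookup-punchIn xs i p = trans (sym (Vec.map-∘ (lookup xs) (punchIn i) p))
  (Vec.map-cong (lookup-punchIn xs i) p)

-- For each fixed arrival order `π` of the slips, the random assignment `σ` alone already makes the
-- order of the values uniform; the identities of the slips then carry no information.
orderingsᵛ-permute : ∀ {A : Set} {n} (xs : Vec A n) π → IsPermutation n π → ∀ f →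
                     orderingsᵛ xs (λ ys → f (Vec.map (lookup ys) π)) ≡ orderingsᵛ xs f
orderingsᵛ-permute {n = zero}  xs []  _                    f = refl
orderingsᵛ-permute {n = suc n} xs .(_) (i , p , p-perm , refl) f = begin
  orderingsᵛ xs (λ ys → f (lookup ys i ∷ Vec.map (lookup ys) (Vec.map (punchIn i) p)))
    ≡⟨ (orderingsᵛ-ext xs λ ys → cong (λ zs → f (lookup ys i ∷ zs)) (map-lookup-punchIn ys i p)) ⟩
  orderingsᵛ xs (λ ys → f (lookup ys i ∷ Vec.map (lookup (removeAt ys i)) p))
    ≡⟨ orderingsᵛ-move xs i (λ y r → f (y ∷ Vec.map (lookup r) p)) ⟩
  selectᵛ xs (λ x r → orderingsᵛ r λ ys → f (x ∷ Vec.map (lookup ys) p))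
    ≡⟨ (selectᵛ-ext xs λ x r → orderingsᵛ-permute r p p-perm λ ys → f (x ∷ ys)) ⟩
  orderingsᵛ xs f
    ∎
  where open ≡-Reasoning

sum-permutations : ∀ {A : Set} {n} (xs : Vec A n) f →
                   sum (permutations n) (λ p → f (Vec.map (lookup xs) p)) ≡ orderingsᵛ xs f
sum-permutations {n = zero}  xs f = ℚ.+-identityʳ (f [])
sum-permutations {n = suc n} xs f = begin
  sum (permutations (suc n)) (λ p → f (Vec.map (lookup xs) p))
    ≡⟨ sum-concatMap (λ i → map (λ p → i ∷ Vec.map (punchIn i) p) (permutations n)) (allFin (suc n))
         (λ p → f (Vec.map (lookup xs) p)) ⟩
  sum (allFin (suc n)) (λ i → sum (map (λ p → i ∷ Vec.map (punchIn i) p) (permutations n))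
                                  (λ p → f (Vec.map (lookup xs) p)))
    ≡⟨ sum-tabulate {n = suc n} id (λ i → sum (map (λ p → i ∷ Vec.map (punchIn i) p) (permutations n))
                                  (λ p → f (Vec.map (lookup xs) p))) ⟩
  sumFin (λ i → sum (map (λ p → i ∷ Vec.map (punchIn i) p) (permutations n))
                    (λ p → f (Vec.map (lookup xs) p)))
    ≡⟨ (sumFin-ext λ i → trans
         (sum-map (λ p → i ∷ Vec.map (punchIn i) p) (permutations n) (λ p → f (Vec.map (lookup xs) p)))
         (trans
           (sum.ext (permutations n) λ p → cong (λ ys → f (lookup xs i ∷ ys)) (map-lookup-punchIn xs i p))
           (sum-permutations (removeAt xs i) λ ys → f (lookup xs i ∷ ys)))) ⟩
  sumFin (λ i → orderingsᵛ (removeAt xs i) λ ys → f (lookup xs i ∷ ys))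
    ≡⟨ sym (selectᵛ-sumFin xs (λ x r → orderingsᵛ r λ ys → f (x ∷ ys))) ⟩
  orderingsᵛ xs f
    ∎
  where open ≡-Reasoning

recipFactorial : ℕ → ℚ
recipFactorial n = (ℤ.+ 1 / (n !)) {{ℕ._!≢0 n}}

k/d*d≡k : ∀ k d .{{_ : ℕ.NonZero d}} → ℤ.+ k / d * ι d ≡ ι k
k/d*d≡k k (suc d) = trans
  (trans (cong (ℤ.+ k / suc d *_) (sym (n/1≡ι (suc d)))) (ℚ.toℚᵘ-injective (begin
    ℚ.toℚᵘ (ℤ.+ k / suc d * (ℤ.+ suc d / 1))
      ≈⟨ ℚ.toℚᵘ-homo-* (ℤ.+ k / suc d) (ℤ.+ suc d / 1) ⟩
    ℚ.toℚᵘ (ℤ.+ k / suc d) ℚᵘ.* ℚ.toℚᵘ (ℤ.+ suc d / 1)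
      ≈⟨ ℚᵘ.*-cong (ℚ.toℚᵘ-fromℚᵘ (ℚᵘ.mkℚᵘ (ℤ.+ k) d)) (ℚ.toℚᵘ-fromℚᵘ (ℚᵘ.mkℚᵘ (ℤ.+ suc d) 0)) ⟩
    ℚᵘ.mkℚᵘ (ℤ.+ k) d ℚᵘ.* ℚᵘ.mkℚᵘ (ℤ.+ suc d) 0
      ≈⟨ ℚᵘ.*≡* (ℤ.*-assoc (ℤ.+ k) (ℤ.+ suc d) (ℤ.+ 1)) ⟩
    ℚᵘ.mkℚᵘ (ℤ.+ k) 0
      ≈⟨ ℚᵘ.≃-sym (ℚ.toℚᵘ-fromℚᵘ (ℚᵘ.mkℚᵘ (ℤ.+ k) 0)) ⟩
    ℚ.toℚᵘ (ℤ.+ k / 1)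
      ∎)))
  (n/1≡ι k)
  where open ℚᵘ.≃-Reasoning

recipFactorial-inverse : ∀ n → recipFactorial n * ι (n !) ≡ 1ℚ
recipFactorial-inverse n = trans (k/d*d≡k 1 (n !) {{ℕ._!≢0 n}}) (ℚ.+-identityʳ 1ℚ)

0≤recipFactorial : ∀ n → 0ℚ ≤ℚ recipFactorial n
0≤recipFactorial n = ℚ.nonNegative⁻¹ (recipFactorial n) {{ℚ.normalize-nonNeg 1 (n !) {{ℕ._!≢0 n}}}}

uniformPermutation-const : ∀ n c → uniformPermutation n (λ _ → c) ≡ c
uniformPermutation-const n c = trans
  (cong (recipFactorial n *_) (trans (sum.const (permutations n) c) (cong (c *_) count)))
  (trans (solve 3 (λ r c k → r :* (c :* k) := c :* (r :* k)) refl (recipFactorial n) c (ι (n !)))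
    (trans (cong (c *_) (recipFactorial-inverse n)) (ℚ.*-identityʳ c)))
  where
  -- The permutations are counted by letting them act on a vector of units, which reduces the count
  -- to `orderings-1`.
  units : Vec ⊤ n
  units = Vec.replicate n tt
  count : sum (permutations n) (λ _ → 1ℚ) ≡ ι (n !)
  count = trans (sum-permutations units (λ _ → 1ℚ)) (trans
    (sym (orderingsᵛ-toList units (λ _ → 1ℚ)))
    (orderings-1 n (toList units) (Vec.length-toList units)))

-- Runs of an algorithm

rank : ∀ {M h} → Value M h → Fin (M ^ h)
rank x = number (digits x)

Comparable : ∀ {M h} → Value M h → Value M h → Set
Comparable x y = Below x y ⊎ Below y x

Below-asym : ∀ {M h} (x y : Value M h) → rank x Fin.≤ rank y → ¬ Below y x
Below-asym x y x≤y (_ , _ , y<x) = ℕ.<⇒≱ y<x x≤y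

AllPairs-resp-↭ : ∀ {A : Set} {R : A → A → Set} → (∀ {x y} → R x y → R y x) →
                  ∀ {xs ys} → xs ↭ ys → AllPairs R xs → AllPairs R ys
AllPairs-resp-↭ {A} {R} R-sym p = PermutationSetoid.AllPairs-resp-↭ (setoid A) R-sym (resp₂ R) (↭⇒↭ₛ p)

module _ {M h : ℕ} where

  record-if : ∀ {z : Value M h} {ws} → All (Comparable z) ws → All (λ w → rank w Fin.≤ rank z) ws →
              isRecord z ws ≡ true
  record-if []                           []         = refl
  record-if {z} {w ∷ _} (inj₁ z<w ∷ cs)  (w≤z ∷ ps) = ⊥-elim (Below-asym w z w≤z z<w)
  record-if (inj₂ (w≺z , _ , _) ∷ cs)    (w≤z ∷ ps) rewrite w≺z = record-if cs ps

  record-only-if : ∀ {z : Value M h} {ws} → All (Comparable z) ws → isRecord z ws ≡ true →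
                   All (λ w → rank w Fin.≤ rank z) ws
  record-only-if []                          r = []
  record-only-if (inj₁ (_ , w⊀z , _) ∷ cs)   r rewrite w⊀z with () ← r
  record-only-if (inj₂ (w≺z , _ , w<z) ∷ cs) r rewrite w≺z = ℕ.<⇒≤ w<z ∷ record-only-if cs r

  not-record : ∀ {y z : Value M h} {ws} → z ∈ ws → z ≺ y ≡ false → isRecord y ws ≡ false
  not-record                  (here refl)  z⊀y rewrite z⊀y = refl
  not-record {y} {ws = w ∷ _} (there z∈ws) z⊀y with w ≺ y
  ... | false = refl
  ... | true  = not-record z∈ws z⊀y

  finish : ∀ {l} → List (Value M h) → Vec (Value M h) l → List (Value M h)
  finish ws zs = foldl (flip _∷_) ws (toList zs)

  All-finish : ∀ {l} {Q : Value M h → Set} ws (zs : Vec (Value M h) l) → All Q (finish ws zs) → All Q ws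
  All-finish ws []       q = q
  All-finish ws (z ∷ zs) q = All.tail (All-finish (z ∷ ws) zs q)

  data Fresh : ∀ {l} → List (Value M h) → Vec (Value M h) l → Set where
    []  : ∀ {ws} → Fresh ws []
    _∷_ : ∀ {l ws z} {zs : Vec (Value M h) l} → All (Comparable z) ws → Fresh (z ∷ ws) zs → Fresh ws (z ∷ zs)

  fresh : ∀ {l} ws (zs : Vec (Value M h) l) → AllPairs Comparable (toList zs) →
          All (λ z → All (Comparable z) ws) (toList zs) → Fresh ws zs
  fresh ws []       _         _         = []
  fresh ws (z ∷ zs) (cz ∷ cs) (pz ∷ ps) = pz ∷ fresh (z ∷ ws) zs cs
    (All.zipWith (λ (c , p) → Sum.swap c ∷ p) (cz , ps))

module Play (M h n : ℕ) where

  open Views {M} {Fin M} id using (View; view)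

  -- `ids j` is the slip that arrives after j others. The head of a view is the latest arrival and
  -- so becomes the last entry of the history.
  history : (ℕ → Fin n) → (os : List (View h)) → History (M ^ h) n (length os)
  history ids []             = Vec.[]
  history ids ((v , _) ∷ os) = history ids os ▷ (ids (length os) , number v)

  -- The flags are withheld from the algorithm; only `status` uses them, to judge its decisions.
  -- Thus `A` can also be played against the cyclic hierarchy, whose flags disagree with the
  -- numbers.
  accepts : Algorithm (M ^ h) n → (ℕ → Fin n) → List (View h) → Bool
  accepts A ids os = A (length os) (history ids os)

  observe : ∀ {l} → Vec (Fin n) l → Vec (Value M h) l → Vec (Observation (M ^ h) n) l
  observe = zipWith (λ i z → i , rank z)

  module _ (accept : List (View h) → Bool) where

    Outcome : Value M h → List (Value M h) → Set
    Outcome z ws = (All (λ w → rank w Fin.≤ rank z) ws × status accept (view ws) ≡ holding) ⊎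
                   (¬ All (λ w → rank w Fin.≤ rank z) ws × status accept (view ws) ≡ lost)

    finish-lost : ∀ {l} ws (zs : Vec (Value M h) l) → status accept (view ws) ≡ lost →
                  status accept (view (finish ws zs)) ≡ lost
    finish-lost ws []       ws-lost = ws-lost
    finish-lost ws (z ∷ zs) ws-lost = finish-lost (z ∷ ws) zs
      (cong (λ s → step s (accept (view (z ∷ ws))) (isRecord z ws)) ws-lost)

    step-holding : ∀ {s r} a → s ≡ holding → r ≡ false → step s a r ≡ holding
    step-holding a refl refl = refl

    step-overtaken : ∀ {s r} a → s ≡ holding → r ≡ true → step s a r ≡ lost
    step-overtaken a refl refl = refl

    -- While `z` is the maximum, a later value is a record exactly if it exceeds `z`; so the status
    -- is lost at the moment at which `z` ceases to be the maximum.
    finish-holding : ∀ {l z} ws (zs : Vec (Value M h) l) → Fresh ws zs → z ∈ ws →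
                     All (λ w → rank w Fin.≤ rank z) ws → status accept (view ws) ≡ holding →
                     Outcome z (finish ws zs)
    finish-holding ws []       _          z∈ws ws≤z held = inj₁ (ws≤z , held)
    finish-holding {z = z} ws (y ∷ zs) (cs ∷ fr) z∈ws ws≤z held with All.lookup cs z∈ws
    ... | inj₁ (_ , z⊀y , y<z) = finish-holding (y ∷ ws) zs fr (there z∈ws) (ℕ.<⇒≤ y<z ∷ ws≤z)
      (step-holding (accept (view (y ∷ ws))) held (not-record z∈ws z⊀y))
    ... | inj₂ z<y@(_ , _ , z<y′) = inj₂
      ( (λ all → Below-asym y z (All.head (All-finish (y ∷ ws) zs all)) z<y)
      , finish-lost (y ∷ ws) zs (step-overtaken (accept (view (y ∷ ws))) held
          (record-if cs (All.map (λ w≤z → ℕ.≤-trans w≤z (ℕ.<⇒≤ z<y′)) ws≤z))))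

    finish-accepted : ∀ {l} z ws (zs : Vec (Value M h) l) → Fresh ws (z ∷ zs) →
                      status accept (view ws) ≡ waiting → accept (view (z ∷ ws)) ≡ true →
                      Outcome z (finish (z ∷ ws) zs)
    finish-accepted z ws zs (cs ∷ fr) ws-waiting accepted with isRecord z ws in r
    ... | true  = finish-holding (z ∷ ws) zs fr (here refl) (ℕ.≤-refl ∷ record-only-if cs r)
      (trans (cong₂ (λ s a → step s a (isRecord z ws)) ws-waiting
        (trans (cong (λ b → accept ((digits z , b) ∷ view ws)) r) accepted)) (cong (step waiting true) r))
    ... | false = inj₂
      ( (λ all → true≢false (trans (sym (record-if cs (All.tail (All-finish (z ∷ ws) zs all)))) r))
      , finish-lost (z ∷ ws) zs (trans (cong₂ (λ s a → step s a (isRecord z ws)) ws-waiting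
          (trans (cong (λ b → accept ((digits z , b) ∷ view ws)) r) accepted)) (cong (step waiting true) r)))
      where
      true≢false : ¬ true ≡ false
      true≢false ()

  module _ (S : NSubset (M ^ h) n) where

    -- The reward asks only whether a number bounds the set from above, so sharing the upper bounds
    -- is enough.
    SameElements : List (Value M h) → Set
    SameElements ws = ∀ (v : Fin (M ^ h)) → (All (λ w → rank w Fin.≤ v) ws → VecAll (Fin._≤ v) (elements S)) ×
                            (VecAll (Fin._≤ v) (elements S) → All (λ w → rank w Fin.≤ v) ws)

    reward-outcome : ∀ accept i z ws → SameElements ws → Outcome accept z ws →
                     reward S (just (i , rank z)) ≡ won (status accept (view ws))
    reward-outcome accept i z ws same (inj₁ (ws≤z , held))
      rewrite held | dec-true (VecAll.all? (Fin._≤? rank z) (elements S)) (proj₁ (same (rank z)) ws≤z) = refl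
    reward-outcome accept i z ws same (inj₂ (ws≰z , gone))
      rewrite gone | dec-false (VecAll.all? (Fin._≤? rank z) (elements S)) (λ S≤z → ws≰z (proj₂ (same (rank z)) S≤z)) =
      refl

    -- As long as nothing is accepted, the status is `waiting` and `run` consults the same decisions
    -- as `status`; at the first acceptance `finish-accepted` takes over.
    reward-run : ∀ A ids {l} ws (πs : Vec (Fin n) l) (zs : Vec (Value M h) l) →
                 Fresh ws zs → SameElements (finish ws zs) →
                 (∀ j → lookup πs j ≡ ids (length (view ws) ℕ.+ toℕ j)) →
                 status (accepts A ids) (view ws) ≡ waiting →
                 reward S (run A (history ids (view ws)) (observe πs zs)) ≡
                 won (status (accepts A ids) (view (finish ws zs)))
    reward-run A ids ws []       []       _          _    _     ws-waiting = cong won (sym ws-waiting)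
    reward-run A ids ws (p ∷ πs) (z ∷ zs) fr@(cs ∷ fr′) same match ws-waiting
      rewrite trans (match zero) (cong ids (ℕ.+-identityʳ (length (view ws))))
      with accepts A ids (view (z ∷ ws)) in accepted
    ... | true  = reward-outcome (accepts A ids) (ids (length (view ws))) z (finish (z ∷ ws) zs) same
      (finish-accepted (accepts A ids) z ws zs fr ws-waiting accepted)
    ... | false = reward-run A ids (z ∷ ws) πs zs fr′ same
      (λ j → trans (match (suc j)) (cong ids (ℕ.+-suc (length (view ws)) (toℕ j))))
      (cong₂ (λ s a → step s a (isRecord z ws)) ws-waiting accepted)

selectᵛ-cong : ∀ {A : Set} {n} (xs : Vec A (suc n)) {F G} →
               (∀ x r → x ∷ toList r ↭ toList xs → F x r ≡ G x r) → selectᵛ xs F ≡ selectᵛ xs G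
selectᵛ-cong (x ∷ [])         F≡G = F≡G x [] ↭-refl
selectᵛ-cong (x ∷ xs@(_ ∷ _)) F≡G = cong₂ _+_ (F≡G x xs ↭-refl)
  (selectᵛ-cong xs λ y r p → F≡G y (x ∷ r) (↭-trans (swap y x ↭-refl) (prep x p)))

orderingsᵛ-cong : ∀ {A : Set} {n} (xs : Vec A n) {f g} →
                  (∀ ys → toList ys ↭ toList xs → f ys ≡ g ys) → orderingsᵛ xs f ≡ orderingsᵛ xs g
orderingsᵛ-cong {n = zero}  []  f≡g = f≡g [] ↭-refl
orderingsᵛ-cong {n = suc n} xs  f≡g = selectᵛ-cong xs λ x r p →
  orderingsᵛ-cong r λ ys q → f≡g (x ∷ ys) (↭-trans (prep x q) p)

latest : ∀ {A : Set} {k} → Vec A (suc k) → A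
latest {k = k} xs = lookup xs (Fin.fromℕ k)

latest-▷ : ∀ {A : Set} {k} (xs : Vec A k) x → latest (xs ▷ x) ≡ x
latest-▷ []       x = refl
latest-▷ (_ ∷ xs) x = latest-▷ xs x

module _ {A : Set} {P : A → Set} where

  ▷⁺ : ∀ {k} {xs : Vec A k} {x} → VecAll P xs → P x → VecAll P (xs ▷ x)
  ▷⁺ []       p = p ∷ []
  ▷⁺ (q ∷ qs) p = q ∷ ▷⁺ qs p

  ▷⁻ : ∀ {k} (xs : Vec A k) {x} → VecAll P (xs ▷ x) → VecAll P xs × P x
  ▷⁻ []       (p ∷ []) = [] , p
  ▷⁻ (_ ∷ xs) (q ∷ qs) = let qs′ , p = ▷⁻ xs qs in q ∷ qs′ , p

-- The threshold rule as an ordinal algorithm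

module _ {N n : ℕ} where

  NoneAbove : ∀ {k} → Fin N → History N n k → Set
  NoneAbove v h = ∀ i → ¬ (v Fin.< proj₂ (lookup h i))

  noneAbove? : ∀ {k} (v : Fin N) (h : History N n k) → Dec (NoneAbove v h)
  noneAbove? v h = Fin.all? λ i → ¬? (v Fin.<? proj₂ (lookup h i))

  latestIsMax : ∀ {k} → History N n (suc k) → Bool
  latestIsMax h = does (noneAbove? (proj₂ (latest h)) h)

  thresholdAlgorithm : Algorithm N n
  thresholdAlgorithm zero    h = false
  thresholdAlgorithm (suc k) h = latestIsMax h ∧ worthwhile n (suc k)

  thresholdAlgorithm-ordinal : Ordinal thresholdAlgorithm
  thresholdAlgorithm-ordinal zero    h h′ _ _    = refl
  thresholdAlgorithm-ordinal (suc k) h h′ _ same = cong (_∧ worthwhile n (suc k)) (does-⇔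
    (mk⇔ (λ above i v<i → above i (Equivalence.from (same (Fin.fromℕ k) i) v<i))
         (λ above i v<i → above i (Equivalence.to (same (Fin.fromℕ k) i) v<i)))
    (noneAbove? (proj₂ (latest h)) h) (noneAbove? (proj₂ (latest h′)) h′))

-- Extends a vector to all times; in a game of n arrivals the default is never reached.
entry : ∀ {A : Set} {l} → A → Vec A l → ℕ → A
entry d []       _       = d
entry d (x ∷ xs) zero    = x
entry d (x ∷ xs) (suc j) = entry d xs j

lookup-entry : ∀ {A : Set} {l} d (xs : Vec A l) j → lookup xs j ≡ entry d xs (toℕ j)
lookup-entry d (x ∷ xs) zero    = refl
lookup-entry d (x ∷ xs) (suc j) = lookup-entry d xs j

module Wins (M h n : ℕ) (someone : Fin n) where

  open Play M h n
  open Views {M} {Fin M} id using (View; view)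

  ranks-increasing : ∀ {l} (xs : Vec (Value M h) l) → Sorted (toList xs) → Linked Fin._<_ (Vec.map rank xs)
  ranks-increasing []           _                                = []
  ranks-increasing (x ∷ [])     _                                = [-]
  ranks-increasing (x ∷ y ∷ xs) (((_ , _ , x<y) ∷ _) ∷ sorted) = x<y ∷ ranks-increasing (y ∷ xs) sorted

  subset : (xs : Vec (Value M h) n) → Sorted (toList xs) → NSubset (M ^ h) n
  subset xs sorted = mkNSubset (Vec.map rank xs) (ranks-increasing xs sorted)

  ranks⁺ : ∀ {v : Fin (M ^ h)} {l} (xs : Vec (Value M h) l) → All (λ x → rank x Fin.≤ v) (toList xs) →
           VecAll (Fin._≤ v) (Vec.map rank xs)
  ranks⁺ []       []       = []
  ranks⁺ (x ∷ xs) (p ∷ ps) = p ∷ ranks⁺ xs ps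

  ranks⁻ : ∀ {v : Fin (M ^ h)} {l} (xs : Vec (Value M h) l) → VecAll (Fin._≤ v) (Vec.map rank xs) →
           All (λ x → rank x Fin.≤ v) (toList xs)
  ranks⁻ []       []       = []
  ranks⁻ (x ∷ xs) (p ∷ ps) = p ∷ ranks⁻ xs ps

  ids : Vec (Fin n) n → ℕ → Fin n
  ids = entry someone

  wins : Algorithm (M ^ h) n → Vec (Fin n) n → List (Value M h) → ℚ
  wins A π ws = won (status (accepts A (ids π)) (view ws))

  arrivals-observe : ∀ (xs : Vec (Value M h) n) sorted σ {l} (π : Vec (Fin n) l) →
                     Vec.map (λ i → i , lookup (elements (subset xs sorted)) (lookup σ i)) π ≡
                     observe π (Vec.map (lookup (Vec.map (lookup xs) σ)) π)
  arrivals-observe xs sorted σ []      = refl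
  arrivals-observe xs sorted σ (i ∷ π) = cong₂ _∷_
    (cong (i ,_) (trans (Vec.lookup-map (lookup σ i) rank xs) (cong rank (sym (Vec.lookup-map i (lookup xs) σ)))))
    (arrivals-observe xs sorted σ π)

  comparable : ∀ {xs ys : List (Value M h)} → Sorted xs → ys ↭ xs → AllPairs Comparable ys
  comparable sorted ys↭xs = AllPairs-resp-↭ Sum.swap (↭-sym ys↭xs) (AllPairs.map inj₁ sorted)

  reward-wins : ∀ A (xs : Vec (Value M h) n) sorted π zs → toList zs ↭ toList xs →
                reward (subset xs sorted) (run A Vec.[] (observe π zs)) ≡ wins A π (reverse (toList zs))
  reward-wins A xs sorted π zs zs↭xs = reward-run (subset xs sorted) A (ids π) [] π zs
    (fresh [] zs (comparable sorted zs↭xs) (All.universal (λ _ → []) (toList zs)))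
    (λ v → (λ all → ranks⁺ xs (All-resp-↭ reversed↭xs all)) ,
           (λ all → All-resp-↭ (↭-sym reversed↭xs) (ranks⁻ xs all)))
    (lookup-entry someone π) refl
    where
    reversed↭xs : reverse (toList zs) ↭ toList xs
    reversed↭xs = ↭-trans (↭-reverse (toList zs)) zs↭xs

  -- With `π` fixed, the sum over `σ` runs through all orders of the values. The reversal between
  -- arrivals and views is absorbed by `orderings-reverse`.
  sum-rewards : ∀ A (xs : Vec (Value M h) n) sorted π → IsPermutation n π →
                sum (permutations n) (λ σ → reward (subset xs sorted)
                  (run A Vec.[] (arrivals (subset xs sorted) σ π))) ≡
                orderings n (toList xs) (wins A π)
  sum-rewards A xs sorted π π-perm = begin
    sum (permutations n) (λ σ → R (arrivals (subset xs sorted) σ π))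
      ≡⟨ (sum.ext (permutations n) λ σ → cong R (arrivals-observe xs sorted σ π)) ⟩
    sum (permutations n) (λ σ → R (observe π (Vec.map (lookup (Vec.map (lookup xs) σ)) π)))
      ≡⟨ sum-permutations xs (λ ys → R (observe π (Vec.map (lookup ys) π))) ⟩
    orderingsᵛ xs (λ ys → R (observe π (Vec.map (lookup ys) π)))
      ≡⟨ orderingsᵛ-permute xs π π-perm (λ zs → R (observe π zs)) ⟩
    orderingsᵛ xs (λ zs → R (observe π zs))
      ≡⟨ orderingsᵛ-cong xs (reward-wins A xs sorted π) ⟩
    orderingsᵛ xs (λ zs → wins A π (reverse (toList zs)))
      ≡⟨ sym (orderingsᵛ-toList xs (λ zs → wins A π (reverse zs))) ⟩
    orderings n (toList xs) (λ zs → wins A π (reverse zs))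
      ≡⟨ orderings-reverse n (toList xs) (wins A π) ⟩
    orderings n (toList xs) (wins A π)
      ∎
    where
    open ≡-Reasoning
    R : Vec (Observation (M ^ h) n) n → ℚ
    R os = reward (subset xs sorted) (run A Vec.[] os)

  winProbability-orderings : ∀ A (xs : Vec (Value M h) n) sorted →
    winProbability A (subset xs sorted) ≡
    uniformPermutation n (λ π → recipFactorial n * orderings n (toList xs) (wins A π))
  winProbability-orderings A xs sorted = begin
    c * sum (permutations n) (λ σ → c * sum (permutations n) (λ π → r σ π))
      ≡⟨ cong (c *_) (sum.mul (permutations n) c (λ σ → sum (permutations n) (λ π → r σ π))) ⟩
    c * (c * sum (permutations n) (λ σ → sum (permutations n) (λ π → r σ π)))
      ≡⟨ cong (λ s → c * (c * s)) (sum-comm (sum-linear (permutations n)) (permutations n) r) ⟩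
    c * (c * sum (permutations n) (λ π → sum (permutations n) (λ σ → r σ π)))
      ≡⟨ cong (λ s → c * (c * s)) (sum-cong (permutations-sound n) (sum-rewards A xs sorted)) ⟩
    c * (c * sum (permutations n) (λ π → orderings n (toList xs) (wins A π)))
      ≡⟨ cong (c *_) (sym (sum.mul (permutations n) c (λ π → orderings n (toList xs) (wins A π)))) ⟩
    c * sum (permutations n) (λ π → c * orderings n (toList xs) (wins A π))
      ∎
    where
    open ≡-Reasoning
    c : ℚ
    c = recipFactorial n
    r : Vec (Fin n) n → Vec (Fin n) n → ℚ
    r σ π = reward (subset xs sorted) (run A Vec.[] (arrivals (subset xs sorted) σ π))

  history⁺ : ∀ {Q : Fin (M ^ h) → Set} is ws → All (λ w → Q (rank w)) ws →
             VecAll (λ o → Q (proj₂ o)) (history is (view ws))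
  history⁺ is []       []       = []
  history⁺ is (w ∷ ws) (q ∷ qs) = ▷⁺ (history⁺ is ws qs) q

  history⁻ : ∀ {Q : Fin (M ^ h) → Set} is ws → VecAll (λ o → Q (proj₂ o)) (history is (view ws)) →
             All (λ w → Q (rank w)) ws
  history⁻ is []       _  = []
  history⁻ is (w ∷ ws) qs = let qs′ , q = ▷⁻ (history is (view ws)) qs in q ∷ history⁻ is ws qs′

  latestIsMax-record : ∀ is z ws → All (Comparable z) ws →
                       latestIsMax (history is (view (z ∷ ws))) ≡ isRecord z ws
  latestIsMax-record is z ws cs
    rewrite latest-▷ (history is (view ws)) (is (length (view ws)) , rank z) with isRecord z ws in r
  ... | true  = dec-true (noneAbove? (rank z) (history is (view (z ∷ ws)))) λ i z<i → ℕ.<⇒≱ z<i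
    (VecAll.lookup⁺ (history⁺ {Q = Fin._≤ rank z} is (z ∷ ws) (ℕ.≤-refl ∷ record-only-if cs r)) i)
  ... | false = dec-false (noneAbove? (rank z) (history is (view (z ∷ ws)))) λ above → true≢false
    (trans (sym (record-if cs (All.tail (history⁻ {Q = Fin._≤ rank z} is (z ∷ ws)
      (VecAll.lookup⁻ λ i → ℕ.≮⇒≥ (above i)))))) r)
    where
    true≢false : ¬ true ≡ false
    true≢false ()

  accepts-threshold : ∀ is ws → AllPairs Comparable ws →
                      status (accepts thresholdAlgorithm is) (view ws) ≡ status (threshold n) (view ws)
  accepts-threshold is []       _         = refl
  accepts-threshold is (z ∷ ws) (cs ∷ ps) = cong₂ (λ s a → step s a (isRecord z ws))
    (accepts-threshold is ws ps)
    (cong (_∧ worthwhile n (suc (length (view ws)))) (latestIsMax-record is z ws cs))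

  open Views {M} {⊤} (λ _ → tt) using () renaming (view to flags)

  -- Passes to views without digits, for which the optimality results hold exactly under the acyclic
  -- law.
  threshold-flags : ∀ ws → status (threshold n) (view ws) ≡ status (threshold n) (flags {h} ws)
  threshold-flags []       = refl
  threshold-flags (z ∷ ws) = cong₂ (λ s l → step s (isRecord z ws ∧ worthwhile n (suc l)) (isRecord z ws))
    (threshold-flags ws) (same-length ws)
    where
    same-length : ∀ ws → length (view ws) ≡ length (flags ws)
    same-length []       = refl
    same-length (_ ∷ ws) = cong suc (same-length ws)

  wins-threshold : ∀ π xs ys → Sorted xs → ys ↭ xs →
                   wins thresholdAlgorithm π ys ≡ won (status (threshold n) (flags ys))
  wins-threshold π xs ys sorted ys↭xs = cong won
    (trans (accepts-threshold (ids π) ys (comparable sorted ys↭xs)) (threshold-flags ys))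

uniformPermutation-mono : ∀ n → Monotone (uniformPermutation n)
uniformPermutation-mono n f≤g = *-monoˡ (0≤recipFactorial n) (sum-mono (permutations n) f≤g)

won≥0 : ∀ s → 0ℚ ≤ℚ won s
won≥0 waiting = ℚ.≤-refl
won≥0 holding = 0≤1
won≥0 lost    = ℚ.≤-refl

orderings-0≤ : ∀ {A : Set} n (xs : List A) {f} → (∀ ys → 0ℚ ≤ℚ f ys) → 0ℚ ≤ℚ orderings n xs f
orderings-0≤ n xs {f} 0≤f = subst (_≤ℚ orderings n xs f) (orderings.vanish n xs) (orderings-mono n xs 0≤f)

vector : ∀ {A : Set} {n} (xs : List A) → length xs ≡ n → ∃ λ (v : Vec A n) → toList v ≡ xs
vector xs refl = fromList xs , Vec.toList∘fromList xs

-- Existence of optimal algorithms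

-- Admissibility asks for maxima that are attained. Algorithms are functions on infinitely many
-- histories, but a payoff depends on finitely many decisions. Equal keys stand for histories that
-- the player cannot distinguish.
module Maximum {H Key : Set} (key : H → Key) (_≟_ : DecidableEquality Key) where

  Respects : (H → Bool) → Set
  Respects A = ∀ h h′ → key h ≡ key h′ → A h ≡ A h′

  DependsOn : List H → ((H → Bool) → ℚ) → Set
  DependsOn hs R = ∀ A A′ → All (λ h → A h ≡ A′ h) hs → R A ≡ R A′

  -- Overrides the whole class of `h`, so that the result still respects the keys.
  update : H → Bool → (H → Bool) → H → Bool
  update h b A h′ = if does (key h ≟ key h′) then b else A h′

  update-respects : ∀ h b {A} → Respects A → Respects (update h b A)
  update-respects h b resp h′ h″ eq =
    cong₂ (λ k a → if does (key h ≟ k) then b else a) eq (resp h′ h″ eq)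

  update-agree : ∀ h b {A A′ h′} → A h′ ≡ A′ h′ → update h b A h′ ≡ update h b A′ h′
  update-agree h b {h′ = h′} = cong (if does (key h ≟ key h′) then b else_)

  update-self : ∀ h b A A′ → update h b A h ≡ update h b A′ h
  update-self h b A A′ rewrite dec-true (key h ≟ key h) refl = refl

  update-current : ∀ h {A} → Respects A → ∀ h′ → A h′ ≡ update h (A h) A h′
  update-current h resp h′ with key h ≟ key h′
  ... | yes eq = resp h′ h (sym eq)
  ... | no  _  = refl

  -- Branches on the decision at `h`. A respectful algorithm coincides with its own update at `h`,
  -- so it falls under one of the two branches, and the payoffs of their optima are rationals that
  -- can be compared.
  maximum : ∀ hs R → DependsOn hs R → ∃ λ A → Respects A × (∀ A′ → Respects A′ → R A′ ≤ℚ R A)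
  maximum []       R dep = (λ _ → false) , (λ _ _ _ → refl) , λ A′ _ → ℚ.≤-reflexive (dep A′ _ [])
  maximum (h ∷ hs) R dep = choose (R₁ A₁ ℚ.≤? R₀ A₀)
    where
    best : ∀ b → ∃ λ A → Respects A × (∀ A′ → Respects A′ → R (update h b A′) ≤ℚ R (update h b A))
    best b = maximum hs (λ A → R (update h b A)) λ A A′ agree →
      dep (update h b A) (update h b A′)
        (update-self h b A A′ ∷ All.map (update-agree h b {A} {A′}) agree)
    R₀ R₁ : (H → Bool) → ℚ
    R₀ A = R (update h false A)
    R₁ A = R (update h true A)
    A₀ A₁ : H → Bool
    A₀ = proj₁ (best false)
    A₁ = proj₁ (best true)
    bound : ∀ c → R₀ A₀ ≤ℚ c → R₁ A₁ ≤ℚ c → ∀ A′ → Respects A′ → R A′ ≤ℚ c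
    bound c 0≤c 1≤c A′ resp = ℚ.≤-trans
      (ℚ.≤-reflexive (dep A′ (update h (A′ h) A′) (All.universal (update-current h resp) (h ∷ hs))))
      (at (A′ h))
      where
      at : ∀ b → R (update h b A′) ≤ℚ c
      at false = ℚ.≤-trans (proj₂ (proj₂ (best false)) A′ resp) 0≤c
      at true  = ℚ.≤-trans (proj₂ (proj₂ (best true)) A′ resp) 1≤c
    choose : Dec (R₁ A₁ ≤ℚ R₀ A₀) → ∃ λ A → Respects A × (∀ A′ → Respects A′ → R A′ ≤ℚ R A)
    choose (yes 1≤0) = update h false A₀ , update-respects h false (proj₁ (proj₂ (best false))) ,
      bound (R₀ A₀) ℚ.≤-refl 1≤0
    choose (no  1≰0) = update h true A₁ , update-respects h true (proj₁ (proj₂ (best true))) ,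
      bound (R₁ A₁) (ℚ.<⇒≤ (ℚ.≰⇒> 1≰0)) ℚ.≤-refl

vectors : ∀ {A : Set} → List A → ∀ k → List (Vec A k)
vectors as zero    = [] ∷ []
vectors as (suc k) = cartesianProductWith _∷_ as (vectors as k)

∈-vectors : ∀ {A : Set} {as : List A} → (∀ a → a ∈ as) → ∀ {k} (v : Vec A k) → v ∈ vectors as k
∈-vectors all []      = here refl
∈-vectors all (a ∷ v) = ∈-cartesianProductWith⁺ _∷_ (all a) (∈-vectors all v)

module _ (N n : ℕ) where

  AnyHistory : Set
  AnyHistory = Σ ℕ (History N n)

  ofLength : ℕ → List AnyHistory
  ofLength k = map (k ,_) (vectors (cartesianProduct (allFin n) (allFin N)) k)

  histories : List AnyHistory
  histories = concatMap ofLength (upTo (suc n))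

  ∈-histories : ∀ {k} → k ≤ n → (h : History N n k) → (k , h) ∈ histories
  ∈-histories {k} k≤n h = ∈-concat⁺′
    (∈-map⁺ (k ,_) (∈-vectors (λ (i , v) → ∈-cartesianProduct⁺ (∈-allFin i) (∈-allFin v)) h))
    (∈-map⁺ ofLength (∈-upTo⁺ (s≤s k≤n)))

  run-cong : ∀ (A A′ : Algorithm N n) → All (λ (k , h) → A k h ≡ A′ k h) histories →
             ∀ {k l} (seen : History N n k) (os : Vec (Observation N n) l) → k ℕ.+ l ≤ n →
             run A seen os ≡ run A′ seen os
  run-cong A A′ agree seen Vec.[]       _     = refl
  run-cong A A′ agree {k} {suc l} seen (o Vec.∷ os) k+l≤n
    rewrite All.lookup agree (∈-histories
              (ℕ.≤-trans (ℕ.m≤m+n (suc k) l) (subst (_≤ n) (ℕ.+-suc k l) k+l≤n)) (seen ▷ o))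
    with A′ (suc k) (seen ▷ o)
  ... | true  = refl
  ... | false = run-cong A A′ agree (seen ▷ o) os (subst (_≤ n) (ℕ.+-suc k l) k+l≤n)

  winProbability-cong : ∀ (A A′ : Algorithm N n) → All (λ (k , h) → A k h ≡ A′ k h) histories →
                        ∀ S → winProbability A S ≡ winProbability A′ S
  winProbability-cong A A′ agree S = cong (recipFactorial n *_) (sum.ext (permutations n) λ σ →
    cong (recipFactorial n *_) (sum.ext (permutations n) λ π →
      cong (reward S) (run-cong A A′ agree Vec.[] (arrivals S σ π) ℕ.≤-refl)))

  module _ (F : Measure (NSubset N n)) where

    open Maximum using (maximum; Respects)

    average : Algorithm N n → ℚ
    average A = ∫ F (winProbability A)

    bestAlgorithm : ∀ {Key : Set} (key : AnyHistory → Key) (_≟_ : DecidableEquality Key) →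
                    ∃ λ (A : Algorithm N n) → Respects key _≟_ (uncurry A) ×
                      (∀ A′ → Respects key _≟_ (uncurry A′) → average A′ ≤ℚ average A)
    bestAlgorithm key _≟_ =
      let A , resp , best = maximum key _≟_ histories (λ A → average (λ k h → A (k , h)))
            λ A A′ agree → ∫.ext F (winProbability-cong (λ k h → A (k , h)) (λ k h → A′ (k , h)) agree)
      in (λ k h → A (k , h)) , resp , λ A′ → best (uncurry A′)

    bestCardinal : ∃ λ (A : Algorithm N n) → ∀ A′ → average A′ ≤ℚ average A
    bestCardinal =
      let A , _ , best = bestAlgorithm id (Product.≡-dec ℕ._≟_ (Vec.≡-dec (Product.≡-dec Fin._≟_ Fin._≟_)))
      in A , λ A′ → best A′ λ h h′ eq → cong (uncurry A′) eq

    OrdinalKey : Set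
    OrdinalKey = Σ ℕ λ k → Vec (Fin n) k × Vec (Vec Bool k) k

    -- The matrix of comparisons encodes a ranking by data with decidable equality.
    order : ∀ {k} → History N n k → Vec (Vec Bool k) k
    order h = Vec.tabulate λ i → Vec.tabulate λ j →
      does (proj₂ (lookup h i) Fin.<? proj₂ (lookup h j))

    ordinalKey : AnyHistory → OrdinalKey
    ordinalKey (k , h) = k , Vec.map proj₁ h , order h

    ordinalKey-≟ : DecidableEquality OrdinalKey
    ordinalKey-≟ = Product.≡-dec ℕ._≟_ (Product.≡-dec (Vec.≡-dec Fin._≟_) (Vec.≡-dec (Vec.≡-dec Bool._≟_)))

    does-≡⇒ : ∀ {P Q : Set} (P? : Dec P) (Q? : Dec Q) → does P? ≡ does Q? → P → Q
    does-≡⇒ P? (yes q) eq p = q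
    does-≡⇒ P? (no ¬q) eq p with () ← trans (sym (dec-true P? p)) eq

    order-injective : ∀ {k} (h h′ : History N n k) → order h ≡ order h′ → SameRanking h h′
    order-injective h h′ eq i j = mk⇔
      (does-≡⇒ (_ Fin.<? _) (_ Fin.<? _) (entries i j))
      (does-≡⇒ (_ Fin.<? _) (_ Fin.<? _) (sym (entries i j)))
      where
      entries : ∀ i j → does (proj₂ (lookup h i) Fin.<? proj₂ (lookup h j)) ≡
                does (proj₂ (lookup h′ i) Fin.<? proj₂ (lookup h′ j))
      entries i j = trans (sym (entryAt h i j)) (trans (cong (λ o → lookup (lookup o i) j) eq) (entryAt h′ i j))
        where
        entryAt : ∀ (h : History N n _) i j → lookup (lookup (order h) i) j ≡
                  does (proj₂ (lookup h i) Fin.<? proj₂ (lookup h j))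
        entryAt h i j = trans (cong (λ v → lookup v j) (Vec.lookup∘tabulate _ i)) (Vec.lookup∘tabulate _ j)

    ordinal-respects : ∀ {A} → Ordinal A → Respects ordinalKey ordinalKey-≟ (uncurry A)
    ordinal-respects ord (k , h) (k′ , h′) eq with refl ← cong proj₁ eq =
      ord k h h′ (cong proj₁ (snd eq)) (order-injective h h′ (cong proj₂ (snd eq)))
      where
      snd : ∀ {k} {x y : Vec (Fin n) k × Vec (Vec Bool k) k} → _≡_ {A = OrdinalKey} (k , x) (k , y) → x ≡ y
      snd refl = refl

    respects-ordinal : ∀ {A} → Respects ordinalKey ordinalKey-≟ (uncurry A) → Ordinal A
    respects-ordinal resp k h h′ ids rank = resp (k , h) (k , h′) (cong (k ,_) (cong₂ _,_ ids
      (Vec.tabulate-cong λ i → Vec.tabulate-cong λ j → does-⇔ (rank i j) (_ Fin.<? _) (_ Fin.<? _))))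

    bestOrdinal : ∃ λ (A : Algorithm N n) → Ordinal A × (∀ A′ → Ordinal A′ → average A′ ≤ℚ average A)
    bestOrdinal =
      let A , resp , best = bestAlgorithm ordinalKey ordinalKey-≟
      in A , respects-ordinal resp , λ A′ ord → best A′ (ordinal-respects ord)

-- Rewards as real numbers

≤-+ʳ : ∀ {p q} r → 0ℚ ≤ℚ r → p ≤ℚ q → p ≤ℚ q + r
≤-+ʳ {p} {q} r 0≤r p≤q = subst (_≤ℚ q + r) (ℚ.+-identityʳ p) (ℚ.+-mono-≤ p≤q 0≤r)

≤ᴿ-pointwise : ∀ x y → (∀ m → seq x m ≤ℚ seq y m) → x ≤ᴿ y
≤ᴿ-pointwise x y x≤y δ 0<δ = 0 , λ m _ → ≤-+ʳ δ (ℚ.<⇒≤ 0<δ) (x≤y m)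

≃ᴿ-pointwise : ∀ x y → (∀ m → seq x m ≡ seq y m) → x ≃ᴿ y
≃ᴿ-pointwise x y x≡y = ≤ᴿ-pointwise x y (λ m → ℚ.≤-reflexive (x≡y m)) ,
                       ≤ᴿ-pointwise y x (λ m → ℚ.≤-reflexive (sym (x≡y m)))

seq-sumᴿ : ∀ {A : Set} (xs : List A) (f : A → ℝ) m → seq (sumᴿ (map f xs)) m ≡ sum xs (λ x → seq (f x) m)
seq-sumᴿ []       f m = refl
seq-sumᴿ (x ∷ xs) f m = cong (_+_ (seq (f x) m)) (seq-sumᴿ xs f m)

sum-outcomes : ∀ {A : Set} (μ : Measure A) (g : A → ℚ) m →
               sum (map (λ (w , a) → fromℚ w , a) μ) (λ (w , a) → seq w m * g a) ≡ ∫ μ g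
sum-outcomes []            g m = refl
sum-outcomes ((w , a) ∷ μ) g m = cong (_+_ (w * g a)) (sum-outcomes μ g m)

distribution : ∀ {A : Set} (μ : Measure A) → NonNeg μ → ∫ μ (λ _ → 1ℚ) ≡ 1ℚ → Dist A
distribution {A} μ 0≤μ mass = record
  { outcomes = weighted
  ; weight≥0 = nonNeg μ 0≤μ
  ; total≃1  = ≃ᴿ-pointwise (sumᴿ (map proj₁ weighted)) 1ᴿ λ m → trans (seq-sumᴿ weighted proj₁ m) (trans
      (sum.ext weighted λ (w , a) → sym (ℚ.*-identityʳ (seq w m)))
      (trans (sum-outcomes μ (λ _ → 1ℚ) m) mass))
  }
  where
  weighted : List (ℝ × A)
  weighted = map (λ (w , a) → fromℚ w , a) μ
  nonNeg : ∀ (μ : Measure A) → NonNeg μ → All (λ o → 0ᴿ ≤ᴿ proj₁ o) (map (λ (w , a) → fromℚ w , a) μ)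
  nonNeg []            []          = []
  nonNeg ((w , a) ∷ μ) (0≤w ∷ 0≤μ) = ≤ᴿ-pointwise 0ᴿ (fromℚ w) (λ _ → 0≤w) ∷ nonNeg μ 0≤μ

½+½ : ∀ δ → ½ * δ + ½ * δ ≡ δ
½+½ = solve 1 (λ δ → con ½ :* δ :+ con ½ :* δ := δ) refl

0<½* : ∀ {δ} → 0ℚ <ℚ δ → 0ℚ <ℚ ½ * δ
0<½* {δ} 0<δ = subst (_<ℚ ½ * δ) (ℚ.*-zeroʳ ½) (ℚ.*-monoʳ-<-pos ½ 0<δ)

-- The witness δ/(1 + c) avoids the case distinction whether `c` is 0.
shrink : ∀ {c δ} → 0ℚ ≤ℚ c → 0ℚ <ℚ δ → ∃ λ η → 0ℚ <ℚ η × η * c ≤ℚ δ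
shrink {c} {δ} 0≤c 0<δ = δ * r , 0<δr , (begin
  δ * r * c           ≤⟨ *-monoˡ (ℚ.<⇒≤ 0<δr) (subst (_≤ℚ 1ℚ + c) (ℚ.+-identityˡ c) (ℚ.+-monoˡ-≤ c 0≤1)) ⟩
  δ * r * (1ℚ + c)    ≡⟨ ℚ.*-assoc δ r (1ℚ + c) ⟩
  δ * (r * (1ℚ + c))  ≡⟨ cong (δ *_) (ℚ.*-inverseˡ (1ℚ + c)) ⟩
  δ * 1ℚ              ≡⟨ ℚ.*-identityʳ δ ⟩
  δ                   ∎)
  where
  open ℚ.≤-Reasoning
  instance
    1+c>0 : Positive (1ℚ + c)
    1+c>0 = positive (ℚ.+-mono-<-≤ (ℚ.positive⁻¹ 1ℚ) 0≤c)
    1+c≢0 = ℚ.pos⇒nonZero (1ℚ + c)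
    r>0 : Positive (1/ (1ℚ + c))
    r>0 = ℚ.1/pos⇒pos (1ℚ + c)
  r : ℚ
  r = 1/ (1ℚ + c)
  0<δr : 0ℚ <ℚ δ * r
  0<δr = subst (_<ℚ δ * r) (ℚ.*-zeroˡ r) (ℚ.*-monoˡ-<-pos r 0<δ)

-- Nonnegative real weights may have slightly negative approximations. Each outcome gets half of the
-- tolerance that is left.
weighted-0≤ : ∀ {B : Set} (os : List (ℝ × B)) (c : B → ℚ) → (∀ b → 0ℚ ≤ℚ c b) → All (λ o → 0ᴿ ≤ᴿ proj₁ o) os →
              ∀ δ → 0ℚ <ℚ δ → Eventually λ m → 0ℚ ≤ℚ sum os (λ (w , b) → seq w m * c b) + δ
weighted-0≤ []             c 0≤c []          δ 0<δ = 0 , λ m _ → ≤-+ʳ δ (ℚ.<⇒≤ 0<δ) ℚ.≤-refl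
weighted-0≤ ((w , b) ∷ os) c 0≤c (0≤w ∷ 0≤os) δ 0<δ =
  let η , 0<η , ηc≤½δ = shrink (0≤c b) (0<½* 0<δ)
      K , hK = 0≤w η 0<η
      L , hL = weighted-0≤ os c 0≤c 0≤os (½ * δ) (0<½* 0<δ)
  in K ℕ.⊔ L , λ m K⊔L≤m →
    let S = sum os (λ (w , b) → seq w m * c b) in begin
    0ℚ
      ≤⟨ 0≤+ (0≤* (hK m (ℕ.m⊔n≤o⇒m≤o K L K⊔L≤m)) (0≤c b)) (hL m (ℕ.m⊔n≤o⇒n≤o K L K⊔L≤m)) ⟩
    (seq w m + η) * c b + (S + ½ * δ)
      ≡⟨ solve 5 (λ w η c s d → (w :+ η) :* c :+ (s :+ d) := η :* c :+ (w :* c :+ s :+ d)) refl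
           (seq w m) η (c b) S (½ * δ) ⟩
    η * c b + (seq w m * c b + S + ½ * δ)
      ≤⟨ ℚ.+-monoˡ-≤ (seq w m * c b + S + ½ * δ) ηc≤½δ ⟩
    ½ * δ + (seq w m * c b + S + ½ * δ)
      ≡⟨ trans (solve 2 (λ d t → d :+ (t :+ d) := t :+ (d :+ d)) refl (½ * δ) (seq w m * c b + S))
           (cong (_+_ (seq w m * c b + S)) (½+½ δ)) ⟩
    seq w m * c b + S + δ
      ∎
  where open ℚ.≤-Reasoning

module _ {N n : ℕ} (μ : Measure (NSubset N n)) (0≤μ : NonNeg μ) (mass : ∫ μ (λ _ → 1ℚ) ≡ 1ℚ) where

  payoffᶠ : Algorithm N n → ℚ
  payoffᶠ A = ∫ μ (winProbability A)

  F : Dist (NSubset N n)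
  F = distribution μ 0≤μ mass

  seq-expectedReward : ∀ {P : Algorithm N n → Set} (𝒜 : Randomized P) m →
    seq (expectedReward F 𝒜) m ≡ sum (outcomes 𝒜) (λ (w , A , _) → seq w m * payoffᶠ A)
  seq-expectedReward 𝒜 m = trans
    (seq-sumᴿ (outcomes 𝒜) (λ (w , A , _) → w *ᴿ 𝔼 F λ S → fromℚ (winProbability A S)) m)
    (sum.ext (outcomes 𝒜) λ (w , A , _) → cong (seq w m *_) (trans
      (seq-sumᴿ (outcomes F) (λ (w , S) → w *ᴿ fromℚ (winProbability A S)) m)
      (sum-outcomes μ (winProbability A) m)))

  -- A mixture cannot beat the bound on its components. One half of `δ` pays for weights whose
  -- approximations are negative, the other for a total weight whose approximations exceed 1.
  expectedReward≤ : ∀ {P : Algorithm N n → Set} {v} → 0ℚ ≤ℚ v → (∀ A → P A → payoffᶠ A ≤ℚ v) →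
                    (𝒜 : Randomized P) → expectedReward F 𝒜 ≤ᴿ fromℚ v
  expectedReward≤ {P} {v} 0≤v bound 𝒜 δ 0<δ =
    let η , 0<η , ηv≤½δ = shrink 0≤v (0<½* 0<δ)
        K , hK = proj₁ (total≃1 𝒜) η 0<η
        L , hL = weighted-0≤ (outcomes 𝒜) gap 0≤gap (weight≥0 𝒜) (½ * δ) (0<½* 0<δ)
    in K ℕ.⊔ L , λ m K⊔L≤m →
      let W = sum (outcomes 𝒜) (λ (w , _) → seq w m)
          S = sum (outcomes 𝒜) (λ (w , A , _) → seq w m * payoffᶠ A)
          G = sum (outcomes 𝒜) (λ (w , o) → seq w m * gap o)
          G≡ : G ≡ W * v - S
          G≡ = trans (sum.ext (outcomes 𝒜) λ (w , A , _) →
                 solve 3 (λ w v p → w :* (v :- p) := w :* v :- w :* p) refl (seq w m) v (payoffᶠ A))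
                 (trans (sum.sub (outcomes 𝒜) (λ (w , _) → seq w m * v) (λ (w , A , _) → seq w m * payoffᶠ A))
                   (cong (_- S) (sum.mulʳ (outcomes 𝒜) v (λ (w , _) → seq w m))))
          W≤ : W ≤ℚ 1ℚ + η
          W≤ = subst (_≤ℚ 1ℚ + η) (seq-sumᴿ (outcomes 𝒜) proj₁ m) (hK m (ℕ.m⊔n≤o⇒m≤o K L K⊔L≤m))
      in begin
      seq (expectedReward F 𝒜) m
        ≡⟨ seq-expectedReward 𝒜 m ⟩
      S
        ≡⟨ sym (ℚ.+-identityʳ S) ⟩
      S + 0ℚ
        ≤⟨ ℚ.+-monoʳ-≤ S (hL m (ℕ.m⊔n≤o⇒n≤o K L K⊔L≤m)) ⟩
      S + (G + ½ * δ)
        ≡⟨ trans (cong (λ g → S + (g + ½ * δ)) G≡)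
             (solve 4 (λ s w v d → s :+ (w :* v :- s :+ d) := w :* v :+ d) refl S W v (½ * δ)) ⟩
      W * v + ½ * δ
        ≤⟨ ℚ.+-monoˡ-≤ (½ * δ) (*-monoʳ 0≤v W≤) ⟩
      (1ℚ + η) * v + ½ * δ
        ≡⟨ solve 3 (λ η v d → (con 1ℚ :+ η) :* v :+ d := η :* v :+ (v :+ d)) refl η v (½ * δ) ⟩
      η * v + (v + ½ * δ)
        ≤⟨ ℚ.+-monoˡ-≤ (v + ½ * δ) ηv≤½δ ⟩
      ½ * δ + (v + ½ * δ)
        ≡⟨ trans (solve 2 (λ d v → d :+ (v :+ d) := v :+ (d :+ d)) refl (½ * δ) v) (cong (_+_ v) (½+½ δ)) ⟩
      v + δ
        ∎
    where
    open ℚ.≤-Reasoning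
    gap : Σ (Algorithm N n) P → ℚ
    gap (A , _) = v - payoffᶠ A
    0≤gap : ∀ o → 0ℚ ≤ℚ gap o
    0≤gap (A , p) = subst (_≤ℚ v - payoffᶠ A) (ℚ.+-inverseʳ (payoffᶠ A)) (ℚ.+-monoˡ-≤ (- payoffᶠ A) (bound A p))

  deterministic : ∀ {P : Algorithm N n → Set} A → P A → Randomized P
  deterministic A p = distribution ((1ℚ , (A , p)) ∷ []) (0≤1 ∷ []) refl

  isMaxReward : ∀ {P : Algorithm N n → Set} A → P A → 0ℚ ≤ℚ payoffᶠ A → (∀ A′ → P A′ → payoffᶠ A′ ≤ℚ payoffᶠ A) →
                IsMaxReward F P (fromℚ (payoffᶠ A))
  isMaxReward {P} A p 0≤A best =
    (deterministic A p , ≃ᴿ-pointwise (expectedReward F (deterministic {P} A p)) (fromℚ (payoffᶠ A)) λ m → trans (seq-expectedReward {P} (deterministic A p) m)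
      (trans (ℚ.+-identityʳ (1ℚ * payoffᶠ A)) (ℚ.*-identityˡ (payoffᶠ A)))) ,
    expectedReward≤ 0≤A best

-- `opt` is a benchmark between the two maxima: it bounds the cardinal one up to the factor `r`, and
-- the ordinal one from below through `D`. The maxima themselves come from the finite search.
nearlyOptimal⇒admissible : ∀ {N n} (μ : Measure (NSubset N n)) → NonNeg μ → ∫ μ (λ _ → 1ℚ) ≡ 1ℚ →
  ∀ ε {opt r D} → 0ℚ ≤ℚ opt → 0ℚ ≤ℚ r → (∀ A → ∫ μ (winProbability A) ≤ℚ r * opt) →
  Ordinal D → opt ≤ℚ ∫ μ (winProbability D) → (Eventually λ i → r ≤ℚ 1ℚ + seq ε i) → Admissible n ε N
nearlyOptimal⇒admissible {N} {n} μ 0≤μ mass ε {opt} {r} {D} 0≤opt 0≤r cardinal≤ D-ordinal opt≤D (K , r≤1+ε) =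
  F μ 0≤μ mass , fromℚ (average N n μ A) , fromℚ (average N n μ B) ,
  isMaxReward μ 0≤μ mass A tt (ℚ.≤-trans (ℚ.≤-trans 0≤opt opt≤D) (A-best D)) (λ A′ _ → A-best A′) ,
  isMaxReward μ 0≤μ mass B B-ordinal 0≤payoffB B-best ,
  λ δ 0<δ → K , λ i K≤i → ≤-+ʳ δ (ℚ.<⇒≤ 0<δ) (begin
    average N n μ A
      ≤⟨ cardinal≤ A ⟩
    r * opt
      ≤⟨ *-monoʳ 0≤opt (r≤1+ε i K≤i) ⟩
    (1ℚ + seq ε i) * opt
      ≤⟨ *-monoˡ (ℚ.≤-trans 0≤r (r≤1+ε i K≤i)) opt≤payoffB ⟩
    (1ℚ + seq ε i) * average N n μ B
      ∎)
  where
  open ℚ.≤-Reasoning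
  cardinal = bestCardinal N n μ
  ordinal  = bestOrdinal N n μ
  A B : Algorithm N n
  A = proj₁ cardinal
  B = proj₁ ordinal
  A-best : ∀ A′ → average N n μ A′ ≤ℚ average N n μ A
  A-best = proj₂ cardinal
  B-ordinal : Ordinal B
  B-ordinal = proj₁ (proj₂ ordinal)
  B-best : ∀ A′ → Ordinal A′ → average N n μ A′ ≤ℚ average N n μ B
  B-best = proj₂ (proj₂ ordinal)
  opt≤payoffB : opt ≤ℚ average N n μ B
  opt≤payoffB = ℚ.≤-trans opt≤D (B-best D D-ordinal)
  0≤payoffB : 0ℚ ≤ℚ average N n μ B
  0≤payoffB = ℚ.≤-trans 0≤opt opt≤payoffB

-- The adversary for n = h + 1 numbers and its two payoffs

module Bounds (m h : ℕ) where

  open Digits m hiding (M)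
  open Wins (suc (suc m)) h (suc h) zero

  subsets : (μ : Measure (List (Value (suc (suc m)) h))) → All (λ o → length (proj₂ o) ≡ suc h) μ →
            All (λ o → Sorted (proj₂ o)) μ → Measure (NSubset (suc (suc m) ^ h) (suc h))
  subsets []             []           []           = []
  subsets ((w , xs) ∷ μ) (|xs| ∷ |μ|) (sxs ∷ sμ) =
    (w , subset (proj₁ (vector xs |xs|)) (subst Sorted (sym (proj₂ (vector xs |xs|))) sxs)) ∷ subsets μ |μ| sμ

  subsets-nonNeg : ∀ μ |μ| sμ → NonNeg μ → NonNeg (subsets μ |μ| sμ)
  subsets-nonNeg []             []           []         []          = []
  subsets-nonNeg ((w , xs) ∷ μ) (|xs| ∷ |μ|) (sxs ∷ sμ) (0≤w ∷ 0≤μ) = 0≤w ∷ subsets-nonNeg μ |μ| sμ 0≤μ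

  averageWins : Algorithm (suc (suc m) ^ h) (suc h) → List (Value (suc (suc m)) h) → ℚ
  averageWins A xs = uniformPermutation (suc h) λ π → recipFactorial (suc h) * orderings (suc h) xs (wins A π)

  ∫-subsets : ∀ A μ |μ| sμ → ∫ (subsets μ |μ| sμ) (winProbability A) ≡ ∫ μ (averageWins A)
  ∫-subsets A []             []           []         = refl
  ∫-subsets A ((w , xs) ∷ μ) (|xs| ∷ |μ|) (sxs ∷ sμ) = cong₂ _+_
    (cong (w *_) (trans (winProbability-orderings A (proj₁ (vector xs |xs|))
        (subst Sorted (sym (proj₂ (vector xs |xs|))) sxs))
      (cong (averageWins A) (proj₂ (vector xs |xs|)))))
    (∫-subsets A μ |μ| sμ)

  ∫-subsets-const : ∀ c μ |μ| sμ → ∫ (subsets μ |μ| sμ) (λ _ → c) ≡ ∫ μ (λ _ → c)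
  ∫-subsets-const c []             []           []         = refl
  ∫-subsets-const c ((w , xs) ∷ μ) (|xs| ∷ |μ|) (sxs ∷ sμ) = cong (_+_ (w * c)) (∫-subsets-const c μ |μ| sμ)

  sorted : All (λ o → Sorted (proj₂ o)) (Real.hierarchy h (suc h))
  sorted = hierarchy-sorted digit adjacent adjacent-increasing h (suc h) ℕ.≤-refl

  abstract

    adversary : Measure (NSubset (suc (suc m) ^ h) (suc h))
    adversary = subsets (Real.hierarchy h (suc h)) (Real.hierarchy-length h (suc h)) sorted

    adversary-nonNeg : NonNeg adversary
    adversary-nonNeg = subsets-nonNeg (Real.hierarchy h (suc h)) (Real.hierarchy-length h (suc h)) sorted
      (Real.hierarchy-nonNeg 0≤digit 0≤adjacent h (suc h))

    adversary-mass : ∫ adversary (λ _ → 1ℚ) ≡ 1ℚ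
    adversary-mass = trans (∫-subsets-const 1ℚ (Real.hierarchy h (suc h)) (Real.hierarchy-length h (suc h)) sorted) (begin
      ∫ H (λ _ → 1ℚ)
        ≡⟨ sym (trans (cong (_* ∫ H (λ _ → 1ℚ)) (recipFactorial-inverse (suc h))) (ℚ.*-identityˡ (∫ H (λ _ → 1ℚ)))) ⟩
      recipFactorial (suc h) * ι (suc h !) * ∫ H (λ _ → 1ℚ)
        ≡⟨ ℚ.*-assoc (recipFactorial (suc h)) (ι (suc h !)) (∫ H (λ _ → 1ℚ)) ⟩
      recipFactorial (suc h) * (ι (suc h !) * ∫ H (λ _ → 1ℚ))
        ≡⟨ cong (recipFactorial (suc h) *_) (trans
             (sym (∫.mul H (ι (suc h !)) (λ _ → 1ℚ)))
             (∫-cong (Real.hierarchy-length h (suc h)) λ xs |xs| →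
               trans (ℚ.*-identityʳ (ι (suc h !))) (sym (orderings-1 (suc h) xs |xs|)))) ⟩
      recipFactorial (suc h) * Real.P h (suc h) (λ _ → 1ℚ)
        ≡⟨ cong (recipFactorial (suc h) *_) (P-1 h (suc h) ℕ.≤-refl) ⟩
      recipFactorial (suc h) * ι (suc h !)
        ≡⟨ recipFactorial-inverse (suc h) ⟩
      1ℚ
        ∎)
      where
      open ≡-Reasoning
      H : Measure (List (Value (suc (suc m)) h))
      H = Real.hierarchy h (suc h)

  payoff : Algorithm (suc (suc m) ^ h) (suc h) → ℚ
  payoff A = ∫ adversary (winProbability A)

  abstract

    payoff-P : ∀ A → payoff A ≡ uniformPermutation (suc h) (λ π → recipFactorial (suc h) * Real.P h (suc h) (wins A π))
    payoff-P A = trans (∫-subsets A H (Real.hierarchy-length h (suc h)) sorted)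
      (trans (∫.mul H c (λ xs → sum (permutations (suc h)) λ π → c * orderings (suc h) xs (wins A π)))
        (cong (c *_) (trans (sum-comm (∫-linear H) (permutations (suc h)) (λ xs π → c * orderings (suc h) xs (wins A π)))
          (sum.ext (permutations (suc h)) λ π → ∫.mul H c (λ xs → orderings (suc h) xs (wins A π))))))
      where
      H : Measure (List (Value (suc (suc m)) h))
      H = Real.hierarchy h (suc h)
      c : ℚ
      c = recipFactorial (suc h)

  abstract

    -- The optimal winning probability of the classical secretary problem; `value` carries a factor
    -- n = h + 1, which `recip h` removes.
    optimum : ℚ
    optimum = recip h * value 0 (suc h)

    0≤optimum : 0ℚ ≤ℚ optimum
    0≤optimum = 0≤* (0≤recip h) (0≤value 0 (suc h))

    cancel-n! : recipFactorial (suc h) * (recip h * (ι (suc h !) * value 0 (suc h))) ≡ optimum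
    cancel-n! = modulo optimum (recipFactorial-inverse (suc h))
      (solve 4 (λ c r f v → c :* (r :* (f :* v)) := r :* v :+ (c :* f :- con 1ℚ) :* (r :* v)) refl
        (recipFactorial (suc h)) (recip h) (ι (suc h !)) (value 0 (suc h)))

    win≡optimum : ∀ x → ι (suc h) * x ≡ ι (suc h !) * value 0 (suc h) → recipFactorial (suc h) * x ≡ optimum
    win≡optimum x n*x≡ = trans
      (cong (recipFactorial (suc h) *_) (trans (sym (recip-cancel h x)) (cong (recip h *_) n*x≡)))
      cancel-n!

    win≤optimum : ∀ x → ι (suc h) * x ≤ℚ ι (suc h !) * value 0 (suc h) → recipFactorial (suc h) * x ≤ℚ optimum
    win≤optimum x n*x≤ = ℚ.≤-trans
      (*-monoˡ (0≤recipFactorial (suc h))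
        (subst (_≤ℚ recip h * (ι (suc h !) * value 0 (suc h))) (recip-cancel h x) (*-monoˡ (0≤recip h) n*x≤)))
      (ℚ.≤-reflexive cancel-n!)

  -- Winning is a nonnegative functional of the list of values, so the acyclic law may be exchanged
  -- for the cyclic one at the cost of `pow ρ h`. There even a player who sees all digits cannot
  -- exceed `optimum`, for each `π` separately.
  payoff≤ : ∀ A → payoff A ≤ℚ pow ρ h * optimum
  payoff≤ A = ℚ.≤-trans (ℚ.≤-reflexive (payoff-P A)) (ℚ.≤-trans
    (uniformPermutation-mono (suc h) each)
    (ℚ.≤-reflexive (uniformPermutation-const (suc h) (pow ρ h * optimum))))
    where
    open ℚ.≤-Reasoning
    each : ∀ π → recipFactorial (suc h) * Real.P h (suc h) (wins A π) ≤ℚ pow ρ h * optimum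
    each π = begin
      recipFactorial (suc h) * Real.P h (suc h) (wins A π)
        ≤⟨ *-monoˡ (0≤recipFactorial (suc h)) (hierarchy-dominated h h (λ xs → orderings (suc h) xs (wins A π))
             (λ xs → orderings-0≤ (suc h) xs λ ys → won≥0 (status (Play.accepts (suc (suc m)) h (suc h) A (ids π)) (Views.view id ys)))) ⟩
      recipFactorial (suc h) * (pow ρ h * Ideal.P h (suc h) (wins A π))
        ≡⟨ solve 3 (λ c r x → c :* (r :* x) := r :* (c :* x)) refl
             (recipFactorial (suc h)) (pow ρ h) (Ideal.P h (suc h) (wins A π)) ⟩
      pow ρ h * (recipFactorial (suc h) * Ideal.P h (suc h) (wins A π))
        ≤⟨ *-monoˡ (0≤pow 0≤ρ h) (win≤optimum _
             (IdealOptimal.win≤ h (suc h) (Play.accepts (suc (suc m)) h (suc h) A (ids π)) ℕ.≤-refl)) ⟩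
      pow ρ h * optimum
        ∎

  -- The rule is evaluated under the acyclic law itself, with digits hidden, so no factor `ρ`
  -- enters.
  payoff-threshold : payoff thresholdAlgorithm ≡ optimum
  payoff-threshold = trans (payoff-P thresholdAlgorithm) (trans
    (cong (recipFactorial (suc h) *_) (sum.ext (permutations (suc h)) each))
    (uniformPermutation-const (suc h) optimum))
    where
    each : ∀ π → recipFactorial (suc h) * Real.P h (suc h) (wins thresholdAlgorithm π) ≡ optimum
    each π = win≡optimum _ (trans
      (cong (ι (suc h) *_) (∫-cong (All.zip (Real.hierarchy-length h (suc h) , sorted)) λ xs (|xs| , sxs) →
        orderings-cong (suc h) xs |xs| λ ys → wins-threshold π xs ys sxs))
      (RealOptimal.win-threshold h (suc h) ℕ.≤-refl))

  dominated-admissible : ∀ ε → (Eventually λ i → pow ρ h ≤ℚ 1ℚ + seq ε i) → Admissible (suc h) ε (suc (suc m) ^ h)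
  dominated-admissible ε = nearlyOptimal⇒admissible adversary adversary-nonNeg adversary-mass ε
    0≤optimum (0≤pow 0≤ρ h) payoff≤ thresholdAlgorithm-ordinal (ℚ.≤-reflexive (sym payoff-threshold))

-- Choice of the base

pow-* : ∀ x y n → pow (x * y) n ≡ pow x n * pow y n
pow-* x y zero    = refl
pow-* x y (suc n) = trans (cong (x * y *_) (pow-* x y n))
  (solve 4 (λ x y p q → x :* y :* (p :* q) := x :* p :* (y :* q)) refl x y (pow x n) (pow y n))

pow-1 : ∀ n → pow 1ℚ n ≡ 1ℚ
pow-1 zero    = refl
pow-1 (suc n) = trans (ℚ.*-identityˡ (pow 1ℚ n)) (pow-1 n)

pow-mono : ∀ {x y} → 0ℚ ≤ℚ x → x ≤ℚ y → ∀ n → pow x n ≤ℚ pow y n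
pow-mono         0≤x x≤y zero    = ℚ.≤-refl
pow-mono {x} {y} 0≤x x≤y (suc n) = ℚ.≤-trans
  (*-monoˡ 0≤x (pow-mono 0≤x x≤y n)) (*-monoʳ (0≤pow (ℚ.≤-trans 0≤x x≤y) n) x≤y)

ι-^ : ∀ m n → ι (m ℕ.^ n) ≡ pow (ι m) n
ι-^ m zero    = refl
ι-^ m (suc n) = trans (ι-* m (m ℕ.^ n)) (cong (ι m *_) (ι-^ m n))

seq-^ᴿ : ∀ x n m → seq (x ^ᴿ n) m ≡ pow (seq x m) n
seq-^ᴿ x zero    m = refl
seq-^ᴿ x (suc n) m = cong (seq x m *_) (seq-^ᴿ x n m)

bernoulli : ∀ u → 0ℚ ≤ℚ u → 0ℚ ≤ℚ 1ℚ - u → ∀ n → 1ℚ - ι n * u ≤ℚ pow (1ℚ - u) n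
bernoulli u 0≤u 0≤1-u zero    = ℚ.≤-reflexive (solve 1 (λ u → con 1ℚ :- con 0ℚ :* u := con 1ℚ) refl u)
bernoulli u 0≤u 0≤1-u (suc n) = begin
  1ℚ - ι (suc n) * u
    ≤⟨ ≤-+ʳ (ι n * u * u) (0≤* (0≤* (0≤ι n) 0≤u) 0≤u) ℚ.≤-refl ⟩
  1ℚ - ι (suc n) * u + ι n * u * u
    ≡⟨ solve 2 (λ n u → con 1ℚ :- (con 1ℚ :+ n) :* u :+ n :* u :* u := (con 1ℚ :- u) :* (con 1ℚ :- n :* u)) refl
         (ι n) u ⟩
  (1ℚ - u) * (1ℚ - ι n * u)
    ≤⟨ *-monoˡ 0≤1-u (bernoulli u 0≤u 0≤1-u n) ⟩
  (1ℚ - u) * pow (1ℚ - u) n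
    ∎
  where open ℚ.≤-Reasoning

-- The base is M = n(b + 2), so that n/M = 1/(b + 2); the tolerance ε is of order 1/(b + 1).
module _ (m b h : ℕ) (M≡ : suc (suc m) ≡ suc h ℕ.* suc (suc b)) where

  open Digits m

  private
    n : ℕ
    n = suc h
    u κ r r′ : ℚ
    u  = recip (suc m)
    κ  = 1ℚ - u
    r  = recip b
    r′ = recip (suc b)

    κ≡ : κ ≡ ι (suc m) * u
    κ≡ = modulo 1ℚ (sym (recip-inverse (suc m)))
      (solve 2 (λ i u → con 1ℚ :- u := i :* u :+ (con 1ℚ :- (con 1ℚ :+ i) :* u) :* con 1ℚ) refl (ι (suc m)) u)

    0≤κ : 0ℚ ≤ℚ κ
    0≤κ = subst (0ℚ ≤ℚ_) (sym κ≡) (0≤* (0≤ι (suc m)) (0≤recip (suc m)))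

    ρ*κ≡1 : ρ * κ ≡ 1ℚ
    ρ*κ≡1 = trans (cong₂ _*_ ρ≡ κ≡) (trans
      (solve 4 (λ a s i u → a :* s :* (i :* u) := a :* u :* (i :* s)) refl (ι M) (recip m) (ι (suc m)) u)
      (cong₂ _*_ (recip-inverse (suc m)) (recip-inverse m)))

    n*u≡r′ : ι n * u ≡ r′
    n*u≡r′ = trans (sym (recip-cancel (suc b) (ι n * u))) (trans
      (cong (r′ *_) (trans
        (solve 3 (λ s n u → s :* (n :* u) := n :* s :* u) refl (ι (suc (suc b))) (ι n) u)
        (trans (cong (_* u) (trans (sym (ι-* n (suc (suc b)))) (cong ι (sym M≡)))) (recip-inverse (suc m)))))
      (ℚ.*-identityʳ r′))

    h*u≤r′ : ι h * u ≤ℚ r′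
    h*u≤r′ = ℚ.≤-trans (*-monoʳ (0≤recip (suc m)) (ι-mono (ℕ.n≤1+n h))) (ℚ.≤-reflexive n*u≡r′)

    [1+r][1-r′]≡1 : (1ℚ + r) * (1ℚ - r′) ≡ 1ℚ
    [1+r][1-r′]≡1 = modulo (- r) (recip-inverse (suc b)) (modulo r′ (recip-inverse b)
      (solve 3 (λ s r r′ → (con 1ℚ :+ r) :* (con 1ℚ :- r′) :=
                con 1ℚ :+ ((con 1ℚ :+ s) :* r′ :- con 1ℚ) :* (:- r) :+ (s :* r :- con 1ℚ) :* r′) refl
        (ι (suc b)) r r′))

  -- Since ρ = 1/(1 - 1/M), Bernoulli's inequality is applied to the inverse: (1 - 1/M)^h ≥ 1 - h/M
  -- ≥ 1 - 1/(b + 2), and the inverse of the last number is exactly 1 + 1/(b + 1).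
  ρ^h≤ : pow ρ h ≤ℚ 1ℚ + recip b
  ρ^h≤ = begin
    pow ρ h
      ≡⟨ sym (trans (cong (pow ρ h *_) [1+r][1-r′]≡1) (ℚ.*-identityʳ (pow ρ h))) ⟩
    pow ρ h * ((1ℚ + r) * (1ℚ - r′))
      ≤⟨ *-monoˡ (0≤pow 0≤ρ h) (*-monoˡ (0≤+ 0≤1 (0≤recip b)) (ℚ.≤-trans
           (ℚ.+-monoʳ-≤ 1ℚ (ℚ.neg-antimono-≤ h*u≤r′))
           (bernoulli u (0≤recip (suc m)) 0≤κ h))) ⟩
    pow ρ h * ((1ℚ + r) * pow κ h)
      ≡⟨ solve 3 (λ p r k → p :* (r :* k) := r :* (p :* k)) refl (pow ρ h) (1ℚ + r) (pow κ h) ⟩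
    (1ℚ + r) * (pow ρ h * pow κ h)
      ≡⟨ cong ((1ℚ + r) *_) (trans (sym (pow-* ρ κ h)) (trans (cong (λ x → pow x h) ρ*κ≡1) (pow-1 h))) ⟩
    (1ℚ + r) * 1ℚ
      ≡⟨ ℚ.*-identityʳ (1ℚ + r) ⟩
    1ℚ + r
      ∎
    where open ℚ.≤-Reasoning

  admissible : ∀ ε → (Eventually λ i → recip b ≤ℚ seq ε i) → Admissible (suc h) ε (suc (suc m) ^ h)
  admissible ε (K , hK) = Bounds.dominated-admissible m h ε
    (K , λ i K≤i → ℚ.≤-trans ρ^h≤ (ℚ.+-monoʳ-≤ 1ℚ (hK i K≤i)))

  -- Since M t = n(t + (b + 1)t) ≤ 18n, the n - 1 levels use up n - 1 factors of the bound, and the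
  -- last one absorbs the remaining factor t ≤ 9. All N up to `M ^ h` are covered for the sake of
  -- the minimum.
  withinBound : ∀ ε → (Eventually λ i → recip b ≤ℚ seq ε i × ι (suc b) * seq ε i ≤ℚ ι 9) →
                ∀ N → N ≤ suc (suc m) ^ h → WithinBound (fromℚ (ι 18)) (suc h) ε N
  withinBound ε (K , hK) N N≤M^h δ 0<δ = K , λ i K≤i → ≤-+ʳ δ (ℚ.<⇒≤ 0<δ) (subst₂ _≤ℚ_
    (cong₂ _*_ (sym (n/1≡ι N)) (sym (seq-^ᴿ ε n i)))
    (trans (cong (λ x → pow (ι 18 * x) n) (sym (n/1≡ι n))) (sym (seq-^ᴿ (fromℚ (ι 18) *ᴿ fromℕ n) n i)))
    (bound (seq ε i) (proj₁ (hK i K≤i)) (proj₂ (hK i K≤i))))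
    where
    open ℚ.≤-Reasoning
    bound : ∀ t → recip b ≤ℚ t → ι (suc b) * t ≤ℚ ι 9 → ι N * pow t n ≤ℚ pow (ι 18 * ι n) n
    bound t r≤t bt≤9 = begin
      ι N * pow t n
        ≤⟨ *-monoʳ (0≤pow 0≤t n) (ι-mono N≤M^h) ⟩
      ι (suc (suc m) ^ h) * (t * pow t h)
        ≡⟨ cong (_* (t * pow t h)) (ι-^ M h) ⟩
      pow (ι M) h * (t * pow t h)
        ≡⟨ solve 3 (λ p t q → p :* (t :* q) := t :* (p :* q)) refl (pow (ι M) h) t (pow t h) ⟩
      t * (pow (ι M) h * pow t h)
        ≡⟨ cong (t *_) (sym (pow-* (ι M) t h)) ⟩
      t * pow (ι M * t) h
        ≤⟨ *-monoˡ 0≤t (pow-mono (0≤* (0≤ι M) 0≤t) Mt≤c h) ⟩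
      t * pow c h
        ≤⟨ *-monoʳ (0≤pow 0≤c h) t≤c ⟩
      c * pow c h
        ∎
      where
      c : ℚ
      c = ι 18 * ι n
      0≤t : 0ℚ ≤ℚ t
      0≤t = ℚ.≤-trans (0≤recip b) r≤t
      0≤c : 0ℚ ≤ℚ c
      0≤c = 0≤* (0≤ι 18) (0≤ι n)
      t≤9 : t ≤ℚ ι 9
      t≤9 = ℚ.≤-trans (subst (t ≤ℚ_)
        (solve 2 (λ t b → t :+ b :* t := (con 1ℚ :+ b) :* t) refl t (ι b))
        (≤-+ʳ (ι b * t) (0≤* (0≤ι b) 0≤t) ℚ.≤-refl)) bt≤9
      t≤c : t ≤ℚ c
      t≤c = ℚ.≤-trans t≤9 (ℚ.≤-trans (ι-mono {9} {18} (ℕ.m≤m+n 9 9)) (subst (_≤ℚ c) (ℚ.*-identityʳ (ι 18))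
        (*-monoˡ (0≤ι 18) (≤-+ʳ (ι h) (0≤ι h) ℚ.≤-refl))))
      Mt≤c : ι M * t ≤ℚ c
      Mt≤c = begin
        ι M * t
          ≡⟨ cong (_* t) (trans (cong ι M≡) (ι-* n (suc (suc b)))) ⟩
        ι n * ι (suc (suc b)) * t
          ≡⟨ solve 3 (λ n s t → n :* (con 1ℚ :+ s) :* t := n :* (t :+ s :* t)) refl (ι n) (ι (suc b)) t ⟩
        ι n * (t + ι (suc b) * t)
          ≤⟨ *-monoˡ (0≤ι n) (ℚ.+-mono-≤ t≤9 bt≤9) ⟩
        ι n * (ι 9 + ι 9)
          ≡⟨ ℚ.*-comm (ι n) (ι 18) ⟩
        c
          ∎

-- The denominator serves as the multiple, since the numerator is at least 1.
positive-multiple : ∀ q → 0ℚ <ℚ q → ∃ λ k → 1ℚ ≤ℚ ι k * q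
positive-multiple q@(mkℚ (ℤ.+ suc k) d _) _ = suc d , subst (1ℚ ≤ℚ_) (sym (trans
  (ℚ.*-comm (ι (suc d)) q)
  (trans (cong (_* ι (suc d)) (sym (ℚ.↥p/↧p≡p q))) (k/d*d≡k (suc k) (suc d)))))
  (≤-+ʳ (ι k) (0≤ι k) ℚ.≤-refl)
positive-multiple (mkℚ (ℤ.+ zero)  _ _) 0<q with ℚ.drop-*<* 0<q
... | ℤ.+<+ ()
positive-multiple (mkℚ ℤ.-[1+ _ ]  _ _) 0<q with ℚ.drop-*<* 0<q
... | ()

-- With q half of a late approximation of ε, all later ones lie between q and 3q. Choosing b with bq
-- ≤ 1 ≤ (b + 1)q gives 1/(b + 1) ≤ q, while (b + 1) · 3q = 3bq + 3q ≤ 3 + 6. Hence the 9, and C = 2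
-- · 9.
approximation : ∀ ε → 0ᴿ <ᴿ ε → ε ≤ᴿ 1ᴿ →
                ∃ λ b → Eventually λ i → recip b ≤ℚ seq ε i × ι (suc b) * seq ε i ≤ℚ ι 9
approximation ε (δ , 0<δ , K₁ , δ≤ε) ε≤1 = b , K , λ i K≤i →
  ℚ.≤-trans r≤q (q≤ε i K≤i) , (begin
    ι (suc b) * seq ε i
      ≤⟨ *-monoˡ (0≤ι (suc b)) (ε≤3q i K≤i) ⟩
    ι (suc b) * (e + q)
      ≡⟨ trans (cong (λ x → ι (suc b) * (x + q)) (sym (½+½ e)))
           (solve 2 (λ b q → (con 1ℚ :+ b) :* (q :+ q :+ q) := b :* q :+ b :* q :+ b :* q :+ (q :+ q :+ q)) refl (ι b) q) ⟩
    ι b * q + ι b * q + ι b * q + (q + q + q)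
      ≤⟨ ℚ.+-mono-≤ (ℚ.+-mono-≤ (ℚ.+-mono-≤ bq≤1 bq≤1) bq≤1) (ℚ.+-mono-≤ (ℚ.+-mono-≤ q≤2 q≤2) q≤2) ⟩
    ι 9
      ∎)
  where
  open ℚ.≤-Reasoning
  C = cauchy ε (½ * δ) (0<½* 0<δ)
  L = ε≤1 1ℚ (ℚ.positive⁻¹ 1ℚ)
  K K₂ K₃ : ℕ
  K₂ = proj₁ C
  K₃ = proj₁ L
  K = K₁ ℕ.⊔ (K₂ ℕ.⊔ K₃)
  K₁≤K : K₁ ≤ K
  K₁≤K = ℕ.m≤m⊔n K₁ (K₂ ℕ.⊔ K₃)
  K₂≤K : K₂ ≤ K
  K₂≤K = ℕ.≤-trans (ℕ.m≤m⊔n K₂ K₃) (ℕ.m≤n⊔m K₁ (K₂ ℕ.⊔ K₃))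
  K₃≤K : K₃ ≤ K
  K₃≤K = ℕ.≤-trans (ℕ.m≤n⊔m K₂ K₃) (ℕ.m≤n⊔m K₁ (K₂ ℕ.⊔ K₃))
  e q : ℚ
  e = seq ε K
  q = ½ * e
  δ≤e : δ ≤ℚ e
  δ≤e = subst (_≤ℚ e) (ℚ.+-identityˡ δ) (δ≤ε K K₁≤K)
  0<e : 0ℚ <ℚ e
  0<e = ℚ.<-≤-trans 0<δ δ≤e
  close : ∀ i j → K ≤ i → K ≤ j → seq ε i ≤ℚ seq ε j + q
  close i j K≤i K≤j = begin
    seq ε i
      ≡⟨ solve 2 (λ x y → x := y :+ (x :- y)) refl (seq ε i) (seq ε j) ⟩
    seq ε j + (seq ε i - seq ε j)
      ≤⟨ ℚ.+-monoʳ-≤ (seq ε j) (ℚ.≤-trans (p≤∣p∣ (seq ε i - seq ε j))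
           (ℚ.≤-trans (proj₂ C i j (ℕ.≤-trans K₂≤K K≤i) (ℕ.≤-trans K₂≤K K≤j))
             (*-monoˡ {r = ½} (ℚ.<⇒≤ (ℚ.positive⁻¹ ½)) δ≤e))) ⟩
    seq ε j + q
      ∎
    where
    p≤∣p∣ : ∀ p → p ≤ℚ ∣ p ∣
    p≤∣p∣ p with ℚ.≤-total 0ℚ p
    ... | inj₁ 0≤p = ℚ.≤-reflexive (sym (ℚ.0≤p⇒∣p∣≡p 0≤p))
    ... | inj₂ p≤0 = ℚ.≤-trans p≤0 (ℚ.0≤∣p∣ p)
  ε≤3q : ∀ i → K ≤ i → seq ε i ≤ℚ e + q
  ε≤3q i K≤i = close i K K≤i ℕ.≤-refl
  q≤ε : ∀ i → K ≤ i → q ≤ℚ seq ε i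
  q≤ε i K≤i = begin
    q
      ≡⟨ trans (solve 1 (λ q → q := q :+ q :- q) refl q) (cong (_- q) (½+½ e)) ⟩
    e - q
      ≤⟨ ℚ.+-monoˡ-≤ (- q) (close K i ℕ.≤-refl K≤i) ⟩
    seq ε i + q - q
      ≡⟨ solve 2 (λ x q → x :+ q :- q := x) refl (seq ε i) q ⟩
    seq ε i
      ∎
  -- The bound `ε ≤ᴿ 1ᴿ` is used with slack 1, which is where the 2 comes from.
  q≤2 : q ≤ℚ ι 2
  q≤2 = ℚ.≤-trans (q≤ε K ℕ.≤-refl) (proj₂ L K K₃≤K)
  search : ∀ k → 1ℚ ≤ℚ ι k * q → ∃ λ b → ι b * q ≤ℚ 1ℚ × 1ℚ ≤ℚ ι (suc b) * q
  search zero    1≤0 = ⊥-elim (ℚ.<-irrefl refl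
    (ℚ.<-≤-trans (ℚ.positive⁻¹ 1ℚ) (ℚ.≤-trans 1≤0 (ℚ.≤-reflexive (ℚ.*-zeroˡ q)))))
  search (suc k) 1≤k with 1ℚ ℚ.≤? ι k * q
  ... | yes 1≤k′ = search k 1≤k′
  ... | no  1≰k′ = k , ℚ.<⇒≤ (ℚ.≰⇒> 1≰k′) , 1≤k
  found = let k , 1≤kq = positive-multiple q (0<½* 0<e) in search k 1≤kq
  b : ℕ
  b = proj₁ found
  bq≤1 : ι b * q ≤ℚ 1ℚ
  bq≤1 = proj₁ (proj₂ found)
  r≤q : recip b ≤ℚ q
  r≤q = subst₂ _≤ℚ_ (ℚ.*-identityʳ (recip b)) (recip-cancel b q) (*-monoˡ (0≤recip b) (proj₂ (proj₂ found)))

theorem5p2 : ∃ λ (C : ℝ) → 0ᴿ <ᴿ C ×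
    (∀ (n : ℕ) → 1 ≤ n → ∀ (ε : ℝ) → 0ᴿ <ᴿ ε → ε ≤ᴿ 1ᴿ → CardinalComplexity≤ C n ε)
theorem5p2 = fromℚ (ι 18) , (1ℚ , ℚ.positive⁻¹ 1ℚ , 0 , λ _ _ → ι-mono {1} {18} (s≤s z≤n)) ,
  λ { (suc h) _ ε 0<ε ε≤1 →
    let b , K , hK = approximation ε 0<ε ε≤1
        -- This is the m for which m + 2 = (h + 1)(b + 2) holds by computation.
        m      = b ℕ.+ h ℕ.* suc (suc b)
        within = withinBound m b h refl ε (K , hK)
        adm    = admissible m b h refl ε (K , λ i K≤i → proj₁ (hK i K≤i))
    -- The minimum is at most the size just exhibited, and `within` accepts every smaller size.
    in (_ , adm , within _ ℕ.≤-refl) , λ κ (_ , κ-least) → within κ (κ-least _ adm) }
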